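{- Let $s,t$ be positive integers and $a,b$ integers with $0\le a<s$ and $0\le b<t$. Let $g=\gcd(s,t)$ and assume $g$ and $a-b$ are coprime. Then \[ \bigl|\mathcal{C}_{(s|0,a)}\cap\mathcal{C}_{(t|0,b)}\cap\mathcal{C}_g^2\bigr|=\frac1g\,\bigl|U_g^{s,a}\bigr|\,\bigl|U_g^{t,b}\bigr|. \] In particular, if $s$ divides $t$, then $\bigl|\mathcal{C}_{(s|0,a)}\cap\mathcal{C}_{(t|0,b)}\bigr|=\frac1s\binom sa\bigl|U_s^{t,b}\bigr|$.
   Context: A partition is a weakly decreasing sequence of non-negative integers with finite sum; a bipartition is a pair $(\lambda,\mu)$ of partitions, with nodes $(a,b,1)$ for $b\le\lambda_a$ and $(a,b,2)$ for $b\le\mu_a$. For $s\ge0$ and $c=(c_1,c_2)\in\mathbb{Z}^2$, the $(s\,|\,c)$-residue of a node $(a,b,k)$ is $b-a+c_k+s\mathbb{Z}$, and the $(s\,|\,c)$-content of a bipartition is the multiset of residues of its nodes. A bipartition is an $(s\,|\,c)$-core if no other bipartition has the same $(s\,|\,c)$-content (for $s=1$ the only $(1\,|\,c)$-core is $(\varnothing,\varnothing)$); $\mathcal{C}_{(s|c_1,c_2)}$ is the set of such cores. A partition is a $g$-core if none of its hook lengths equals $g$; $\mathcal{C}_g^2$ denotes the set of bipartitions both of whose components are $g$-cores. For positive integers $g\mid s$ and integer $a$, $U_g^{s,a}$ is the set of functions $u:\mathbb{Z}/g\mathbb{Z}\to\mathbb{Z}$ with $\sum_{i\in\mathbb{Z}/g\mathbb{Z}}u_i=a$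 and $0\le u_i\le s/g$ for all $i$. -}

module Defs where

open import Data.Nat using (ℕ; zero; suc; _+_; _*_; _∸_; _≤_; _<_; _≥_; _≤ᵇ_)
open import Data.Nat.DivMod using (_/_)
open import Data.Integer using (ℤ; +_) renaming (_+_ to _+ℤ_; _-_ to _-ℤ_)
open import Data.Integer.DivMod using (_%ℕ_)
open import Data.List using (List; []; _∷_; _++_; map; length; applyUpTo; concat; filter)
open import Data.Nat.ListAction using (sum)
open import Data.List.Relation.Unary.All using (All)
open import Data.List.Relation.Unary.Linked using (Linked)
open import Data.List.Relation.Unary.Unique.Propositional using (Unique)
open import Data.List.Membership.Propositional using (_∈_; _∉_)
open import Data.List.Relation.Binary.Permutation.Propositional using (_↭_)
open import Data.Vec using (Vec) renaming (toList to vecToList)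
open import Data.Product using (_×_; _,_; proj₁; proj₂; ∃)
open import Relation.Binary.PropositionalEquality using (_≡_)
open import Function.Bundles using (_⇔_)
open import Relation.Nullary.Decidable using (yes; no)
open import Data.Nat.Properties using (_≤?_)

-- Partitions: a partition is represented by its list of NONZERO parts,
-- weakly decreasing (the trailing zeros of the infinite sequence are
-- dropped, so each partition has a unique representative).

IsPartition : List ℕ → Set
IsPartition λ′ = Linked _≥_ λ′ × All (λ p → 1 ≤ p) λ′

Bipartition : Set
Bipartition = List ℕ × List ℕ

IsBipartition : Bipartition → Set
IsBipartition (λ′ , μ) = IsPartition λ′ × IsPartition μ

-- Residues.  The residue class b - a + c + sℤ is represented by its
-- canonical representative: for s = 0 the integer itself, for s > 0
-- the least non-negative representative.

reduce : ℕ → ℤ → ℤ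
reduce zero    z = z
reduce (suc k) z = + (z %ℕ suc k)

-- integers b - a + c for the nodes (a , b) of a partition with charge c
-- (rows a = i+1 with i starting at 0; columns b = b'+1 with b' from 0)
rowVals : ℤ → ℕ → ℕ → List ℤ
rowVals c i l = applyUpTo (λ b′ → ((+ b′) -ℤ (+ i)) +ℤ c) l

partVals : ℤ → ℕ → List ℕ → List ℤ
partVals c i []       = []
partVals c i (l ∷ ls) = rowVals c i l ++ partVals c (suc i) ls

content : ℕ → ℤ × ℤ → Bipartition → List ℤ
content s (c₁ , c₂) (λ′ , μ) = map (reduce s) (partVals c₁ 0 λ′ ++ partVals c₂ 0 μ)

SameContent : ℕ → ℤ × ℤ → Bipartition → Bipartition → Set
SameContent s c β β′ = content s c β ↭ content s c β′

IsCore : ℕ → ℤ × ℤ → Bipartition → Set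
IsCore s c β = IsBipartition β ×
  (∀ β′ → IsBipartition β′ → SameContent s c β′ β → β′ ≡ β)

-- length of column b (1-indexed) = number of parts ≥ b
colLen : List ℕ → ℕ → ℕ
colLen λ′ b = length (filter (λ p → b ≤? p) λ′)

-- hook length of node (a , b) = (λ_a - b) + (λ'_b - a) + 1
rowHooks : List ℕ → ℕ → ℕ → List ℕ
rowHooks λ′ i l = applyUpTo (λ b′ → ((l ∸ suc b′) + (colLen λ′ (suc b′) ∸ suc i)) + 1) l

hooksFrom : List ℕ → ℕ → List ℕ → List ℕ
hooksFrom λ′ i []       = []
hooksFrom λ′ i (l ∷ ls) = rowHooks λ′ i l ++ hooksFrom λ′ (suc i) ls

hooks : List ℕ → List ℕ
hooks λ′ = hooksFrom λ′ 0 λ′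

IsGCore : ℕ → List ℕ → Set
IsGCore g λ′ = g ∉ hooks λ′

IsGCore² : ℕ → Bipartition → Set
IsGCore² g (λ′ , μ) = IsGCore g λ′ × IsGCore g μ

HasCard : {A : Set} → (A → Set) → ℕ → Set
HasCard {A} P n = ∃ λ (xs : List A) → Unique xs × length xs ≡ n × (∀ x → (x ∈ xs) ⇔ P x)

-- U_g^{s,a}: functions u : ℤ/gℤ → ℤ with Σ u_i = a and 0 ≤ u_i ≤ s/g,
-- represented as vectors of naturals of length g (u_i ≥ 0).

-- integer division, only used for positive divisors
quot : ℕ → ℕ → ℕ
quot s zero    = 0
quot s (suc k) = s / suc k

InU : (g s a : ℕ) → Vec ℕ g → Set
InU g s a u = sum (vecToList u) ≡ a × All (λ x → x ≤ quot s g) (vecToList u)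

{-# OPTIONS --safe #-}
module Submission where

-- Record a partition by its β-set X = { λ_a - a }. A bipartition with β-sets X and Y is an
-- (s | 0 , a)-core exactly when X ⊆ Y + a ⊆ X + s: otherwise a bead of X and a bead of Y can be
-- exchanged (up to a shift by s) without changing the content, and if the inclusions hold then the
-- sum of the s-heights of X and Y is a weight, determined by the content, that is nonnegative
-- exactly on the beads.
--
-- If X and Y are g-cores with heights π and κ (so X = { π ≥ 0 } and π (z + g) = π z - 1), the two
-- core conditions say that u z = κ (z - a) - π z and v z = κ (z - b) - π z lie in [0 , s/g] and
-- [0 , t/g]; both are g-periodic, and their sums over a period are a and b. Conversely (u , v)
-- prescribes π (z + b - a) - π z, so, b - a being prime to g, it determines π up to a constant.
-- Hence (u , v) determines (X , Y) up to a common shift, and the shifts by 0 , … , g - 1 of a core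
-- give distinct pairs (u , v). This makes Fin g × cores equinumerous with U_g^{s,a} × U_g^{t,b}.

open import Defs
open import Data.Bool using (Bool; true; false; _∨_; _∧_; not)
open import Data.Bool.Properties using (∧-zeroʳ; ∧-identityʳ; ∨-zeroʳ)
open import Data.Empty using (⊥; ⊥-elim)
open import Data.Fin using (Fin; zero; suc; toℕ; fromℕ<)
open import Data.Fin.Properties using (toℕ<n; toℕ-fromℕ<; toℕ-injective)
open import Data.Integer using (ℤ; +_; -[1+_]; _+_; _*_; _-_; -_; 0ℤ; 1ℤ; _≤_; _≤?_; _≟_; +≤+; -≤+; ∣_∣)
open import Data.Integer.DivMod using (_%ℕ_; _/ℕ_; n%ℕd<d; a≡a%ℕn+[a/ℕn]*n)
open import Data.Integer.Properties hiding (_≟_; _≤?_; module ≤-Reasoning)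
open import Data.Integer.Tactic.RingSolver using (solve-∀)
open import Data.List using (List; []; _∷_; length; filter; applyUpTo; _++_; map; cartesianProduct;
  cartesianProductWith; upTo; deduplicate)
open import Data.List.Properties using (filter-accept; filter-none; length-map; length-++; length-upTo)
import Data.List.Properties as List
open import Data.List.Membership.Propositional using (_∈_; mapWith∈)
open import Data.List.Membership.Propositional.Properties using (∈-applyUpTo⁺; ∈-applyUpTo⁻; ∈-∃++;
  ∈-map⁺; ∈-map⁻; ∈-++⁺ˡ; ∈-++⁺ʳ; ∈-++⁻; ∈-upTo⁺; ∈-upTo⁻; ∈-filter⁺; ∈-filter⁻; ∈-deduplicate⁺;
  ∈-deduplicate⁻; ∈-cartesianProduct⁺; ∈-cartesianProduct⁻; ∈-cartesianProductWith⁺; ∈-cartesianProductWith⁻)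
open import Data.List.Relation.Binary.Permutation.Propositional as Perm using (_↭_; prep; swap; ↭-refl; ↭-sym; ↭-trans)
open import Data.List.Relation.Binary.Permutation.Propositional.Properties using (shift; ∈-resp-↭)
open import Data.List.Relation.Unary.All as All using (All; []; _∷_)
open import Data.List.Relation.Unary.AllPairs using ([]; _∷_)
open import Data.List.Relation.Unary.Any using (here; there)
open import Data.List.Relation.Unary.Linked as Linked using ([]; [-]; _∷_)
open import Data.List.Relation.Unary.Linked.Properties using (Linked⇒AllPairs)
open import Data.List.Relation.Unary.Unique.Propositional using (Unique)
open import Data.List.Relation.Unary.Unique.Propositional.Properties using (map⁺; ++⁺; upTo⁺; filter⁺;
  cartesianProduct⁺; cartesianProductWith⁺)
import Data.List.Relation.Unary.Unique.DecPropositional.Properties as DecUnique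
open import Data.Nat as ℕ using (ℕ; zero; suc; z≤n; s≤s)
import Data.Nat.Properties as ℕ
open import Data.Nat.Combinatorics using (_C_; nCn≡1; nCk≡nC[n∸k]; k>n⇒nCk≡0; nCk+nC[k+1]≡[n+1]C[k+1])
open import Data.Nat.Coprimality using (Coprime; coprime-Bézout)
open import Data.Nat.DivMod using (m<n⇒m%n≡m; m*n/n≡m; n/n≡1)
open import Data.Nat.Divisibility using (_∣_; divides; ∣-refl; ∣-antisym)
open import Data.Nat.GCD using (module Bézout; gcd; gcd[m,n]∣m; gcd[m,n]∣n; gcd-greatest; gcd[m,n]≢0)
open import Data.Nat.ListAction using (sum)
open import Data.Product using (_×_; _,_; ∃; proj₁; proj₂; Σ)
import Data.Product.Properties as Product
open import Data.Sum using (_⊎_; inj₁; inj₂)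
open import Data.Vec using (Vec; []; _∷_; lookup; tabulate; toList)
open import Data.Vec.Properties using (lookup∘tabulate; tabulate∘lookup; tabulate-cong)
open import Function.Bundles using (mk⇔; Equivalence)
open import Relation.Binary.Definitions using (DecidableEquality)
open import Relation.Nullary using (¬_; yes; no; ⌊_⌋)
open import Relation.Binary.PropositionalEquality using (_≡_; _≢_; refl; sym; trans; cong; cong₂; subst; module ≡-Reasoning)

-- A content is a multiset of residues, and β-sets are infinite. Both difficulties are met by
-- testing with potentials: if `φ` has `s`-periodic increments, the sum of `Δ φ` over the content
-- telescopes along rows and becomes a sum of `φ` over beads, taken relative to the empty partition.
-- Agreement for all such `φ` is the same as equality of contents, and this serves both directions
-- of the core criterion. The sum of two `s`-heights is such a potential, because it drops by the
-- constant 2 under a shift by `s`. The factor 1/g is a matter of charge. The equations determine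
-- `π` only up to a constant, and a set of height `π` comes from a partition only if `π z + 1` sums
-- to 0 over a period. Adding a constant changes this sum by a multiple of `g`, and shifting the
-- argument by `i` lowers it by `i`, so exactly one `i` among `0 , … , g - 1` is possible for a
-- given pair. The set of height `κ` then has charge 0 by itself, since `u` sums to `a`.

-- Linear inequalities over the integers

-- The pattern of all later estimates: the slack `y - x` is written as a sum of known nonnegative
-- gaps, joined by `⊕`, and the ring solver checks the identity.
≤-by : ∀ {x y p} → 0ℤ ≤ p → y - x ≡ p → x ≤ y
≤-by 0≤p eq = 0≤i-j⇒j≤i (subst (0ℤ ≤_) (sym eq) 0≤p)

infixl 6 _⊕_
_⊕_ : ∀ {p q} → 0ℤ ≤ p → 0ℤ ≤ q → 0ℤ ≤ p + q
_⊕_ = +-mono-≤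

0≤+ : ∀ {n} → 0ℤ ≤ + n
0≤+ = +≤+ z≤n

gap : ∀ {x y} → x ≤ y → 0ℤ ≤ y - x
gap = i≤j⇒0≤j-i

x+1≰x : ∀ {x} → ¬ (x + 1ℤ ≤ x)
x+1≰x {x} p with subst (0ℤ ≤_) (lem x) (gap p)
  where
  lem : ∀ x → x - (x + 1ℤ) ≡ -[1+ 0 ]
  lem = solve-∀
... | ()

≤-or-> : ∀ x y → x ≤ y ⊎ y + 1ℤ ≤ x
≤-or-> x y with x ≤? y
... | yes p = inj₁ p
... | no p = inj₂ (subst (_≤ x) (+-comm 1ℤ y) (i<j⇒suc[i]≤j (≰⇒> p)))

<-absurd : ∀ {x y} → x + 1ℤ ≤ y → ¬ (y ≤ x)
<-absurd p q = x+1≰x (≤-trans p q)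

0≤-* : ∀ {x y} → 0ℤ ≤ x → 0ℤ ≤ y → 0ℤ ≤ x * y
0≤-* {+ m} {+ n} _ _ = subst (0ℤ ≤_) (pos-* m n) 0≤+
0≤-* {+ _} { -[1+ _ ]} _ ()
0≤-* { -[1+ _ ]} ()

ι : Bool → ℤ
ι true  = 1ℤ
ι false = 0ℤ

nonneg : ℤ → Bool
nonneg (+ _)    = true
nonneg -[1+ _ ] = false

nonneg-true : ∀ {z} → 0ℤ ≤ z → nonneg z ≡ true
nonneg-true (+≤+ _) = refl

nonneg-false : ∀ {z} → z + 1ℤ ≤ 0ℤ → nonneg z ≡ false
nonneg-false {+ n} p = ⊥-elim (<-absurd p 0≤+)
nonneg-false { -[1+ n ]} p = refl

true-nonneg : ∀ {z} → nonneg z ≡ true → 0ℤ ≤ z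
true-nonneg {+ _} _ = 0≤+

false-nonneg : ∀ {z} → nonneg z ≡ false → z + 1ℤ ≤ 0ℤ
false-nonneg { -[1+ zero ]} _ = +≤+ z≤n
false-nonneg { -[1+ suc n ]} _ = -≤+

-- Finite sums over integer intervals

sumFrom : ℤ → ℕ → (ℤ → ℤ) → ℤ
sumFrom A zero    f = 0ℤ
sumFrom A (suc n) f = f A + sumFrom (A + 1ℤ) n f

private
  suc-end : ∀ A n → (A + 1ℤ) + + n ≡ A + + suc n
  suc-end A n = +-assoc A 1ℤ (+ n)

  head-in : ∀ A n → A + 1ℤ ≤ A + + suc n
  head-in A n = +-monoʳ-≤ A (+≤+ (s≤s z≤n))

  tail≤ : ∀ {A z} → A + 1ℤ ≤ z → A ≤ z
  tail≤ {A} p = ≤-trans (i≤i+j A 1ℤ) p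

sum-cong-in : ∀ {f g} A n → (∀ z → A ≤ z → z + 1ℤ ≤ A + + n → f z ≡ g z) → sumFrom A n f ≡ sumFrom A n g
sum-cong-in A zero    h = refl
sum-cong-in A (suc n) h = cong₂ _+_ (h A ≤-refl (head-in A n))
  (sum-cong-in (A + 1ℤ) n λ z p q → h z (tail≤ p) (subst (z + 1ℤ ≤_) (suc-end A n) q))

sum-cong : ∀ {f g} A n → (∀ z → f z ≡ g z) → sumFrom A n f ≡ sumFrom A n g
sum-cong A n h = sum-cong-in A n λ z _ _ → h z

sum-+ : ∀ A n f g → sumFrom A n (λ z → f z + g z) ≡ sumFrom A n f + sumFrom A n g
sum-+ A zero    f g = refl
sum-+ A (suc n) f g rewrite sum-+ (A + 1ℤ) n f g = lem (f A) (g A) _ _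
  where
  lem : ∀ a b c d → a + b + (c + d) ≡ a + c + (b + d)
  lem = solve-∀

sum-const : ∀ A n c → sumFrom A n (λ _ → c) ≡ + n * c
sum-const A zero    c = sym (*-zeroˡ c)
sum-const A (suc n) c rewrite sum-const (A + 1ℤ) n c = lem (+ n) c
  where
  lem : ∀ n c → c + n * c ≡ (1ℤ + n) * c
  lem = solve-∀

sum-- : ∀ A n f g → sumFrom A n (λ z → f z - g z) ≡ sumFrom A n f - sumFrom A n g
sum-- A zero    f g = refl
sum-- A (suc n) f g rewrite sum-- (A + 1ℤ) n f g = lem (f A) (g A) _ _
  where
  lem : ∀ a b c d → a - b + (c - d) ≡ a + c - (b + d)
  lem = solve-∀

sum-shift : ∀ A n k f → sumFrom A n (λ z → f (z + k)) ≡ sumFrom (A + k) n f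
sum-shift A zero    k f = refl
sum-shift A (suc n) k f = cong (_+_ (f (A + k))) (trans (sum-shift (A + 1ℤ) n k f)
  (cong (λ B → sumFrom B n f) (lem A k)))
  where
  lem : ∀ A k → A + 1ℤ + k ≡ A + k + 1ℤ
  lem = solve-∀

sum-++ : ∀ A m n f → sumFrom A (m ℕ.+ n) f ≡ sumFrom A m f + sumFrom (A + + m) n f
sum-++ A zero    n f = trans (cong (λ B → sumFrom B n f) (sym (+-identityʳ A))) (sym (+-identityˡ _))
sum-++ A (suc m) n f = trans (cong (_+_ (f A)) (trans (sum-++ (A + 1ℤ) m n f)
  (cong (λ B → sumFrom (A + 1ℤ) m f + sumFrom B n f) (suc-end A m)))) (sym (+-assoc (f A) _ _))

sum-snoc : ∀ A n f → sumFrom A (suc n) f ≡ sumFrom A n f + f (A + + n)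
sum-snoc A n f = trans (cong (λ k → sumFrom A k f) (ℕ.+-comm 1 n))
  (trans (sum-++ A n 1 f) (cong (_+_ (sumFrom A n f)) (+-identityʳ _)))

sum-nonneg : ∀ A n f → (∀ z → A ≤ z → z + 1ℤ ≤ A + + n → 0ℤ ≤ f z) → 0ℤ ≤ sumFrom A n f
sum-nonneg A zero    f h = ≤-refl
sum-nonneg A (suc n) f h = h A ≤-refl (head-in A n) ⊕
  sum-nonneg (A + 1ℤ) n f λ z p q → h z (tail≤ p) (subst (z + 1ℤ ≤_) (suc-end A n) q)

sum-zero : ∀ A n f → (∀ z → A ≤ z → z + 1ℤ ≤ A + + n → f z ≡ 0ℤ) → sumFrom A n f ≡ 0ℤ
sum-zero A n f h = trans (sum-cong-in A n h) (trans (sum-const A n 0ℤ) (*-zeroʳ (+ n)))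

+≡0⇒≡0ˡ : ∀ {a b} → 0ℤ ≤ a → 0ℤ ≤ b → a + b ≡ 0ℤ → a ≡ 0ℤ
+≡0⇒≡0ˡ {a} {b} p q eq = ≤-antisym (≤-by q (trans (cong (_- a) (sym eq)) (lem a b))) p
  where
  lem : ∀ a b → a + b - a ≡ b
  lem = solve-∀

sum≡0⇒≡0 : ∀ A n f → (∀ z → 0ℤ ≤ f z) → sumFrom A n f ≡ 0ℤ →
  ∀ z → A ≤ z → z + 1ℤ ≤ A + + n → f z ≡ 0ℤ
sum≡0⇒≡0 A zero    f h eq z p q = ⊥-elim (<-absurd q (subst (_≤ z) (sym (+-identityʳ A)) p))
sum≡0⇒≡0 A (suc n) f h eq z p q with ≤-or-> z A
... | inj₁ z≤A = subst (λ w → f w ≡ 0ℤ) (≤-antisym p z≤A)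
  (+≡0⇒≡0ˡ (h A) (sum-nonneg (A + 1ℤ) n f λ w _ _ → h w) eq)
... | inj₂ A<z = sum≡0⇒≡0 (A + 1ℤ) n f h
  (+≡0⇒≡0ˡ (sum-nonneg (A + 1ℤ) n f λ w _ _ → h w) (h A) (trans (+-comm _ (f A)) eq))
  z A<z (subst (z + 1ℤ ≤_) (sym (suc-end A n)) q)

δ : ℤ → ℤ → ℤ
δ y z = ι ⌊ z ≟ y ⌋

δ-refl : ∀ y → δ y y ≡ 1ℤ
δ-refl y with y ≟ y
... | yes _ = refl
... | no y≢y = ⊥-elim (y≢y refl)

δ-≢ : ∀ {y z} → z ≢ y → δ y z ≡ 0ℤ
δ-≢ {y} {z} z≢y with z ≟ y
... | yes p = ⊥-elim (z≢y p)
... | no _  = refl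

<⇒≢ʳ : ∀ {x y} → x + 1ℤ ≤ y → y ≢ x
<⇒≢ʳ p refl = x+1≰x p

<⇒≢ˡ : ∀ {x y} → x + 1ℤ ≤ y → x ≢ y
<⇒≢ˡ p refl = x+1≰x p

sum-δ : ∀ A n y (f : ℤ → ℤ) → A ≤ y → y + 1ℤ ≤ A + + n → sumFrom A n (λ z → δ y z * f z) ≡ f y
sum-δ A zero    y f p q = ⊥-elim (<-absurd q (subst (_≤ y) (sym (+-identityʳ A)) p))
sum-δ A (suc n) y f p q with ≤-or-> y A
... | inj₁ y≤A with ≤-antisym p y≤A
...   | refl = trans (cong₂ _+_ (trans (cong (_* f A) (δ-refl A)) (*-identityˡ (f A)))
  (sum-zero (A + 1ℤ) n _ λ z p′ _ → trans (cong (_* f z) (δ-≢ (<⇒≢ʳ p′))) (*-zeroˡ (f z))))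
  (+-identityʳ (f A))
sum-δ A (suc n) y f p q | inj₂ A<y = trans (cong₂ _+_ (trans (cong (_* f A) (δ-≢ {y} {A} (<⇒≢ˡ A<y))) (*-zeroˡ (f A)))
  (sum-δ (A + 1ℤ) n y f A<y (subst (y + 1ℤ ≤_) (sym (suc-end A n)) q))) (+-identityˡ (f y))

search : ∀ A n (P : ℤ → Bool) → (∃ λ y → P y ≡ true) ⊎ (∀ z → A ≤ z → z + 1ℤ ≤ A + + n → P z ≡ false)
search A zero    P = inj₂ λ z p q → ⊥-elim (<-absurd q (subst (_≤ z) (sym (+-identityʳ A)) p))
search A (suc n) P with P A in eq | search (A + 1ℤ) n P
... | true  | _ = inj₁ (A , eq)
... | false | inj₁ r = inj₁ r
... | false | inj₂ h = inj₂ go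
  where
  go : ∀ z → A ≤ z → z + 1ℤ ≤ A + + suc n → P z ≡ false
  go z p q with ≤-or-> z A
  ... | inj₁ z≤A = trans (cong P (≤-antisym z≤A p)) eq
  ... | inj₂ A<z = h z A<z (subst (z + 1ℤ ≤_) (sym (suc-end A n)) q)

-- Both sides differ from the sum over [A , A + n + g) by the same amount.
sum-telescope : ∀ A n g f → sumFrom A n (λ z → f z - f (z + + g)) ≡ sumFrom A g f - sumFrom (A + + n) g f
sum-telescope A n g f = trans (sum-- A n f _)
  (trans (cong (_-_ (sumFrom A n f)) (sum-shift A n (+ g) f))
  (lem (sumFrom A n f) (sumFrom (A + + g) n f) (sumFrom (A + + n) g f) (sumFrom A g f)
      (trans (sym (sum-++ A n g f)) (trans (cong (λ k → sumFrom A k f) (ℕ.+-comm n g)) (sum-++ A g n f)))))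
  where
  lem′ : ∀ a b c → a - b ≡ a + c - b - c
  lem′ = solve-∀
  lem″ : ∀ b c d → d + b - b - c ≡ d - c
  lem″ = solve-∀
  lem : ∀ a b c d → a + c ≡ d + b → a - b ≡ d - c
  lem a b c d eq = trans (lem′ a b c) (trans (cong (λ w → w - b - c) eq) (lem″ b c d))

i≤+∣i∣ : ∀ i → i ≤ + ∣ i ∣
i≤+∣i∣ (+ n) = ≤-refl
i≤+∣i∣ -[1+ n ] = -≤+

-i≤+∣i∣ : ∀ i → - i ≤ + ∣ i ∣
-i≤+∣i∣ i = subst (λ n → - i ≤ + n) (∣-i∣≡∣i∣ i) (i≤+∣i∣ (- i))

win-low : ∀ {k b} → k ℕ.≤ b → - + b + + k ≤ 0ℤ
win-low {k} {b} p = ≤-by (gap (+≤+ p)) (lem (+ b) (+ k))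
  where
  lem : ∀ b k → 0ℤ - (- b + k) ≡ b - k
  lem = solve-∀

win-high : ∀ {k b} → k ℕ.≤ b → + k ≤ - + b + + (b ℕ.+ b)
win-high {k} {b} p = ≤-by (gap (+≤+ p)) (lem (+ b) (+ k))
  where
  lem : ∀ b k → - b + (b + b) - k ≡ b - k
  lem = solve-∀

-- β-sets

-- The β-set { λ_a - a : a ≥ 1 } of a partition.
bead : List ℕ → ℤ → Bool
bead []       z = not (nonneg z)
bead (l ∷ ls) z = ⌊ z ≟ + l - 1ℤ ⌋ ∨ bead ls (z + 1ℤ)

sumOver : ℤ → ℕ → (ℤ → Bool) → (ℤ → ℤ) → ℤ
sumOver A n χ f = sumFrom A n λ z → ι (χ z) * f z

one : ℤ → ℤ
one _ = 1ℤ

⌊≟⌋-refl : ∀ {x y} → x ≡ y → ⌊ x ≟ y ⌋ ≡ true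
⌊≟⌋-refl {x} {y} eq with x ≟ y
... | yes _ = refl
... | no ne = ⊥-elim (ne eq)

⌊≟⌋-≢ : ∀ {x y} → x ≢ y → ⌊ x ≟ y ⌋ ≡ false
⌊≟⌋-≢ {x} {y} ne with x ≟ y
... | yes eq = ⊥-elim (ne eq)
... | no _ = refl

x-1+1 : ∀ x → x - 1ℤ + 1ℤ ≡ x
x-1+1 = solve-∀

x+1-1 : ∀ x → x + 1ℤ - 1ℤ ≡ x
x+1-1 = solve-∀

+1-cancel : ∀ {x y} → x + 1ℤ ≤ y + 1ℤ → x ≤ y
+1-cancel {x} {y} p = ≤-by (gap p) (lem x y)
  where
  lem : ∀ x y → y - x ≡ y + 1ℤ - (x + 1ℤ)
  lem = solve-∀

≤⇒≤+1 : ∀ {x y} → x ≤ y → x ≤ y + 1ℤ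
≤⇒≤+1 {y = y} p = ≤-trans p (i≤i+j y 1ℤ)

tail-partition : ∀ {l ls} → IsPartition (l ∷ ls) → IsPartition ls
tail-partition (li , _ ∷ ps) = Linked.tail li , ps

parts≤head : ∀ {l ls} → IsPartition (l ∷ ls) → All (ℕ._≤ l) ls
parts≤head (li , _) with Linked⇒AllPairs (λ p q → ℕ.≤-trans q p) li
... | ps ∷ _ = ps

bead-high : ∀ {m} ls {z} → All (ℕ._≤ m) ls → + m ≤ z → bead ls z ≡ false
bead-high [] [] p rewrite nonneg-true (≤-trans 0≤+ p) = refl
bead-high (l ∷ ls) {z} (l≤m ∷ ps) p
  rewrite ⌊≟⌋-≢ {z} {+ l - 1ℤ} (<⇒≢ʳ (≤-trans (≤-reflexive (x-1+1 (+ l))) (≤-trans (+≤+ l≤m) p)))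
  = bead-high ls ps (≤⇒≤+1 p)

bead-low : ∀ ls {z} → z + + length ls + 1ℤ ≤ 0ℤ → bead ls z ≡ true
bead-low [] {z} p rewrite nonneg-false {z} (subst (_≤ 0ℤ) (cong (λ w → w + 1ℤ) (+-identityʳ z)) p) = refl
bead-low (l ∷ ls) {z} p = trans
  (cong (⌊ z ≟ + l - 1ℤ ⌋ ∨_) (bead-low ls {z + 1ℤ} (subst (_≤ 0ℤ) (lem z (+ length ls)) p))) (∨-zeroʳ _)
  where
  lem : ∀ z n → z + (1ℤ + n) + 1ℤ ≡ z + 1ℤ + n + 1ℤ
  lem = solve-∀

bead-head : ∀ l ls → bead (l ∷ ls) (+ l - 1ℤ) ≡ true
bead-head l ls rewrite ⌊≟⌋-refl {+ l - 1ℤ} refl = refl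

bead-0∷ : ∀ z → bead (0 ∷ []) z ≡ bead [] z
bead-0∷ (+ zero) = refl
bead-0∷ (+ suc n) = refl
bead-0∷ -[1+ zero ] = refl
bead-0∷ -[1+ suc n ] = refl

-- The sum of `f` over the β-set minus its sum over the β-set of the empty partition. It is finite
-- because each row is read as one bead moved from its vacuum position; the shift of `f` in the
-- recursion lowers those positions by one per row.
rowSum : List ℕ → (ℤ → ℤ) → ℤ
rowSum []       f = 0ℤ
rowSum (l ∷ ls) f = f (+ l - 1ℤ) - f (- 1ℤ) + rowSum ls (λ z → f (z - 1ℤ))

private
  ι-∨ : ∀ a b → (a ≡ true → b ≡ false) → ι (a ∨ b) ≡ ι a + ι b
  ι-∨ false b h = sym (+-identityˡ (ι b))
  ι-∨ true  b h rewrite h refl = refl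

-- The largest bead is split off, and the others form the β-set of the tail moved down by one. The
-- bound on the parts makes this union disjoint, so the indicators add.
sumOver-bead-∷ : ∀ {l ls} A n f → All (ℕ._≤ l) ls → A + 1ℤ ≤ + l → + l ≤ A + + n →
  sumOver A n (bead (l ∷ ls)) f ≡ f (+ l - 1ℤ) + sumOver (A + 1ℤ) n (bead ls) (λ z → f (z - 1ℤ))
sumOver-bead-∷ {l} {ls} A n f ps p q = begin
  sumOver A n (bead (l ∷ ls)) f
    ≡⟨ sum-cong A n (λ z → trans (cong (_* f z) (ι-∨ ⌊ z ≟ y ⌋ (bead ls (z + 1ℤ)) (disjoint z)))
        (*-distribʳ-+ (f z) (δ y z) (ι (bead ls (z + 1ℤ))))) ⟩
  sumFrom A n (λ z → δ y z * f z + ι (bead ls (z + 1ℤ)) * f z)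
    ≡⟨ sum-+ A n (λ z → δ y z * f z) _ ⟩
  sumFrom A n (λ z → δ y z * f z) + sumFrom A n (λ z → ι (bead ls (z + 1ℤ)) * f z)
    ≡⟨ cong₂ _+_ (sum-δ A n y f (+1-cancel (subst (A + 1ℤ ≤_) (sym (x-1+1 (+ l))) p))
        (subst (_≤ A + + n) (sym (x-1+1 (+ l))) q))
       (trans (sum-cong A n (λ z → cong (λ w → ι (bead ls (z + 1ℤ)) * f w) (sym (x+1-1 z))))
       (sum-shift A n 1ℤ (λ z → ι (bead ls z) * f (z - 1ℤ)))) ⟩
  f y + sumOver (A + 1ℤ) n (bead ls) (λ z → f (z - 1ℤ)) ∎
  where
  open ≡-Reasoning
  y : ℤ
  y = + l - 1ℤ
  disjoint : ∀ z → ⌊ z ≟ y ⌋ ≡ true → bead ls (z + 1ℤ) ≡ false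
  disjoint z eq with z ≟ y
  ... | yes refl = bead-high ls ps (≤-reflexive (sym (x-1+1 (+ l))))

sumOver-bead : ∀ ls A n f → IsPartition ls → A + + length ls ≤ 0ℤ → All (λ l → + l ≤ A + + n) ls →
  sumOver A n (bead ls) f ≡ sumOver A n (bead []) f + rowSum ls f
sumOver-bead [] A n f ip p qs = sym (+-identityʳ _)
sumOver-bead (l ∷ ls) A n f ip p (q ∷ qs) = begin
  sumOver A n (bead (l ∷ ls)) f
    ≡⟨ sumOver-bead-∷ A n f (parts≤head ip) (≤-trans A+1≤0 0≤+) q ⟩
  f (+ l - 1ℤ) + sumOver (A + 1ℤ) n (bead ls) f′
    ≡⟨ cong (_+_ (f (+ l - 1ℤ))) (sumOver-bead ls (A + 1ℤ) n f′ (tail-partition ip)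
        (subst (_≤ 0ℤ) (lem₁ A (+ length ls)) p)
         (All.map (λ {k} r → ≤-trans r (≤-trans (i≤i+j (A + + n) 1ℤ) (≤-reflexive (lem₂ A (+ n))))) qs)) ⟩
  f (+ l - 1ℤ) + (sumOver (A + 1ℤ) n (bead []) f′ + rowSum ls f′)
    ≡⟨ lem₃ (f (+ l - 1ℤ)) (f (- 1ℤ)) (sumOver (A + 1ℤ) n (bead []) f′) (rowSum ls f′) ⟩
  f (- 1ℤ) + sumOver (A + 1ℤ) n (bead []) f′ + (f (+ l - 1ℤ) - f (- 1ℤ) + rowSum ls f′)
    -- The vacuum is peeled by the same lemma, applied to the list `0 ∷ []`: a part 0 has its bead
    -- at -1 and leaves the β-set of the empty partition unchanged.
    ≡⟨ cong (_+ (f (+ l - 1ℤ) - f (- 1ℤ) + rowSum ls f′))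
        (trans (sym (sumOver-bead-∷ {0} {[]} A n f [] A+1≤0 (≤-trans 0≤+ q)))
         (sum-cong A n λ z → cong (λ b → ι b * f z) (bead-0∷ z))) ⟩
  sumOver A n (bead []) f + rowSum (l ∷ ls) f ∎
  where
  open ≡-Reasoning
  f′ : ℤ → ℤ
  f′ z = f (z - 1ℤ)
  lem₁ : ∀ A n → A + (1ℤ + n) ≡ A + 1ℤ + n
  lem₁ = solve-∀
  lem₂ : ∀ A n → A + n + 1ℤ ≡ A + 1ℤ + n
  lem₂ = solve-∀
  lem₃ : ∀ a b c d → a + (c + d) ≡ b + c + (a - b + d)
  lem₃ = solve-∀
  A+1≤0 : A + 1ℤ ≤ 0ℤ
  A+1≤0 = ≤-trans (i≤i+j (A + 1ℤ) (+ length ls)) (subst (_≤ 0ℤ) (lem₁ A (+ length ls)) p)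

-- A set of integers containing all sufficiently small and no sufficiently
-- large integers, with c more elements than { z : z < 0 }.
record Maya (χ : ℤ → Bool) (c : ℤ) : Set where
  field
    bound : ℕ
    full  : ∀ z → z + + bound + 1ℤ ≤ 0ℤ → χ z ≡ true
    empty : ∀ z → + bound ≤ z → χ z ≡ false
    count : ∀ A n → A + + bound ≤ 0ℤ → + bound ≤ A + + n → sumOver A n χ one ≡ c - A

open Maya public

sumOver-cong : ∀ A n {χ χ′} f → (∀ z → χ z ≡ χ′ z) → sumOver A n χ f ≡ sumOver A n χ′ f
sumOver-cong A n f h = sum-cong A n λ z → cong (λ b → ι b * f z) (h z)

Maya-shift : ∀ {χ c} (a : ℤ) → Maya χ c → Maya (λ z → χ (z - a)) (c + a)
Maya-shift {χ} {c} a m = record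
  { bound = b
  ; full  = λ z p → full m (z - a) (≤-by (gap p ⊕ gap (-i≤+∣i∣ a)) (lem₁ z a (+ bound m) (+ ∣ a ∣)))
  ; empty = λ z p → empty m (z - a) (≤-by (gap p ⊕ gap (i≤+∣i∣ a)) (lem₂ z a (+ bound m) (+ ∣ a ∣)))
  ; count = λ A n p q → trans (sum-shift A n (- a) (λ z → ι (χ z) * 1ℤ))
      (trans (count m (A - a) n (≤-by (gap p ⊕ gap (-i≤+∣i∣ a)) (lem₃ A a (+ bound m) (+ ∣ a ∣)))
        (≤-by (gap q ⊕ gap (i≤+∣i∣ a)) (lem₄ A (+ n) a (+ bound m) (+ ∣ a ∣))))
      (lem₅ c A a))
  }
  where
  b : ℕ
  b = bound m ℕ.+ ∣ a ∣
  lem₁ : ∀ z a b n → 0ℤ - (z - a + b + 1ℤ) ≡ 0ℤ - (z + (b + n) + 1ℤ) + (n - - a)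
  lem₁ = solve-∀
  lem₂ : ∀ z a b n → z - a - b ≡ z - (b + n) + (n - a)
  lem₂ = solve-∀
  lem₃ : ∀ A a b n → 0ℤ - (A - a + b) ≡ 0ℤ - (A + (b + n)) + (n - - a)
  lem₃ = solve-∀
  lem₄ : ∀ A n a b k → A - a + n - b ≡ A + n - (b + k) + (k - a)
  lem₄ = solve-∀
  lem₅ : ∀ c A a → c - (A - a) ≡ c + a - A
  lem₅ = solve-∀

private
  -‿+ : ∀ {A} → A ≤ 0ℤ → ∃ λ m → A ≡ - (+ m)
  -‿+ {+ zero} (+≤+ z≤n) = 0 , refl
  -‿+ { -[1+ n ]} _ = suc n , refl

count-∅ : ∀ A n → A ≤ 0ℤ → 0ℤ ≤ A + + n → sumOver A n (bead []) one ≡ - A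
count-∅ A n p q with -‿+ p
... | m , refl = begin
  sumOver (- + m) n (bead []) one
    ≡⟨ cong (λ k → sumOver (- + m) k (bead []) one) (sym (ℕ.m+[n∸m]≡n m≤n)) ⟩
  sumOver (- + m) (m ℕ.+ k) (bead []) one
    ≡⟨ sum-++ (- + m) m k _ ⟩
  sumOver (- + m) m (bead []) one + sumOver (- + m + + m) k (bead []) one
    ≡⟨ cong₂ _+_ (trans (sum-cong-in (- + m) m low) (sum-const (- + m) m 1ℤ))
         (sum-zero (- + m + + m) k _ high) ⟩
  + m * 1ℤ + 0ℤ
    ≡⟨ lem (+ m) ⟩
  - - + m ∎
  where
  open ≡-Reasoning
  k : ℕ
  k = n ℕ.∸ m
  m≤n : m ℕ.≤ n
  m≤n = drop‿+≤+ (≤-by q (lem′ (+ n) (+ m)))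
    where
    lem′ : ∀ n m → n - m ≡ - m + n
    lem′ = solve-∀
  low : ∀ z → - + m ≤ z → z + 1ℤ ≤ - + m + + m → ι (bead [] z) * 1ℤ ≡ 1ℤ
  low z _ p rewrite nonneg-false {z} (subst (z + 1ℤ ≤_) (+-inverseˡ (+ m)) p) = refl
  high : ∀ z → - + m + + m ≤ z → z + 1ℤ ≤ - + m + + m + + k → ι (bead [] z) * 1ℤ ≡ 0ℤ
  high z p _ rewrite nonneg-true {z} (subst (_≤ z) (+-inverseˡ (+ m)) p) = refl
  lem : ∀ m → m * 1ℤ + 0ℤ ≡ - - m
  lem = solve-∀

rowSum-one : ∀ ls → rowSum ls one ≡ 0ℤ
rowSum-one []       = refl
rowSum-one (l ∷ ls) = trans (+-identityˡ _) (rowSum-one ls)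

headOr0 : List ℕ → ℕ
headOr0 []      = 0
headOr0 (l ∷ _) = l

parts≤headOr0 : ∀ {ls} → IsPartition ls → All (ℕ._≤ headOr0 ls) ls
parts≤headOr0 {[]}     _  = []
parts≤headOr0 {l ∷ ls} ip = ℕ.≤-refl ∷ parts≤head ip

-- One radius for both ends: it dominates the largest part, beyond which there are no beads, and the
-- number of parts, below whose negative there are no gaps.
size-bound : List ℕ → ℕ
size-bound ls = headOr0 ls ℕ.+ length ls

Covers : List ℕ → ℤ → ℕ → Set
Covers ls A n = A + + size-bound ls ≤ 0ℤ × + size-bound ls ≤ A + + n

sumOver-bead-covers : ∀ ls A n f → IsPartition ls → Covers ls A n →
  sumOver A n (bead ls) f ≡ sumOver A n (bead []) f + rowSum ls f
sumOver-bead-covers ls A n f ip (p , q) = sumOver-bead ls A n f ip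
  (≤-trans (+-monoʳ-≤ A (+≤+ (ℕ.m≤n+m (length ls) (headOr0 ls)))) p)
  (All.map (λ r → ≤-trans (+≤+ (ℕ.≤-trans r (ℕ.m≤m+n (headOr0 ls) (length ls)))) q) (parts≤headOr0 ip))

bead-Maya : ∀ {ls} → IsPartition ls → Maya (bead ls) 0ℤ
bead-Maya {ls} ip = record
  { bound = size-bound ls
  ; full  = λ z p → bead-low ls (≤-trans (+-monoˡ-≤ 1ℤ (+-monoʳ-≤ z (+≤+ (ℕ.m≤n+m (length ls) (headOr0 ls))))) p)
  ; empty = λ z p → bead-high ls (parts≤headOr0 ip) (≤-trans (+≤+ (ℕ.m≤m+n (headOr0 ls) (length ls))) p)
  ; count = λ A n p q → trans (sumOver-bead-covers ls A n one ip (p , q)) (trans (cong₂ _+_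
      (count-∅ A n (≤-trans (i≤i+j A (+ size-bound ls)) p) (≤-trans 0≤+ q)) (rowSum-one ls))
          (trans (+-identityʳ (- A)) (sym (+-identityˡ (- A)))))
  }

-- The largest bead gives back the first part, and removing it leaves the shifted β-set of the tail.
-- Parts equal to 0 are invisible in the β-set; positivity of the parts excludes them.
bead-injective : ∀ {ls ms} → IsPartition ls → IsPartition ms → (∀ z → bead ls z ≡ bead ms z) → ls ≡ ms
bead-injective {[]} {[]} _ _ h = refl
bead-injective {[]} {suc m ∷ ms} _ _ h with trans (h (+ suc m - 1ℤ)) (bead-head (suc m) ms)
... | ()
bead-injective {[]} {zero ∷ ms} _ (_ , () ∷ _) h
bead-injective {suc l ∷ ls} {[]} _ _ h with trans (sym (h (+ suc l - 1ℤ))) (bead-head (suc l) ls)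
... | ()
bead-injective {zero ∷ ls} {[]} (_ , () ∷ _) _ h
bead-injective {l ∷ ls} {m ∷ ms} ip ip′ h = cong₂ _∷_ l≡m
  (bead-injective (tail-partition ip) (tail-partition ip′) tails)
  where
  heads : ∀ {l m ls ms} → IsPartition (m ∷ ms) → (∀ z → bead (l ∷ ls) z ≡ bead (m ∷ ms) z) → l ℕ.≤ m
  heads {l} {m} {ls} {ms} ip h with ≤-or-> (+ l) (+ m)
  ... | inj₁ p = drop‿+≤+ p
  ... | inj₂ p with trans (sym (bead-head l ls)) (trans (h (+ l - 1ℤ))
                    (bead-high (m ∷ ms) (ℕ.≤-refl ∷ parts≤head ip) (≤-by (gap p) (lem (+ l) (+ m)))))
    where
    lem : ∀ l m → l - 1ℤ - m ≡ l - (m + 1ℤ)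
    lem = solve-∀
  ...   | ()
  l≡m : l ≡ m
  l≡m = ℕ.≤-antisym (heads {l} {m} {ls} {ms} ip′ h) (heads {m} {l} {ms} {ls} ip (λ z → sym (h z)))
  tails : ∀ z → bead ls z ≡ bead ms z
  tails z with z ≟ + l
  ... | yes refl = trans (bead-high ls (parts≤head ip) ≤-refl)
      (sym (bead-high ms (parts≤head ip′) (≤-reflexive (cong +_ (sym l≡m)))))
  ... | no z≢l = trans (sym (drop l ls z≢l)) (trans (h (z - 1ℤ)) (drop m ms λ eq → z≢l (trans eq (cong +_ (sym l≡m)))))
    where
    drop : ∀ k ks → z ≢ + k → bead (k ∷ ks) (z - 1ℤ) ≡ bead ks z
    drop k ks ne rewrite ⌊≟⌋-≢ {z - 1ℤ} {+ k - 1ℤ} (λ eq → ne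
        (trans (sym (x-1+1 z)) (trans (cong (_+ 1ℤ) eq) (x-1+1 (+ k)))))
      = cong (bead ks) (x-1+1 z)

-- Reconstruction of a partition from a set of charge 0

ι≤1 : ∀ b → ι b * 1ℤ ≤ 1ℤ
ι≤1 true  = ≤-refl
ι≤1 false = +≤+ z≤n

private
  all≡0⇒[] : ∀ {ls} → All (ℕ._≤ 0) ls → All (1 ℕ.≤_) ls → ls ≡ []
  all≡0⇒[] [] [] = refl
  all≡0⇒[] (z≤n ∷ _) (() ∷ _)

  cons-partition : ∀ {l ls} → 1 ℕ.≤ l → All (ℕ._≤ l) ls → IsPartition ls → IsPartition (l ∷ ls)
  cons-partition p []       (_ , _)   = [-] , p ∷ []
  cons-partition p (q ∷ qs) (li , ps) = q ∷ li , p ∷ ps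

-- Induction from the top of the window. A vacant top cell is dropped. An occupied one becomes the
-- first part, and the remaining beads are moved up by one, which raises the lower end to `A + 1ℤ`
-- and keeps the charge equal to 0.
realise-window : ∀ n A χ → (∀ z → z + 1ℤ ≤ A → χ z ≡ true) → (∀ z → A + + n ≤ z → χ z ≡ false) →
  sumOver A n χ one ≡ - A → ∃ λ ls → IsPartition ls × All (λ l → + l ≤ A + + n) ls × (∀ z → bead ls z ≡ χ z)
realise-window zero A χ lo hi eq = [] , ([] , []) , [] , same
  where
  A≡0 : A ≡ 0ℤ
  A≡0 = trans (sym (neg-involutive A)) (cong -_ (sym eq))
  same : ∀ z → bead [] z ≡ χ z
  same z with ≤-or-> 0ℤ z
  ... | inj₁ p rewrite nonneg-true p = sym (hi z (≤-trans (≤-reflexive (trans (+-identityʳ A) A≡0)) p))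
  ... | inj₂ p rewrite nonneg-false {z} p = sym (lo z (≤-trans p (≤-reflexive (sym A≡0))))
realise-window (suc n) A χ lo hi eq with χ (A + + n) in top
... | false = let ls , ip , ps , h = realise-window n A χ lo hi′ eq′ in
  ls , ip , All.map (λ p → ≤-trans p (+-monoʳ-≤ A (+≤+ (ℕ.n≤1+n n)))) ps , h
  where
  hi′ : ∀ z → A + + n ≤ z → χ z ≡ false
  hi′ z p with ≤-or-> z (A + + n)
  ... | inj₁ q = trans (cong χ (≤-antisym q p)) top
  ... | inj₂ q = hi z (≤-by (gap q) (lem A (+ n) z))
    where
    lem : ∀ A n z → z - (A + (1ℤ + n)) ≡ z - (A + n + 1ℤ)
    lem = solve-∀
  eq′ : sumOver A n χ one ≡ - A
  eq′ = trans (sym (trans (sum-snoc A n _) (trans (cong (λ b → sumOver A n χ one + ι b * 1ℤ) top) (+-identityʳ _)))) eq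
... | true = finish (realise-window n (A + 1ℤ) χ′ lo′ hi′ eq′)
  where
  l : ℤ
  l = A + + suc n
  l≡ : l ≡ A + 1ℤ + + n
  l≡ = sym (+-assoc A 1ℤ (+ n))
  χ′ : ℤ → Bool
  χ′ z = χ (z - 1ℤ) ∧ not ⌊ z ≟ l ⌋
  lo′ : ∀ z → z + 1ℤ ≤ A + 1ℤ → χ′ z ≡ true
  lo′ z p = cong₂ (λ b c → b ∧ not c) (lo (z - 1ℤ) (subst (_≤ A) (sym (x-1+1 z)) (+1-cancel p)))
    (⌊≟⌋-≢ {z} {l} (<⇒≢ˡ (≤-by (gap p ⊕ 0≤+ {n}) (lem A z (+ n)))))
    where
    lem : ∀ A z n → A + (1ℤ + n) - (z + 1ℤ) ≡ A + 1ℤ - (z + 1ℤ) + n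
    lem = solve-∀
  hi′ : ∀ z → A + 1ℤ + + n ≤ z → χ′ z ≡ false
  hi′ z p with z ≟ l
  ... | yes _ = ∧-zeroʳ _
  ... | no z≢l with ≤-or-> z l
  ...   | inj₁ q = ⊥-elim (z≢l (≤-antisym q (subst (_≤ z) (sym l≡) p)))
  ...   | inj₂ q = cong (_∧ true) (hi (z - 1ℤ) (≤-by (gap q) (lem l z)))
    where
    lem : ∀ l z → z - 1ℤ - l ≡ z - (l + 1ℤ)
    lem = solve-∀
  count-χ : sumOver A n χ one ≡ - A - 1ℤ
  count-χ = trans (sym (lem (sumOver A n χ one))) (cong (_- 1ℤ)
    (trans (cong (λ b → sumOver A n χ one + ι b * 1ℤ) (sym top)) (trans (sym (sum-snoc A n _)) eq)))
    where
    lem : ∀ w → w + 1ℤ - 1ℤ ≡ w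
    lem = solve-∀
  χ′-in : ∀ z → z + 1ℤ ≤ A + + n → χ′ (z + 1ℤ) ≡ χ z
  χ′-in z p = trans (cong₂ (λ b c → b ∧ not c) (cong χ (x+1-1 z))
      (⌊≟⌋-≢ {z + 1ℤ} {l} (<⇒≢ˡ (≤-by (gap p) (lem A (+ n) z)))))
    (∧-identityʳ (χ z))
    where
    lem : ∀ A n z → A + (1ℤ + n) - (z + 1ℤ + 1ℤ) ≡ A + n - (z + 1ℤ)
    lem = solve-∀
  eq′ : sumOver (A + 1ℤ) n χ′ one ≡ - (A + 1ℤ)
  eq′ = trans (sym (sum-shift A n 1ℤ (λ z → ι (χ′ z) * 1ℤ))) (trans (sum-cong-in A n
    (λ z _ p → cong (λ b → ι b * 1ℤ) (χ′-in z p))) (trans count-χ (lem A)))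
    where
    lem : ∀ A → - A - 1ℤ ≡ - (A + 1ℤ)
    lem = solve-∀
  -- The `n` cells below the top bead hold `- A - 1` beads, and no more than `n`; so the candidate
  -- part `A + n + 1` is nonnegative.
  0≤l : 0ℤ ≤ l
  0≤l = subst (0ℤ ≤_) (trans (sum-- A n one _) (trans (cong₂ _-_ (sum-const A n 1ℤ) count-χ) (lem A (+ n))))
    (sum-nonneg A n (λ z → 1ℤ - ι (χ z) * 1ℤ) λ z _ _ → gap (ι≤1 (χ z)))
    where
    lem : ∀ A n → n * 1ℤ - (- A - 1ℤ) ≡ A + (1ℤ + n)
    lem = solve-∀
  k : ℕ
  k = ∣ l ∣
  k≡l : + k ≡ l
  k≡l = 0≤i⇒+∣i∣≡i 0≤l
  l-1 : l - 1ℤ ≡ A + + n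
  l-1 = lem A (+ n)
    where
    lem : ∀ A n → A + (1ℤ + n) - 1ℤ ≡ A + n
    lem = solve-∀
  beads : ∀ k ls → + k ≡ l → (∀ z → bead ls z ≡ χ′ z) → ∀ z → bead (k ∷ ls) z ≡ χ z
  beads k ls k≡l h z with z ≟ + k - 1ℤ
  ... | yes eq = sym (trans (cong χ (trans eq (trans (cong (_- 1ℤ) k≡l) l-1))) top)
  ... | no ne = trans (h (z + 1ℤ)) (trans (cong₂ (λ b c → b ∧ not c) (cong χ (x+1-1 z))
    (⌊≟⌋-≢ {z + 1ℤ} {l} λ eq → ne (trans (sym (x+1-1 z)) (cong (_- 1ℤ) (trans eq (sym k≡l)))))) (∧-identityʳ (χ z)))
  finish : (∃ λ ls → IsPartition ls × All (λ l → + l ≤ A + 1ℤ + + n) ls × (∀ z → bead ls z ≡ χ′ z)) →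
    ∃ λ ls → IsPartition ls × All (λ l → + l ≤ A + + suc n) ls × (∀ z → bead ls z ≡ χ z)
  finish (ls , ip , ps , h) = go k k≡l (All.map (λ p → drop‿+≤+ (≤-trans p (≤-reflexive (trans (sym l≡) (sym k≡l)))))
      ps) (beads k ls k≡l h)
    where
    go : ∀ k → + k ≡ l → All (ℕ._≤ k) ls → (∀ z → bead (k ∷ ls) z ≡ χ z) →
      ∃ λ ls → IsPartition ls × All (λ l → + l ≤ A + + suc n) ls × (∀ z → bead ls z ≡ χ z)
    -- A top bead at -1 stands for a part 0. All further parts are then 0 as well, so the set is the
    -- vacuum and the empty partition realises it.
    go zero    k≡l qs g = [] , ([] , []) , [] ,
      λ z → trans (sym (bead-0∷ z)) (trans (cong (λ ms → bead (0 ∷ ms) z) (sym (all≡0⇒[] qs (proj₂ ip)))) (g z))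
    go (suc k) k≡l qs g = suc k ∷ ls , cons-partition (s≤s z≤n) qs ip ,
      All.map (λ p → ≤-trans (+≤+ p) (≤-reflexive k≡l)) (ℕ.≤-refl ∷ qs) , g

realise : ∀ {χ} → Maya χ 0ℤ → ∃ λ ls → IsPartition ls × (∀ z → bead ls z ≡ χ z)
realise {χ} m = let ls , ip , _ , h = realise-window (b ℕ.+ b) (- + b) χ
                      (λ z p → full m z (≤-by (gap p) (lem₁ z (+ b))))
                      (λ z p → empty m z (≤-trans (≤-reflexive (lem₂ (+ b))) p))
                      (trans (count m (- + b) (b ℕ.+ b) (≤-reflexive (+-inverseˡ (+ b))) (≤-reflexive (lem₂ (+ b))))
                          (+-identityˡ _))
                in ls , ip , h
  where
  b : ℕ
  b = bound m
  lem₁ : ∀ z b → 0ℤ - (z + b + 1ℤ) ≡ - b - (z + 1ℤ)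
  lem₁ = solve-∀
  lem₂ : ∀ b → b ≡ - b + (b + b)
  lem₂ = solve-∀

-- Hook lengths

part : List ℕ → ℕ → ℕ
part []       j       = 0
part (l ∷ ls) zero    = l
part (l ∷ ls) (suc j) = part ls j

part≤ : ∀ {m} ls → All (ℕ._≤ m) ls → ∀ j → part ls j ℕ.≤ m
part≤ []       _        j       = z≤n
part≤ (l ∷ ls) (p ∷ ps) zero    = p
part≤ (l ∷ ls) (p ∷ ps) (suc j) = part≤ ls ps j

bead-part : ∀ ls j → bead ls (+ part ls j - + j - 1ℤ) ≡ true
bead-part [] j = cong not (nonneg-false {0ℤ - + j - 1ℤ} (≤-by (0≤+ {j}) (lem (+ j))))
  where
  lem : ∀ j → 0ℤ - (0ℤ - j - 1ℤ + 1ℤ) ≡ j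
  lem = solve-∀
bead-part (l ∷ ls) zero = cong (_∨ bead ls (+ l - 0ℤ - 1ℤ + 1ℤ))
  (⌊≟⌋-refl {+ l - 0ℤ - 1ℤ} {+ l - 1ℤ} (cong (_- 1ℤ) (+-identityʳ (+ l))))
bead-part (l ∷ ls) (suc j) = trans (cong (⌊ + part ls j - + suc j - 1ℤ ≟ + l - 1ℤ ⌋ ∨_)
  (trans (cong (bead ls) (lem (+ part ls j) (+ j))) (bead-part ls j))) (∨-zeroʳ _)
  where
  lem : ∀ p j → p - (1ℤ + j) - 1ℤ + 1ℤ ≡ p - j - 1ℤ
  lem = solve-∀

part-bead : ∀ ls {z} → bead ls z ≡ true → ∃ λ j → z ≡ + part ls j - + j - 1ℤ
part-bead [] { -[1+ zero ]} _ = 0 , refl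
part-bead [] { -[1+ suc n ]} _ = suc n , cong -[1+_] (cong suc (sym (ℕ.+-identityʳ n)))
part-bead (l ∷ ls) {z} eq with z ≟ + l - 1ℤ
... | yes refl = 0 , cong (_- 1ℤ) (sym (+-identityʳ (+ l)))
... | no _ with part-bead ls {z + 1ℤ} eq
...   | j , eq′ = suc j , trans (sym (x+1-1 z)) (trans (cong (_- 1ℤ) eq′) (lem (+ part ls j) (+ j)))
  where
  lem : ∀ p j → p - j - 1ℤ - 1ℤ ≡ p - (1ℤ + j) - 1ℤ
  lem = solve-∀

colLen-∷-≤ : ∀ {l} ls b → b ℕ.≤ l → colLen (l ∷ ls) b ≡ suc (colLen ls b)
colLen-∷-≤ ls b p = cong length (filter-accept (b ℕ.≤?_) p)

colLen-none : ∀ {l} ls b → All (ℕ._≤ l) ls → l ℕ.< b → colLen ls b ≡ 0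
colLen-none ls b ps q = cong length (filter-none (b ℕ.≤?_) (All.map (λ p → ℕ.<⇒≱ (ℕ.≤-<-trans p q)) ps))

<colLen : ∀ {ls} → IsPartition ls → ∀ b j → suc b ℕ.≤ part ls j → j ℕ.< colLen ls (suc b)
<colLen {l ∷ ls} ip b zero p rewrite colLen-∷-≤ ls (suc b) p = s≤s z≤n
<colLen {l ∷ ls} ip b (suc j) p rewrite colLen-∷-≤ ls (suc b) (ℕ.≤-trans p (part≤ ls (parts≤head ip) j)) =
  s≤s (<colLen (tail-partition ip) b j p)

colLen≤ : ∀ {ls} → IsPartition ls → ∀ b j → part ls j ℕ.≤ b → colLen ls (suc b) ℕ.≤ j
colLen≤ {[]} ip b j p = z≤n
colLen≤ {l ∷ ls} ip b zero p = ℕ.≤-reflexive (colLen-none (l ∷ ls) (suc b) (ℕ.≤-refl ∷ parts≤head ip) (s≤s p))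
colLen≤ {l ∷ ls} ip b (suc j) p with suc b ℕ.≤? l
... | yes q rewrite colLen-∷-≤ ls (suc b) q = s≤s (colLen≤ (tail-partition ip) b j p)
... | no q rewrite colLen-none (l ∷ ls) (suc b) (ℕ.≤-refl ∷ parts≤head ip) (ℕ.≰⇒> q) = z≤n

-- Gaps belong to columns as beads belong to rows. When a row of length `l` is put on top, the
-- columns up to `l` grow by one cell, which moves their gaps down by one; the empty columns beyond
-- `l` have to be renumbered instead, which is the task of `pred-case`.
gap-colLen : ∀ {ls z} → IsPartition ls → bead ls z ≡ false → ∃ λ b → z ≡ + b - + colLen ls (suc b)
gap-colLen {[]} {+ n} _ _ = n , sym (+-identityʳ (+ n))
gap-colLen {l ∷ ls} {z} ip eq with z ≟ + l - 1ℤ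
... | no z≢ with gap-colLen {ls} {z + 1ℤ} (tail-partition ip) eq
...   | b , eq′ with suc b ℕ.≤? l
...     | yes p = b , trans (trans (sym (x+1-1 z)) (trans (cong (_- 1ℤ) eq′) (lem (+ b) (+ colLen ls (suc b)))))
                        (cong (λ c → + b - + c) (sym (colLen-∷-≤ ls (suc b) p)))
  where
  lem : ∀ b c → b - c - 1ℤ ≡ b - (1ℤ + c)
  lem = solve-∀
...     | no p = pred-case b refl
  where
  z+1≡b : z + 1ℤ ≡ + b
  z+1≡b = trans eq′ (trans (cong (λ c → + b - + c) (colLen-none ls (suc b) (parts≤head ip) (ℕ.≰⇒> p)))
      (+-identityʳ (+ b)))
  z≡b-1 : z ≡ + b - 1ℤ
  z≡b-1 = trans (sym (x+1-1 z)) (cong (_- 1ℤ) z+1≡b)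
  l<b : l ℕ.< b
  l<b = ℕ.≤∧≢⇒< (ℕ.≤-pred (ℕ.≰⇒> p)) λ l≡b → z≢ (trans z≡b-1 (cong (λ k → + k - 1ℤ) (sym l≡b)))
  pred-case : ∀ c → c ≡ b → ∃ λ d → z ≡ + d - + colLen (l ∷ ls) (suc d)
  pred-case zero    refl = ⊥-elim (ℕ.n≮0 l<b)
  pred-case (suc d) refl = d , trans z≡b-1 (trans (sym (+-identityʳ (+ d))) (cong (λ c → + d - + c)
    (sym (colLen-none (l ∷ ls) (suc d) (ℕ.≤-refl ∷ parts≤head ip) l<b))))

-- The bead of row `j` lies strictly above the gap of column `b` if their common cell is in the
-- diagram, and strictly below it otherwise; so they never coincide.
colLen-gap : ∀ {ls} → IsPartition ls → ∀ b → bead ls (+ b - + colLen ls (suc b)) ≡ false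
colLen-gap {ls} ip b with bead ls (+ b - + colLen ls (suc b)) in eq
... | false = refl
... | true with part-bead ls eq
...   | j , eq′ with suc b ℕ.≤? part ls j
...     | yes p = ⊥-elim (<⇒≢ˡ (≤-by (gap (+≤+ p) ⊕ gap (+≤+ (<colLen ip b j p)))
                    (lem (+ b) (+ j) (+ part ls j) (+ colLen ls (suc b)))) eq′)
  where
  lem : ∀ b j p c → p - j - 1ℤ - (b - c + 1ℤ) ≡ p - (1ℤ + b) + (c - (1ℤ + j))
  lem = solve-∀
...     | no p = ⊥-elim (<⇒≢ʳ (≤-by (gap (+≤+ q) ⊕ gap (+≤+ (colLen≤ ip b j q)))
                    (lem (+ b) (+ j) (+ part ls j) (+ colLen ls (suc b)))) eq′)
  where
  q : part ls j ℕ.≤ b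
  q = ℕ.≤-pred (ℕ.≰⇒> p)
  lem : ∀ b j p c → b - c - (p - j - 1ℤ + 1ℤ) ≡ b - p + (j - c)
  lem = solve-∀

hook : List ℕ → ℕ → ℕ → ℕ → ℕ
hook ls l i b = ((l ℕ.∸ suc b) ℕ.+ (colLen ls (suc b) ℕ.∸ suc i)) ℕ.+ 1

∈-hooksFrom⁺ : ∀ ls i ms j b → b ℕ.< part ms j → hook ls (part ms j) (i ℕ.+ j) b ∈ hooksFrom ls i ms
∈-hooksFrom⁺ ls i (m ∷ ms) zero b p = ∈-++⁺ˡ (subst (λ k → hook ls m k b ∈ rowHooks ls i m) (sym (ℕ.+-identityʳ i))
  (∈-applyUpTo⁺ (hook ls m i) p))
∈-hooksFrom⁺ ls i (m ∷ ms) (suc j) b p = ∈-++⁺ʳ (rowHooks ls i m)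
  (subst (λ k → hook ls (part ms j) k b ∈ hooksFrom ls (suc i) ms) (sym (ℕ.+-suc i j))
      (∈-hooksFrom⁺ ls (suc i) ms j b p))

∈-hooksFrom⁻ : ∀ ls i ms {h} → h ∈ hooksFrom ls i ms →
  ∃ λ j → ∃ λ b → b ℕ.< part ms j × h ≡ hook ls (part ms j) (i ℕ.+ j) b
∈-hooksFrom⁻ ls i (m ∷ ms) {h} h∈ with ∈-++⁻ (rowHooks ls i m) h∈
... | inj₁ q = let b , p , eq = ∈-applyUpTo⁻ (hook ls m i) q in
  0 , b , p , trans eq (cong (λ k → hook ls m k b) (sym (ℕ.+-identityʳ i)))
... | inj₂ q = let j , b , p , eq = ∈-hooksFrom⁻ ls (suc i) ms q in
  suc j , b , p , trans eq (cong (λ k → hook ls (part ms j) k b) (sym (ℕ.+-suc i j)))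

-- The classical reading of a hook length as the distance from the bead of its row down to the gap
-- of its column. The truncated subtractions in `hook` are exact because the cell lies in the
-- diagram.
hook-bead : ∀ {ls} → IsPartition ls → ∀ j b → b ℕ.< part ls j →
  + part ls j - + j - 1ℤ - + hook ls (part ls j) j b ≡ + b - + colLen ls (suc b)
hook-bead {ls} ip j b p = trans (cong (λ h → + part ls j - + j - 1ℤ - (h + 1ℤ))
  (cong₂ _+_ (∸-ℤ p) (∸-ℤ (<colLen ip b j p)))) (lem (+ part ls j) (+ j) (+ b) (+ colLen ls (suc b)))
  where
  ∸-ℤ : ∀ {m n} → n ℕ.≤ m → + (m ℕ.∸ n) ≡ + m - + n
  ∸-ℤ {m} {n} q = sym (trans (m-n≡m⊖n m n) (⊖-≥ q))
  lem : ∀ p j b c → p - j - 1ℤ - (p - (1ℤ + b) + (c - (1ℤ + j)) + 1ℤ) ≡ b - c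
  lem = solve-∀

+-cancelˡ : ∀ x {y z} → x + y ≡ x + z → y ≡ z
+-cancelˡ x {y} {z} eq = trans (sym (lem x y)) (trans (cong (_- x) eq) (lem x z))
  where
  lem : ∀ x y → x + y - x ≡ y
  lem = solve-∀

-- On the abacus with `g` runners: no bead has a vacant place directly below it.
Closed : ℕ → (ℤ → Bool) → Set
Closed g χ = ∀ z → χ z ≡ true → χ (z - + g) ≡ true

IsGCore⇒Closed : ∀ {g ls} → IsPartition ls → IsGCore g ls → Closed g (bead ls)
IsGCore⇒Closed {g} {ls} ip core z eq with bead ls (z - + g) in eq′
... | true = refl
... | false with part-bead ls eq | gap-colLen ip eq′
...   | j , refl | b , eq″ with suc b ℕ.≤? part ls j
...     | yes p = ⊥-elim (core (subst (_∈ hooks ls) (+-injective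
    (neg-injective (+-cancelˡ (+ part ls j - + j - 1ℤ) (trans (hook-bead ip j b p) (sym eq″)))))
                    (∈-hooksFrom⁺ ls 0 ls j b p)))
-- For a cell outside the diagram the gap of the column lies above the bead of the row, whereas here
-- the gap is `z - g` and the bead is `z`.
...     | no p = ⊥-elim (<⇒≢ˡ (≤-by (gap (+≤+ q) ⊕ gap (+≤+ (colLen≤ ip b j q)) ⊕ 0≤+ {g})
                    (lem (+ b) (+ j) (+ part ls j) (+ colLen ls (suc b)) (+ g))) eq″)
  where
  q : part ls j ℕ.≤ b
  q = ℕ.≤-pred (ℕ.≰⇒> p)
  lem : ∀ b j p c g → b - c - (p - j - 1ℤ - g + 1ℤ) ≡ b - p + (j - c) + g
  lem = solve-∀

Closed⇒IsGCore : ∀ {g ls} → IsPartition ls → Closed g (bead ls) → IsGCore g ls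
Closed⇒IsGCore {g} {ls} ip closed g∈ with ∈-hooksFrom⁻ ls 0 ls g∈
... | j , b , p , refl with trans (sym (closed (+ part ls j - + j - 1ℤ) (bead-part ls j)))
                             (trans (cong (bead ls) (hook-bead ip j b p)) (colLen-gap ip b))
...   | ()

-- Contents

Quasi : ℤ → ℤ → (ℤ → ℤ) → Set
Quasi g c f = ∀ z → f (z + g) ≡ f z + c

Periodic : ℤ → (ℤ → ℤ) → Set
Periodic g = Quasi g 0ℤ

quasi-* : ∀ {g c f} → Quasi g c f → ∀ k → Quasi (k * g) (k * c) f
quasi-* {g} {c} {f} h (+ k) = nat k
  where
  nat : ∀ k → Quasi (+ k * g) (+ k * c) f
  nat zero z = trans (cong f (lem₀ z g)) (lem₁ (f z) c)
    where
    lem₀ : ∀ z g → z + 0ℤ * g ≡ z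
    lem₀ = solve-∀
    lem₁ : ∀ w c → w ≡ w + 0ℤ * c
    lem₁ = solve-∀
  nat (suc k) z = trans (cong f (lem₀ z (+ k) g)) (trans (h (z + + k * g))
      (trans (cong (_+ c) (nat k z)) (lem₁ (f z) (+ k) c)))
    where
    lem₀ : ∀ z k g → z + (1ℤ + k) * g ≡ z + k * g + g
    lem₀ = solve-∀
    lem₁ : ∀ w k c → w + k * c + c ≡ w + (1ℤ + k) * c
    lem₁ = solve-∀
quasi-* {g} {c} {f} h -[1+ k ] z = trans (lem₁ (f (z + -[1+ k ] * g)) (+ suc k) c)
  (cong (_+ -[1+ k ] * c) (trans (sym (quasi-* {g} {c} {f} h (+ suc k) (z + -[1+ k ] * g)))
      (cong f (lem₀ z (+ suc k) g))))
  where
  lem₀ : ∀ z k g → z + - k * g + k * g ≡ z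
  lem₀ = solve-∀
  lem₁ : ∀ w k c → w ≡ w + k * c + - k * c
  lem₁ = solve-∀

periodic-* : ∀ {g f} → Periodic g f → ∀ k z → f (z + k * g) ≡ f z
periodic-* {g} {f} h k z = trans (quasi-* {f = f} h k z) (trans (cong (_+_ (f z)) (*-zeroʳ k)) (+-identityʳ (f z)))

periodic-1 : ∀ {f} → (∀ z → f (z + 1ℤ) ≡ f z) → ∀ z → f z ≡ f 0ℤ
periodic-1 {f} h z = trans (cong f (lem z)) (periodic-* {1ℤ} {f} (λ w → trans (h w) (sym (+-identityʳ (f w)))) z 0ℤ)
  where
  lem : ∀ z → z ≡ 0ℤ + z * 1ℤ
  lem = solve-∀

Δ : (ℤ → ℤ) → ℤ → ℤ
Δ f z = f (z + 1ℤ) - f z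

-- A primitive for `Δ`, normalised at 0. It builds potentials with prescribed increments: indicators
-- of residue classes when contents are compared, and later the unknown height itself.
Anti : (ℤ → ℤ) → ℤ → ℤ
Anti f (+ zero)      = 0ℤ
Anti f (+ suc n)     = Anti f (+ n) + f (+ n)
Anti f -[1+ zero ]   = - f -[1+ 0 ]
Anti f -[1+ suc n ]  = Anti f -[1+ n ] - f -[1+ suc n ]

Δ-Anti : ∀ f z → Δ (Anti f) z ≡ f z
Δ-Anti f (+ n) rewrite ℕ.+-comm n 1 = lem (Anti f (+ n)) (f (+ n))
  where
  lem : ∀ a b → a + b - a ≡ b
  lem = solve-∀
Δ-Anti f -[1+ zero ] = trans (+-identityˡ _) (neg-involutive _)
Δ-Anti f -[1+ suc n ] = lem (Anti f -[1+ n ]) (f -[1+ suc n ])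
  where
  lem : ∀ a b → a - (a - b) ≡ b
  lem = solve-∀

-- The increment of `f` over a step of `g` has vanishing difference, so it is constant and can be
-- read off at 0.
Δ-periodic⇒quasi : ∀ {g f} → Periodic g (Δ f) → Quasi g (f g - f 0ℤ) f
Δ-periodic⇒quasi {g} {f} h z = trans (lem (f (z + g)) (f z)) (cong (_+_ (f z))
  (trans (periodic-1 {λ w → f (w + g) - f w} step z) (cong (λ w → f w - f 0ℤ) (+-identityˡ g))))
  where
  lem : ∀ a b → a ≡ b + (a - b)
  lem = solve-∀
  lem₁ : ∀ z g → z + 1ℤ + g ≡ z + g + 1ℤ
  lem₁ = solve-∀
  lem₂ : ∀ a b c d → a - b ≡ c - d + 0ℤ → a - c ≡ b - d
  lem₂ a b c d eq = trans (lem₃ a b c) (trans (cong (λ w → w + b - c) eq) (lem₄ b c d))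
    where
    lem₃ : ∀ a b c → a - c ≡ a - b + b - c
    lem₃ = solve-∀
    lem₄ : ∀ b c d → c - d + 0ℤ + b - c ≡ b - d
    lem₄ = solve-∀
  step : ∀ w → f (w + 1ℤ + g) - f (w + 1ℤ) ≡ f (w + g) - f w
  step w = lem₂ (f (w + 1ℤ + g)) (f (w + g)) (f (w + 1ℤ)) (f w)
    (trans (cong (λ v → f v - f (w + g)) (lem₁ w g)) (h w))

divMod-unique : ∀ {r r′ s} q q′ → r ℕ.< s → r′ ℕ.< s → + r + q * + s ≡ + r′ + q′ * + s → r ≡ r′ × q ≡ q′
divMod-unique {r} {r′} {s} q q′ p p′ eq with ≤-antisym (q≤q′ r r′ q q′ p′ (sym eq)) (q≤q′ r′ r q′ q p eq)
  where
  q≤q′ : ∀ r r′ q q′ → r′ ℕ.< s → + r′ + q′ * + s ≡ + r + q * + s → q ≤ q′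
  q≤q′ r r′ q q′ p eq with ≤-or-> q q′
  ... | inj₁ le = le
  ... | inj₂ gt = ⊥-elim (<-absurd {+ r′} {+ s} (≤-trans (≤-reflexive (+-comm (+ r′) 1ℤ)) (+≤+ p))
      (≤-by (0≤-* (gap gt) (0≤+ {s}) ⊕ 0≤+ {r})
    (trans (lem (+ r′) (+ s) q′) (trans (cong (λ w → w - q′ * + s - + s) eq) (lem′ (+ r) q q′ (+ s))))))
    where
    lem : ∀ r s q → r - s ≡ r + q * s - q * s - s
    lem = solve-∀
    lem′ : ∀ r q q′ s → r + q * s - q′ * s - s ≡ (q - (q′ + 1ℤ)) * s + r
    lem′ = solve-∀
... | refl = +-injective (+-cancelˡ (q * + s) (trans (+-comm (q * + s) (+ r)) (trans eq (+-comm (+ r′) (q * + s))))) ,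
    refl

reduce-% : ∀ k z → ∃ λ q → z ≡ reduce (suc k) z + q * + suc k
reduce-% k z = z /ℕ suc k , a≡a%ℕn+[a/ℕn]*n z (suc k)

%ℕ-period : ∀ z k → (z + + suc k) %ℕ suc k ≡ z %ℕ suc k
%ℕ-period z k = proj₁ (divMod-unique ((z + + suc k) /ℕ suc k) (z /ℕ suc k + 1ℤ) (n%ℕd<d (z + + suc k) (suc k))
    (n%ℕd<d z (suc k))
  (trans (sym (a≡a%ℕn+[a/ℕn]*n (z + + suc k) (suc k))) (trans (cong (_+ + suc k) (a≡a%ℕn+[a/ℕn]*n z (suc k)))
    (lem (+ (z %ℕ suc k)) (z /ℕ suc k) (+ suc k)))))
  where
  lem : ∀ r q s → r + q * s + s ≡ r + (q + 1ℤ) * s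
  lem = solve-∀

periodic-reduce : ∀ {k f} → Periodic (+ suc k) f → ∀ z → f (reduce (suc k) z) ≡ f z
periodic-reduce {k} {f} h z = let q , eq = reduce-% k z in
  trans (sym (periodic-* {f = f} h q (reduce (suc k) z))) (cong f (sym eq))

lsum : (ℤ → ℤ) → List ℤ → ℤ
lsum f []       = 0ℤ
lsum f (x ∷ xs) = f x + lsum f xs

lsum-cong : ∀ {f g} → (∀ z → f z ≡ g z) → ∀ xs → lsum f xs ≡ lsum g xs
lsum-cong h []       = refl
lsum-cong h (x ∷ xs) = cong₂ _+_ (h x) (lsum-cong h xs)

lsum-++ : ∀ f xs ys → lsum f (xs ++ ys) ≡ lsum f xs + lsum f ys
lsum-++ f []       ys = sym (+-identityˡ _)
lsum-++ f (x ∷ xs) ys = trans (cong (_+_ (f x)) (lsum-++ f xs ys)) (sym (+-assoc (f x) _ _))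

lsum-map : ∀ f g xs → lsum f (map g xs) ≡ lsum (λ x → f (g x)) xs
lsum-map f g []       = refl
lsum-map f g (x ∷ xs) = cong (_+_ (f (g x))) (lsum-map f g xs)

lsum-↭ : ∀ f {xs ys} → xs ↭ ys → lsum f xs ≡ lsum f ys
lsum-↭ f Perm.refl = refl
lsum-↭ f (prep x p) = cong (_+_ (f x)) (lsum-↭ f p)
lsum-↭ f (swap {xs} {ys} x y p) = trans (cong (λ w → f x + (f y + w)) (lsum-↭ f p)) (lem (f x) (f y) (lsum f ys))
  where
  lem : ∀ a b c → a + (b + c) ≡ b + (a + c)
  lem = solve-∀
lsum-↭ f (Perm.trans p q) = trans (lsum-↭ f p) (lsum-↭ f q)

lsum-δ-∈ : ∀ r xs → lsum (δ r) xs ≢ 0ℤ → r ∈ xs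
lsum-δ-∈ r []       ne = ⊥-elim (ne refl)
lsum-δ-∈ r (x ∷ xs) ne with x ≟ r
... | yes refl = here refl
... | no _ = there (lsum-δ-∈ r xs λ eq → ne (trans (+-identityˡ _) eq))

lsum-δ-≥0 : ∀ r xs → 0ℤ ≤ lsum (δ r) xs
lsum-δ-≥0 r []       = ≤-refl
lsum-δ-≥0 r (x ∷ xs) = ι≥0 ⌊ x ≟ r ⌋ ⊕ lsum-δ-≥0 r xs
  where
  ι≥0 : ∀ b → 0ℤ ≤ ι b
  ι≥0 true = 0≤+
  ι≥0 false = 0≤+

lsum-δ-self : ∀ x xs → lsum (δ x) (x ∷ xs) ≢ 0ℤ
lsum-δ-self x xs eq = <-absurd {0ℤ} (≤-by (lsum-δ-≥0 x xs)
    (trans (cong (λ w → w + lsum (δ x) xs - 1ℤ) (δ-refl x)) (lem (lsum (δ x) xs)))) (≤-reflexive eq)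
  where
  lem : ∀ a → 1ℤ + a - 1ℤ ≡ a
  lem = solve-∀

-- `lsum (δ r)` is the multiplicity of `r`. Removing one common entry from both lists keeps the
-- multiplicities equal, so the permutation is built head by head.
lsum-δ⇒↭ : ∀ xs ys → (∀ r → lsum (δ r) xs ≡ lsum (δ r) ys) → xs ↭ ys
lsum-δ⇒↭ [] [] h = ↭-refl
lsum-δ⇒↭ [] (y ∷ ys) h = ⊥-elim (lsum-δ-self y ys (sym (h y)))
lsum-δ⇒↭ (x ∷ xs) ys h with ∈-∃++ (lsum-δ-∈ x ys (λ eq → lsum-δ-self x xs (trans (h x) eq)))
... | as , bs , refl = ↭-trans (prep x (lsum-δ⇒↭ xs (as ++ bs) λ r →
  +-cancelˡ (δ r x) (trans (h r) (lsum-↭ (δ r) (shift x as bs))))) (↭-sym (shift x as bs))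

rowSum-cong : ∀ {f g} → (∀ z → f z ≡ g z) → ∀ ls → rowSum ls f ≡ rowSum ls g
rowSum-cong h []       = refl
rowSum-cong h (l ∷ ls) = cong₂ _+_ (cong₂ _-_ (h (+ l - 1ℤ)) (h (- 1ℤ))) (rowSum-cong (λ z → h (z - 1ℤ)) ls)

lsum-telescope : ∀ φ (f : ℕ → ℤ) → (∀ k → f (suc k) ≡ f k + 1ℤ) → ∀ l → lsum (Δ φ) (applyUpTo f l) ≡ φ (f l) - φ (f 0)
lsum-telescope φ f h zero = sym (+-inverseʳ (φ (f 0)))
lsum-telescope φ f h (suc l) = trans (cong₂ _+_ (cong (λ w → φ w - φ (f 0)) (sym (h 0)))
  (lsum-telescope φ (λ k → f (suc k)) (λ k → h (suc k)) l)) (lem (φ (f 1)) (φ (f 0)) (φ (f (suc l))))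
  where
  lem : ∀ a b c → a - b + (c - a) ≡ c - b
  lem = solve-∀

-- The values in a row are consecutive, so `Δ φ` telescopes along it. What remains is `φ` one place
-- past the bead of the row minus `φ` one place past its vacuum bead, whence the `z + 1ℤ`.
lsum-partVals : ∀ φ c i ls → lsum (Δ φ) (partVals c i ls) ≡ rowSum ls (λ z → φ (z + 1ℤ - + i + c))
lsum-partVals φ c i []       = refl
lsum-partVals φ c i (l ∷ ls) = trans (lsum-++ (Δ φ) (rowVals c i l) (partVals c (suc i) ls)) (cong₂ _+_
  (trans (lsum-telescope φ (λ b → + b - + i + c) (λ k → lem₀ (+ k) (+ i) c) l)
    (cong₂ _-_ (cong φ (lem₁ (+ l) (+ i) c)) (cong φ (lem₁ 0ℤ (+ i) c))))
  (trans (lsum-partVals φ c (suc i) ls) (rowSum-cong (λ z → cong φ (lem₂ z (+ i) c)) ls)))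
  where
  lem₀ : ∀ k i c → 1ℤ + k - i + c ≡ k - i + c + 1ℤ
  lem₀ = solve-∀
  lem₁ : ∀ k i c → k - i + c ≡ k - 1ℤ + 1ℤ - i + c
  lem₁ = solve-∀
  lem₂ : ∀ z i c → z + 1ℤ - (1ℤ + i) + c ≡ z - 1ℤ + 1ℤ - i + c
  lem₂ = solve-∀

beadSum : ℤ → (ℤ → ℤ) → Bipartition → ℤ
beadSum a φ (λ′ , μ) = rowSum λ′ (λ z → φ (z + 1ℤ)) + rowSum μ (λ z → φ (z + 1ℤ + a))

-- Periodicity of `Δ φ` makes its value at a reduced residue the value at the integer that was
-- reduced, so the telescoping survives the reduction.
lsum-content : ∀ {k} a φ β → Periodic (+ suc k) (Δ φ) → lsum (Δ φ) (content (suc k) (0ℤ , a) β) ≡ beadSum a φ β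
lsum-content {k} a φ (λ′ , μ) per = trans (lsum-map (Δ φ) (reduce (suc k)) (partVals 0ℤ 0 λ′ ++ partVals a 0 μ))
  (trans (lsum-cong (periodic-reduce {f = Δ φ} per) (partVals 0ℤ 0 λ′ ++ partVals a 0 μ))
  (trans (lsum-++ (Δ φ) (partVals 0ℤ 0 λ′) (partVals a 0 μ)) (cong₂ _+_
    (trans (lsum-partVals φ 0ℤ 0 λ′) (rowSum-cong (λ z → cong φ (lem₁ z)) λ′))
    (trans (lsum-partVals φ a 0 μ) (rowSum-cong (λ z → cong φ (lem₂ z a)) μ)))))
  where
  lem₁ : ∀ z → z + 1ℤ - 0ℤ + 0ℤ ≡ z + 1ℤ
  lem₁ = solve-∀
  lem₂ : ∀ z a → z + 1ℤ - 0ℤ + a ≡ z + 1ℤ + a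
  lem₂ = solve-∀

content⇒beadSum : ∀ {k a β β′} → SameContent (suc k) (0ℤ , a) β β′ →
  ∀ φ → Periodic (+ suc k) (Δ φ) → beadSum a φ β ≡ beadSum a φ β′
content⇒beadSum {a = a} {β} {β′} sc φ per = trans (sym (lsum-content a φ β per))
    (trans (lsum-↭ (Δ φ) sc) (lsum-content a φ β′ per))

-- The test potential for a residue `r` is a primitive of the indicator of its class; the
-- corresponding bead sum is the multiplicity of `r` in the content. `reduce-idem` enters since the
-- entries of a content are already reduced.
beadSum⇒content : ∀ {k a β β′} → (∀ φ → Periodic (+ suc k) (Δ φ) → beadSum a φ β ≡ beadSum a φ β′) →
  SameContent (suc k) (0ℤ , a) β β′
beadSum⇒content {k} {a} {λ′ , μ} {λ″ , μ′} h = lsum-δ⇒↭ _ _ λ r → trans (count≡ r (λ′ , μ))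
    (trans (h (φ r) (per r)) (sym (count≡ r (λ″ , μ′))))
  where
  ψ φ : ℤ → ℤ → ℤ
  ψ r z = δ r (reduce (suc k) z)
  φ r = Anti (ψ r)
  per : ∀ r → Periodic (+ suc k) (Δ (φ r))
  per r z = trans (Δ-Anti (ψ r) (z + + suc k)) (trans (cong (λ w → δ r (+ w)) (%ℕ-period z k))
      (trans (sym (Δ-Anti (ψ r) z)) (sym (+-identityʳ _))))
  reduce-idem : ∀ z → reduce (suc k) (reduce (suc k) z) ≡ reduce (suc k) z
  reduce-idem z = periodic-reduce {f = reduce (suc k)} (λ w → trans (cong +_ (%ℕ-period w k)) (sym (+-identityʳ _))) z
  count≡ : ∀ r β → lsum (δ r) (content (suc k) (0ℤ , a) β) ≡ beadSum a (φ r) β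
  count≡ r β@(λ′ , μ) = trans (trans (lsum-map (δ r) (reduce (suc k)) vals) (trans
      (lsum-cong (λ z → sym (trans (Δ-Anti (ψ r) (reduce (suc k) z)) (cong (δ r) (reduce-idem z)))) vals)
      (sym (lsum-map (Δ (φ r)) (reduce (suc k)) vals)))) (lsum-content a (φ r) β (per r))
    where
    vals : List ℤ
    vals = partVals 0ℤ 0 λ′ ++ partVals a 0 μ

-- Heights

-- For a set χ closed under subtracting g, π z + 1 is the number of elements of χ in z + g ℕ, or
-- minus the number of non-elements below z in its class modulo g.
IsHeight : ℕ → (ℤ → Bool) → (ℤ → ℤ) → Set
IsHeight g χ π = Quasi (+ g) (- 1ℤ) π × (∀ z → χ z ≡ nonneg (π z))

desc-* : ∀ {g f} → Quasi g (- 1ℤ) f → ∀ k z → f (z + k * g) ≡ f z - k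
desc-* {g} {f} h k z = trans (quasi-* {g} { - 1ℤ} {f} h k z) (lem (f z) k)
  where
  lem : ∀ w k → w + k * - 1ℤ ≡ w - k
  lem = solve-∀

-- After `f z` steps of `g` the function `f` has reached 0, so the hypothesis gives `h ≥ 0` there,
-- where `h` has dropped by `f z`. In this way inclusions of sets become inequalities of heights.
desc-dominates : ∀ {g f h} → Quasi g (- 1ℤ) f → Quasi g (- 1ℤ) h →
  (∀ z → nonneg (f z) ≡ true → nonneg (h z) ≡ true) → ∀ z → f z ≤ h z
desc-dominates {g} {f} {h} qf qh imp z = 0≤i-j⇒j≤i (subst (0ℤ ≤_) (desc-* {g} {h} qh (f z) z)
  (true-nonneg (imp (z + f z * g) (nonneg-true (≤-reflexive
      (sym (trans (desc-* {g} {f} qf (f z) z) (+-inverseʳ (f z)))))))))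

height-unique : ∀ {g χ χ′ π π′} → IsHeight g χ π → IsHeight g χ′ π′ → (∀ z → χ z ≡ χ′ z) → ∀ z → π z ≡ π′ z
height-unique {π = π} {π′} (q , h) (q′ , h′) eq z = ≤-antisym
  (desc-dominates {f = π} {h = π′} q q′ (λ w p → trans (sym (h′ w)) (trans (sym (eq w)) (trans (h w) p))) z)
  (desc-dominates {f = π′} {h = π} q′ q (λ w p → trans (sym (h w)) (trans (eq w) (trans (h′ w) p))) z)

threshold : ∀ n (P : ℤ → Bool) k → P k ≡ true → P (k + + n) ≡ false → ∃ λ m → P m ≡ true × P (m + 1ℤ) ≡ false
threshold zero P k p q with trans (sym p) (trans (cong P (sym (+-identityʳ k))) q)
... | ()
threshold (suc n) P k p q with P (k + 1ℤ) in eq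
... | false = k , p , eq
... | true  = threshold n P (k + 1ℤ) eq (trans (cong P (+-assoc k 1ℤ (+ n))) q)

closed-* : ∀ {g χ} → Closed g χ → ∀ n z → χ z ≡ true → χ (z - + n * + g) ≡ true
closed-* {g} {χ} cl zero z p = trans (cong χ (lem z (+ g))) p
  where
  lem : ∀ z g → z - 0ℤ * g ≡ z
  lem = solve-∀
closed-* {g} {χ} cl (suc n) z p = trans (cong χ (lem z (+ n) (+ g))) (cl (z - + n * + g) (closed-* cl n z p))
  where
  lem : ∀ z n g → z - (1ℤ + n) * g ≡ z - n * g - g
  lem = solve-∀

≤⇒+ℕ : ∀ {x y} → x ≤ y → ∃ λ n → y ≡ x + + n
≤⇒+ℕ {x} {y} p = ∣ y - x ∣ , trans (lem x y) (cong (_+_ x) (sym (0≤i⇒+∣i∣≡i (gap p))))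
  where
  lem : ∀ x y → y ≡ x + (y - x)
  lem = solve-∀

crossing : ∀ {k χ c} → Maya χ c → ∀ z → ∃ λ j → χ (z + j * + suc k) ≡ true × χ (z + (j + 1ℤ) * + suc k) ≡ false
-- A step on the runner has length at least 1, so `∣ z ∣ + b + 1` steps down lead below `- b`, where
-- the set is full, and `∣ z ∣ + b` steps up lead to `b` or beyond, where it is empty. The search
-- length is the sum of the two.
crossing {k} {χ} m z = threshold (∣ z ∣ ℕ.+ b ℕ.+ suc (∣ z ∣ ℕ.+ b)) (λ j → χ (z + j * + suc k)) (- + suc (∣ z ∣ ℕ.+ b))
  (full m (z + - + suc (∣ z ∣ ℕ.+ b) * + suc k)
    (≤-by (gap (i≤+∣i∣ z) ⊕ 0≤-* {+ suc (∣ z ∣ ℕ.+ b)} {+ k} 0≤+ 0≤+) (lem₁ z (+ ∣ z ∣) (+ b) (+ k))))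
  (empty m (z + (- + suc (∣ z ∣ ℕ.+ b) + + (∣ z ∣ ℕ.+ b ℕ.+ suc (∣ z ∣ ℕ.+ b))) * + suc k)
    (≤-by (gap (-i≤+∣i∣ z) ⊕ 0≤-* {+ (∣ z ∣ ℕ.+ b)} {+ k} 0≤+ 0≤+) (lem₂ z (+ ∣ z ∣) (+ b) (+ k))))
  where
  b : ℕ
  b = bound m
  lem₁ : ∀ z a b k → 0ℤ - (z + - (1ℤ + (a + b)) * (1ℤ + k) + b + 1ℤ) ≡ a - z + (1ℤ + (a + b)) * k
  lem₁ = solve-∀
  lem₂ : ∀ z a b k → z + (- (1ℤ + (a + b)) + (a + b + (1ℤ + (a + b)))) * (1ℤ + k) - b ≡ a - - z + (a + b) * k
  lem₂ = solve-∀

-- A closed set meets each runner in a down-ray, so a crossing is unique (`bounded`). Comparing the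
-- crossings seen from `z` and from `z + g` gives the quasi-period.
crossing-height : ∀ {g χ} → Closed g χ → (π : ℤ → ℤ) →
  (∀ z → χ (z + π z * + g) ≡ true × χ (z + (π z + 1ℤ) * + g) ≡ false) → IsHeight g χ π
crossing-height {g₀} {χ} cl π crosses = quasi , sign
  where
  g : ℤ
  g = + g₀
  below : ∀ z i j → j ≤ i → χ (z + i * g) ≡ true → χ (z + j * g) ≡ true
  below z i j j≤i p with ≤⇒+ℕ j≤i
  ... | n , refl = trans (cong χ (lem z j (+ n) g)) (closed-* cl n (z + (j + + n) * g) p)
    where
    lem : ∀ z j n g → z + j * g ≡ z + (j + n) * g - n * g
    lem = solve-∀
  bounded : ∀ z i j → χ (z + i * g) ≡ true → χ (z + (j + 1ℤ) * g) ≡ false → i ≤ j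
  bounded z i j p q with ≤-or-> i j
  ... | inj₁ le = le
  ... | inj₂ gt with trans (sym (below z i (j + 1ℤ) gt p)) q
  ...   | ()
  z+0*g : ∀ z → χ (z + 0ℤ * g) ≡ χ z
  z+0*g z = cong χ (+-identityʳ z)
  sign : ∀ z → χ z ≡ nonneg (π z)
  sign z with ≤-or-> 0ℤ (π z)
  ... | inj₁ p = trans (trans (sym (z+0*g z)) (below z (π z) 0ℤ p (proj₁ (crosses z)))) (sym (nonneg-true p))
  ... | inj₂ p with χ z in eq
  ...   | false = sym (nonneg-false p)
  ...   | true with trans (sym (below z 0ℤ (π z + 1ℤ) p (trans (z+0*g z) eq))) (proj₂ (crosses z))
  ...     | ()
  quasi : Quasi g (- 1ℤ) π
  quasi z = let p , q = crosses z ; p′ , q′ = crosses (z + g) ; i = π (z + g) ; j = π z in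
    ≤-antisym (≤-by (gap (bounded z (i + 1ℤ) j (trans (cong χ (lem z i g)) p′) q)) (lem₁ i j))
              (≤-by (gap (bounded z j (i + 1ℤ) p (trans (cong χ (lem₃ z i g)) q′))) (lem₂ i j))
    where
    lem : ∀ z i g → z + (i + 1ℤ) * g ≡ z + g + i * g
    lem = solve-∀
    lem₁ : ∀ i j → j + - 1ℤ - i ≡ j - (i + 1ℤ)
    lem₁ = solve-∀
    lem₂ : ∀ i j → i - (j + - 1ℤ) ≡ i + 1ℤ - j
    lem₂ = solve-∀
    lem₃ : ∀ z i g → z + (i + 1ℤ + 1ℤ) * g ≡ z + g + (i + 1ℤ) * g
    lem₃ = solve-∀

height-exists : ∀ {k χ c} → Maya χ c → Closed (suc k) χ → ∃ λ π → IsHeight (suc k) χ π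
height-exists {k} m cl = (λ z → proj₁ (crossing {k} m z)) , crossing-height cl _ λ z → proj₂ (crossing {k} m z)

-- Moving the window up by one replaces `f B` by `f (B + g)`, a change of `c`; so the sum is itself
-- quasi-periodic in its starting point.
sum-period : ∀ {c} g f → Quasi (+ g) c f → ∀ A → sumFrom A g f ≡ sumFrom 0ℤ g f + A * c
sum-period {c} g f q A = trans (cong (λ B → sumFrom B g f) (lem A)) (quasi-* {1ℤ} {c} {λ B → sumFrom B g f} step A 0ℤ)
  where
  lem : ∀ A → A ≡ 0ℤ + A * 1ℤ
  lem = solve-∀
  step : ∀ B → sumFrom (B + 1ℤ) g f ≡ sumFrom B g f + c
  step B = +-cancelˡ (f B) (trans (sum-snoc B g f) (trans (cong (_+_ (sumFrom B g f)) (q B))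
      (lem′ (sumFrom B g f) (f B) c)))
    where
    lem′ : ∀ s a c → s + (a + c) ≡ a + (s + c)
    lem′ = solve-∀

bounded-on : ∀ A n (f : ℤ → ℤ) → ∃ λ M → ∀ z → A ≤ z → z + 1ℤ ≤ A + + n → f z ≤ + M × - f z ≤ + M
bounded-on A zero f = 0 , λ z p q → ⊥-elim (<-absurd q (subst (_≤ z) (sym (+-identityʳ A)) p))
bounded-on A (suc n) f with bounded-on (A + 1ℤ) n f
... | M , h = ∣ f A ∣ ℕ.+ M , go
  where
  go : ∀ z → A ≤ z → z + 1ℤ ≤ A + + suc n → f z ≤ + (∣ f A ∣ ℕ.+ M) × - f z ≤ + (∣ f A ∣ ℕ.+ M)
  go z p q with ≤-or-> z A
  ... | inj₁ r with ≤-antisym p r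
  ...   | refl = ≤-trans (i≤+∣i∣ (f z)) (+≤+ (ℕ.m≤m+n ∣ f z ∣ M)) , ≤-trans (-i≤+∣i∣ (f z)) (+≤+ (ℕ.m≤m+n ∣ f z ∣ M))
  go z p q | inj₂ r = let h₁ , h₂ = h z r (subst (z + 1ℤ ≤_) (sym (+-assoc A 1ℤ (+ n))) q) in
    ≤-trans h₁ (+≤+ (ℕ.m≤n+m M ∣ f A ∣)) , ≤-trans h₂ (+≤+ (ℕ.m≤n+m M ∣ f A ∣))

-- The positive part. At `π z + 1` it is the number of beads at or above `z` on its runner.
relu : ℤ → ℤ
relu (+ n)    = + n
relu -[1+ n ] = 0ℤ

relu-nonneg : ∀ {x} → 0ℤ ≤ x → relu x ≡ x
relu-nonneg {+ n} _ = refl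

relu-nonpos : ∀ {x} → x ≤ 0ℤ → relu x ≡ 0ℤ
relu-nonpos {+ zero} _ = refl
relu-nonpos {+ suc n} (+≤+ ())
relu-nonpos { -[1+ n ]} _ = refl

relu-step : ∀ x → ι (nonneg x) * 1ℤ ≡ relu (x + 1ℤ) - relu x
relu-step (+ n) = sym (lem (+ n))
  where
  lem : ∀ n → n + 1ℤ - n ≡ 1ℤ * 1ℤ
  lem = solve-∀
relu-step -[1+ zero ] = refl
relu-step -[1+ suc n ] = refl

-- `M` bounds the absolute value of `π` on one period, and `π` falls by one with each step of `g`.
-- Hence its sign is settled outside the radius `g * (1 + M)`.
desc-bounds : ∀ {k π} → Quasi (+ suc k) (- 1ℤ) π → ∀ M →
    (∀ z → 0ℤ ≤ z → z + 1ℤ ≤ 0ℤ + + suc k → π z ≤ + M × - π z ≤ + M) →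
  ∀ b → + b ≡ + suc k * (1ℤ + + M) →
  (∀ z → z + + b + 1ℤ ≤ 0ℤ → 0ℤ ≤ π z) × (∀ z → + b ≤ z → π z + 1ℤ ≤ 0ℤ)
desc-bounds {k} {π} q M bd b b≡ = below , above
  where
  g : ℤ
  g = + suc k
  π-decomp : ∀ z → ∃ λ r → ∃ λ j → z ≡ + r + j * g × 0ℤ ≤ g - (1ℤ + + r) × π z ≡ π (+ r) - j × 0ℤ ≤ + M - π (+ r) ×
      0ℤ ≤ + M - - π (+ r)
  π-decomp z = r , j , z≡ , gap (+≤+ r<) , trans (cong π z≡) (desc-* {g} {π} q j (+ r)) , gap
      (proj₁ (bd (+ r) 0≤+ r-in)) , gap (proj₂ (bd (+ r) 0≤+ r-in))
    where
    r : ℕ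
    r = z %ℕ suc k
    j : ℤ
    j = z /ℕ suc k
    r< : r ℕ.< suc k
    r< = n%ℕd<d z (suc k)
    z≡ : z ≡ + r + j * g
    z≡ = a≡a%ℕn+[a/ℕn]*n z (suc k)
    r-in : + r + 1ℤ ≤ 0ℤ + g
    r-in = ≤-trans (≤-reflexive (+-comm (+ r) 1ℤ)) (≤-trans (+≤+ r<) (≤-reflexive (sym (+-identityˡ g))))
  below : ∀ z → z + + b + 1ℤ ≤ 0ℤ → 0ℤ ≤ π z
  below z p with π-decomp z
  ... | r , j , z≡ , r< , π≡ , _ , lo with ≤-or-> 0ℤ (j + + M + 1ℤ)
  ...   | inj₁ h = ⊥-elim (<-absurd {0ℤ} (≤-by (gap p′ ⊕ 0≤-* {j + + M + 1ℤ} {g} h 0≤+ ⊕ 0≤+ {r}) (lem (+ r) j g (+ M)))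
      ≤-refl)
    where
    p′ : + r + j * g + g * (1ℤ + + M) + 1ℤ ≤ 0ℤ
    p′ = ≤-trans (≤-reflexive (cong₂ (λ x y → x + y + 1ℤ) (sym z≡) (sym b≡))) p
    lem : ∀ r j g M → 0ℤ - (0ℤ + 1ℤ) ≡ 0ℤ - (r + j * g + g * (1ℤ + M) + 1ℤ) + (j + M + 1ℤ) * g + r
    lem = solve-∀
  ...   | inj₂ h = ≤-by (lo ⊕ gap h ⊕ 0≤+ {2}) (trans (cong (_- 0ℤ) π≡) (lem (π (+ r)) j (+ M)))
    where
    lem : ∀ x j M → x - j - 0ℤ ≡ M - - x + (0ℤ - (j + M + 1ℤ + 1ℤ)) + (1ℤ + 1ℤ)
    lem = solve-∀
  above : ∀ z → + b ≤ z → π z + 1ℤ ≤ 0ℤ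
  above z p with π-decomp z
  ... | r , j , z≡ , r< , π≡ , hi , _ with ≤-or-> j (+ M)
  ...   | inj₁ h = ⊥-elim (<-absurd {0ℤ} (≤-by (gap p′ ⊕ 0≤-* {+ M - j} {g} (gap h) 0≤+ ⊕ r<) (lem (+ r) j g (+ M)))
      ≤-refl)
    where
    p′ : g * (1ℤ + + M) ≤ + r + j * g
    p′ = ≤-trans (≤-reflexive (sym b≡)) (≤-trans p (≤-reflexive z≡))
    lem : ∀ r j g M → 0ℤ - (0ℤ + 1ℤ) ≡ r + j * g - g * (1ℤ + M) + (M - j) * g + (g - (1ℤ + r))
    lem = solve-∀
  ...   | inj₂ h = ≤-by (hi ⊕ gap h) (trans (cong (λ w → 0ℤ - (w + 1ℤ)) π≡) (lem (π (+ r)) j (+ M)))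
    where
    lem : ∀ x j M → 0ℤ - (x - j + 1ℤ) ≡ M - x + (j - (M + 1ℤ))
    lem = solve-∀

height-Maya : ∀ {k χ π} → IsHeight (suc k) χ π → Maya χ (sumFrom 0ℤ (suc k) (λ z → π z + 1ℤ))
height-Maya {k} {χ} {π} (q , sign) = let M , bd = bounded-on 0ℤ (suc k) π ; b = suc k ℕ.* suc M in
  from-bound b (desc-bounds q M bd b (pos-* (suc k) (suc M)))
  where
  g : ℤ
  g = + suc k
  ρ : ℤ → ℤ
  ρ z = relu (π z + 1ℤ)
  -- χ = ρ - ρ (_ + g), so the number of elements in a window telescopes.
  count′ : ∀ b → (∀ z → z + + b + 1ℤ ≤ 0ℤ → 0ℤ ≤ π z) → (∀ z → + b ≤ z → π z + 1ℤ ≤ 0ℤ) →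
    ∀ A n → A + + b ≤ 0ℤ → + b ≤ A + + n → sumOver A n χ one ≡ sumFrom 0ℤ (suc k) (λ z → π z + 1ℤ) - A
  count′ b below above A n p r = begin
    sumOver A n χ one
      ≡⟨ sum-cong A n (λ z → trans (cong (λ c → ι c * 1ℤ) (sign z)) (trans (relu-step (π z))
           (cong (λ w → ρ z - relu w) (trans (lem₁ (π z)) (cong (_+ 1ℤ) (sym (q z))))))) ⟩
    sumFrom A n (λ z → ρ z - ρ (z + g))
      ≡⟨ sum-telescope A n (suc k) ρ ⟩
    sumFrom A (suc k) ρ - sumFrom (A + + n) (suc k) ρ
      -- On the lowest period it suffices that `π z ≥ - 1`, which holds because `z - g` lies in the
      -- full region; this is exactly when `relu (π z + 1)` is `π z + 1`. On the period above the
      -- window `ρ` vanishes.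
      ≡⟨ cong₂ _-_ (sum-cong-in A (suc k) bottom) (sum-zero (A + + n) (suc k) ρ top) ⟩
    sumFrom A (suc k) (λ z → π z + 1ℤ) - 0ℤ
      ≡⟨ cong (_- 0ℤ) (sum-period (suc k) (λ z → π z + 1ℤ) (λ z → trans (cong (_+ 1ℤ) (q z)) (lem₂ (π z))) A) ⟩
    sumFrom 0ℤ (suc k) (λ z → π z + 1ℤ) + A * - 1ℤ - 0ℤ
      ≡⟨ lem₃ (sumFrom 0ℤ (suc k) (λ z → π z + 1ℤ)) A ⟩
    sumFrom 0ℤ (suc k) (λ z → π z + 1ℤ) - A ∎
    where
    open ≡-Reasoning
    lem₁ : ∀ x → x ≡ x + - 1ℤ + 1ℤ
    lem₁ = solve-∀
    lem₂ : ∀ x → x + - 1ℤ + 1ℤ ≡ x + 1ℤ + - 1ℤ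
    lem₂ = solve-∀
    lem₃ : ∀ s A → s + A * - 1ℤ - 0ℤ ≡ s - A
    lem₃ = solve-∀
    bottom : ∀ z → A ≤ z → z + 1ℤ ≤ A + + suc k → ρ z ≡ π z + 1ℤ
    bottom z _ z< = relu-nonneg (≤-by (below (z - g) (≤-by (gap z< ⊕ gap p) (lem₄ z A g (+ b))))
      (trans (lem₅ (π z)) (trans (cong (λ w → w + 1ℤ) (sym (π-g))) (x-1+1′ _))))
      where
      lem₄ : ∀ z A g b → 0ℤ - (z - g + b + 1ℤ) ≡ A + g - (z + 1ℤ) + (0ℤ - (A + b))
      lem₄ = solve-∀
      lem₅ : ∀ x → x + 1ℤ - 0ℤ ≡ x + 1ℤ
      lem₅ = solve-∀
      x-1+1′ : ∀ x → x + - 1ℤ + 1ℤ ≡ x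
      x-1+1′ = solve-∀
      z-g+g : ∀ z g → z - g + g ≡ z
      z-g+g = solve-∀
      π-g : π (z - g) + - 1ℤ ≡ π z
      π-g = trans (sym (q (z - g))) (cong π (z-g+g z g))
    top : ∀ z → A + + n ≤ z → z + 1ℤ ≤ A + + n + + suc k → ρ z ≡ 0ℤ
    top z p′ _ = relu-nonpos (above z (≤-trans r p′))
  from-bound : ∀ b → (∀ z → z + + b + 1ℤ ≤ 0ℤ → 0ℤ ≤ π z) × (∀ z → + b ≤ z → π z + 1ℤ ≤ 0ℤ) →
    Maya χ (sumFrom 0ℤ (suc k) (λ z → π z + 1ℤ))
  from-bound b (below , above) = record
    { bound = b
    ; full  = λ z p → trans (sign z) (nonneg-true (below z p))
    ; empty = λ z p → trans (sign z) (nonneg-false (above z p))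
    ; count = count′ b below above
    }

Maya-charge : ∀ {χ c c′} → Maya χ c → Maya χ c′ → c ≡ c′
Maya-charge {χ} {c} {c′} m m′ = trans (lem c A) (trans (cong (_+ A) (trans
  (sym (count m A n (win-low m≤b) (win-high m≤b))) (count m′ A n (win-low m′≤b) (win-high m′≤b)))) (sym (lem c′ A)))
  where
  b n : ℕ
  b = bound m ℕ.+ bound m′
  n = b ℕ.+ b
  A : ℤ
  A = - + b
  lem : ∀ c A → c ≡ c - A + A
  lem = solve-∀
  m≤b : bound m ℕ.≤ b
  m≤b = ℕ.m≤m+n (bound m) (bound m′)
  m′≤b : bound m′ ℕ.≤ b
  m′≤b = ℕ.m≤n+m (bound m′) (bound m)

-- Exchanging beads

in-window : ∀ {A n x} → A + + suc ∣ x ∣ ≤ 0ℤ → + suc ∣ x ∣ ≤ A + + n → A ≤ x × x + 1ℤ ≤ A + + n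
in-window {A} {n} {x} p q =
  ≤-by (gap p ⊕ gap (-i≤+∣i∣ x) ⊕ 0≤+ {1}) (lem A x (+ ∣ x ∣)) ,
  ≤-trans (≤-trans (+-monoˡ-≤ 1ℤ (i≤+∣i∣ x)) (≤-reflexive (+-comm (+ ∣ x ∣) 1ℤ))) q
  where
  lem : ∀ A x k → x - A ≡ 0ℤ - (A + (1ℤ + k)) + (k - - x) + 1ℤ
  lem = solve-∀

-- Turns the relative sum into a difference of two finite sums over one symmetric window, so that
-- several partitions can be compared in a common window.
rowSum-sumOver : ∀ ls b f → IsPartition ls → size-bound ls ℕ.≤ b →
  rowSum ls f ≡ sumOver (- + b) (b ℕ.+ b) (bead ls) f - sumOver (- + b) (b ℕ.+ b) (bead []) f
rowSum-sumOver ls b f ip p = trans (lem (sumOver (- + b) (b ℕ.+ b) (bead []) f) (rowSum ls f))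
  (cong (_- sumOver (- + b) (b ℕ.+ b) (bead []) f) (sym
      (sumOver-bead-covers ls (- + b) (b ℕ.+ b) f ip (win-low p , win-high p))))
  where
  lem : ∀ w r → r ≡ w + r - w
  lem = solve-∀

move : (ℤ → Bool) → ℤ → ℤ → ℤ → Bool
move χ x y z = ⌊ z ≟ y ⌋ ∨ (χ z ∧ not ⌊ z ≟ x ⌋)

true≢false : ∀ {b} → b ≡ true → b ≡ false → ⊥
true≢false refl ()

move-x : ∀ {χ x y} → χ x ≡ true → χ y ≡ false → move χ x y x ≡ false
move-x {χ} {x} {y} p q = cong₂ _∨_ (⌊≟⌋-≢ {x} {y} λ eq → true≢false p (trans (cong χ eq) q))
  (trans (cong (λ b → χ x ∧ not b) (⌊≟⌋-refl {x} refl)) (∧-zeroʳ (χ x)))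

move-other : ∀ {χ x y z} → z ≢ x → z ≢ y → move χ x y z ≡ χ z
move-other {χ} {x} {y} {z} p q rewrite ⌊≟⌋-≢ p | ⌊≟⌋-≢ q = ∧-identityʳ (χ z)

sumOver-move : ∀ A n {χ x y} f → χ x ≡ true → χ y ≡ false → A ≤ x × x + 1ℤ ≤ A + + n → A ≤ y × y + 1ℤ ≤ A + + n →
  sumOver A n (move χ x y) f ≡ sumOver A n χ f + (f y - f x)
sumOver-move A n {χ} {x} {y} f p q (x₁ , x₂) (y₁ , y₂) = begin
  sumOver A n (move χ x y) f
    ≡⟨ sum-cong A n pointwise ⟩
  sumFrom A n (λ z → ι (χ z) * f z + (δ y z * f z - δ x z * f z))
    ≡⟨ sum-+ A n (λ z → ι (χ z) * f z) _ ⟩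
  sumOver A n χ f + sumFrom A n (λ z → δ y z * f z - δ x z * f z)
    ≡⟨ cong (_+_ (sumOver A n χ f)) (trans (sum-- A n (λ z → δ y z * f z) (λ z → δ x z * f z))
         (cong₂ _-_ (sum-δ A n y f y₁ y₂) (sum-δ A n x f x₁ x₂))) ⟩
  sumOver A n χ f + (f y - f x) ∎
  where
  open ≡-Reasoning
  lem₁ : ∀ w → 1ℤ * w ≡ 0ℤ * w + (1ℤ * w - 0ℤ * w)
  lem₁ = solve-∀
  lem₂ : ∀ w → 0ℤ * w ≡ 1ℤ * w + (0ℤ * w - 1ℤ * w)
  lem₂ = solve-∀
  lem₃ : ∀ c w → c * w ≡ c * w + (0ℤ * w - 0ℤ * w)
  lem₃ = solve-∀
  pointwise : ∀ z → ι (move χ x y z) * f z ≡ ι (χ z) * f z + (δ y z * f z - δ x z * f z)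
  pointwise z with z ≟ y | z ≟ x
  ... | yes refl | yes refl = ⊥-elim (true≢false p q)
  ... | yes refl | no _ rewrite q = lem₁ (f z)
  ... | no _ | yes refl rewrite p = lem₂ (f z)
  ... | no _ | no _ rewrite ∧-identityʳ (χ z) = lem₃ (ι (χ z)) (f z)

Maya-move : ∀ {χ c x y} → χ x ≡ true → χ y ≡ false → Maya χ c → Maya (move χ x y) c
Maya-move {χ} {c} {x} {y} p q m = record { bound = b ; full = full′ ; empty = empty′ ; count = count′ }
  where
  b : ℕ
  b = bound m ℕ.+ suc (∣ x ∣ ℕ.+ ∣ y ∣)
  m≤b : + bound m ≤ + b
  m≤b = +≤+ (ℕ.m≤m+n (bound m) _)
  x≤b : + suc ∣ x ∣ ≤ + b
  x≤b = +≤+ (ℕ.≤-trans (s≤s (ℕ.m≤m+n ∣ x ∣ ∣ y ∣)) (ℕ.m≤n+m _ (bound m)))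
  y≤b : + suc ∣ y ∣ ≤ + b
  y≤b = +≤+ (ℕ.≤-trans (s≤s (ℕ.m≤n+m ∣ y ∣ ∣ x ∣)) (ℕ.m≤n+m _ (bound m)))
  low : ∀ {u z} → + suc ∣ u ∣ ≤ + b → z + + b + 1ℤ ≤ 0ℤ → z ≢ u
  low {u} {z} h r = <⇒≢ˡ (≤-by (gap h ⊕ gap r ⊕ gap (-i≤+∣i∣ u) ⊕ 0≤+ {1}) (lem u z (+ ∣ u ∣) (+ b)))
    where
    lem : ∀ u z k b → u - (z + 1ℤ) ≡ b - (1ℤ + k) + (0ℤ - (z + b + 1ℤ)) + (k - - u) + 1ℤ
    lem = solve-∀
  high : ∀ {u z} → + suc ∣ u ∣ ≤ + b → + b ≤ z → z ≢ u
  high {u} {z} h r = <⇒≢ʳ (≤-by (gap h ⊕ gap r ⊕ gap (i≤+∣i∣ u)) (lem u z (+ ∣ u ∣) (+ b)))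
    where
    lem : ∀ u z k b → z - (u + 1ℤ) ≡ b - (1ℤ + k) + (z - b) + (k - u)
    lem = solve-∀
  full′ : ∀ z → z + + b + 1ℤ ≤ 0ℤ → move χ x y z ≡ true
  full′ z r = trans (move-other {χ} {x} {y} {z} (low {x} x≤b r) (low {y} y≤b r))
      (full m z (≤-trans (+-monoˡ-≤ 1ℤ (+-monoʳ-≤ z m≤b)) r))
  empty′ : ∀ z → + b ≤ z → move χ x y z ≡ false
  empty′ z r = trans (move-other {χ} {x} {y} {z} (high {x} x≤b r) (high {y} y≤b r)) (empty m z (≤-trans m≤b r))
  count′ : ∀ A n → A + + b ≤ 0ℤ → + b ≤ A + + n → sumOver A n (move χ x y) one ≡ c - A
  count′ A n r s = trans (sumOver-move A n one p q
      (in-window {A} {n} (≤-trans (+-monoʳ-≤ A x≤b) r) (≤-trans x≤b s))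
      (in-window {A} {n} (≤-trans (+-monoʳ-≤ A y≤b) r) (≤-trans y≤b s)))
    (trans (+-identityʳ _) (count m A n (≤-trans (+-monoʳ-≤ A m≤b) r) (≤-trans m≤b s)))

rowSum-move : ∀ {ls ms x y} f → IsPartition ls → IsPartition ms → bead ls x ≡ true → bead ls y ≡ false →
  (∀ z → bead ms z ≡ move (bead ls) x y z) → rowSum ms f ≡ rowSum ls f + (f y - f x)
rowSum-move {ls} {ms} {x} {y} f ip ip′ p q h = begin
  rowSum ms f
    ≡⟨ rowSum-sumOver ms b f ip′ (≤b (ℕ.m≤n+m sm sl)) ⟩
  sumOver A n (bead ms) f - sumOver A n (bead []) f
    ≡⟨ cong (_- sumOver A n (bead []) f) (trans (sumOver-cong A n f h) (sumOver-move A n f p q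
         (in-window {A} {n} (win-low x≤b) (win-high x≤b)) (in-window {A} {n} (win-low y≤b) (win-high y≤b)))) ⟩
  sumOver A n (bead ls) f + (f y - f x) - sumOver A n (bead []) f
    ≡⟨ lem (sumOver A n (bead ls) f) (f y - f x) (sumOver A n (bead []) f) ⟩
  sumOver A n (bead ls) f - sumOver A n (bead []) f + (f y - f x)
    ≡⟨ cong (_+ (f y - f x)) (rowSum-sumOver ls b f ip (≤b (ℕ.m≤m+n sl sm))) ⟨
  rowSum ls f + (f y - f x) ∎
  where
  open ≡-Reasoning
  sl sm b n : ℕ
  sl = size-bound ls
  sm = size-bound ms
  b = (sl ℕ.+ sm) ℕ.+ suc (∣ x ∣ ℕ.+ ∣ y ∣)
  n = b ℕ.+ b
  A : ℤ
  A = - + b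
  ≤b : ∀ {k} → k ℕ.≤ sl ℕ.+ sm → k ℕ.≤ b
  ≤b r = ℕ.≤-trans r (ℕ.m≤m+n _ _)
  x≤b : suc ∣ x ∣ ℕ.≤ b
  x≤b = ℕ.≤-trans (s≤s (ℕ.m≤m+n ∣ x ∣ ∣ y ∣)) (ℕ.m≤n+m _ (sl ℕ.+ sm))
  y≤b : suc ∣ y ∣ ℕ.≤ b
  y≤b = ℕ.≤-trans (s≤s (ℕ.m≤n+m ∣ y ∣ ∣ x ∣)) (ℕ.m≤n+m _ (sl ℕ.+ sm))
  lem : ∀ a d c → a + d - c ≡ a - c + d
  lem = solve-∀

-- Pigeonhole. If the window contained no such `y`, then `χ` minus `χ′` minus the indicator of `x`
-- would be nonnegative at every place, yet it sums to `c - c′ - 1`, which is negative.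
exchange : ∀ {χ χ′ c c′ x} → Maya χ c → Maya χ′ c′ → c ≤ c′ → χ x ≡ true → χ′ x ≡ false →
  ∃ λ y → χ′ y ≡ true × χ y ≡ false
exchange {χ} {χ′} {c} {c′} {x} m m′ c≤c′ p q = conclude (search A n λ z → χ′ z ∧ not (χ z))
  where
  b n : ℕ
  b = (bound m ℕ.+ bound m′) ℕ.+ suc ∣ x ∣
  n = b ℕ.+ b
  A : ℤ
  A = - + b
  m≤b : bound m ℕ.≤ b
  m≤b = ℕ.≤-trans (ℕ.m≤m+n (bound m) (bound m′)) (ℕ.m≤m+n _ _)
  m′≤b : bound m′ ℕ.≤ b
  m′≤b = ℕ.≤-trans (ℕ.m≤n+m (bound m′) (bound m)) (ℕ.m≤m+n _ _)
  x≤b : suc ∣ x ∣ ℕ.≤ b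
  x≤b = ℕ.m≤n+m _ (bound m ℕ.+ bound m′)
  lem : ∀ c c′ → c - (c′ + 1ℤ) ≡ c - c′ - 1ℤ
  lem = solve-∀
  lem′ : ∀ c c′ A → c - A - (c′ - A) ≡ c - c′
  lem′ = solve-∀
  term : ℤ → ℤ
  term z = ι (χ z) * 1ℤ - ι (χ′ z) * 1ℤ - δ x z * 1ℤ
  x-in : A ≤ x × x + 1ℤ ≤ A + + n
  x-in = in-window {A} {n} (win-low x≤b) (win-high x≤b)
  total : sumFrom A n term ≡ c - c′ - 1ℤ
  total = trans (sum-- A n (λ z → ι (χ z) * 1ℤ - ι (χ′ z) * 1ℤ) _) (cong₂ _-_
    (trans (sum-- A n (λ z → ι (χ z) * 1ℤ) _) (trans (cong₂ _-_ (count m A n (win-low m≤b) (win-high m≤b))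
        (count m′ A n (win-low m′≤b) (win-high m′≤b))) (lem′ c c′ A)))
    (sum-δ A n x one (proj₁ x-in) (proj₂ x-in)))
  term≥0 : ∀ z → χ′ z ∧ not (χ z) ≡ false → 0ℤ ≤ term z
  term≥0 z r with z ≟ x
  ... | yes refl rewrite p | q = 0≤+
  ... | no _ with χ z | χ′ z
  ...   | true | true = 0≤+
  ...   | true | false = 0≤+
  ...   | false | false = 0≤+
  split : ∀ c d → c ∧ not d ≡ true → c ≡ true × d ≡ false
  split true false _ = refl , refl
  conclude : (∃ λ y → χ′ y ∧ not (χ y) ≡ true) ⊎ (∀ z → A ≤ z → z + 1ℤ ≤ A + + n → χ′ z ∧ not (χ z) ≡ false) →
    ∃ λ y → χ′ y ≡ true × χ y ≡ false
  conclude (inj₁ (y , h)) = y , split (χ′ y) (χ y) h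
  conclude (inj₂ h) = ⊥-elim (<-absurd {c′} (≤-by (subst (0ℤ ≤_) total
    (sum-nonneg A n term λ z r s → term≥0 z (h z r s))) (lem c c′)) c≤c′)

Adm : ℤ → ℤ → (ℤ → Bool) → (ℤ → Bool) → Set
Adm s a X Y = (∀ z → X z ≡ true → Y (z - a) ≡ true) × (∀ z → Y z ≡ true → X (z + a - s) ≡ true)

-- Exchanging a bead x of λ with a bead y of μ, up to a shift by m ∈ s ℤ, preserves the content.
no-exchange : ∀ {k a λ′ μ x y} j → let m = j * + suc k in IsCore (suc k) (0ℤ , a) (λ′ , μ) →
  bead λ′ x ≡ true → bead μ (x + m - a) ≡ false → bead μ y ≡ true → bead λ′ (y + a - m) ≡ false → ⊥
no-exchange {k} {a} {λ′} {μ} {x} {y} j ((ipλ , ipμ) , core) p q r s =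
  true≢false p (trans (sym (cong (λ ls → bead ls x) (cong proj₁ same)))
      (trans (hλ x) (move-x {bead λ′} {x} {y + a - m} p s)))
  where
  m : ℤ
  m = j * + suc k
  newλ : ∃ λ ls → IsPartition ls × (∀ z → bead ls z ≡ move (bead λ′) x (y + a - m) z)
  newλ = realise (Maya-move p s (bead-Maya ipλ))
  newμ : ∃ λ ls → IsPartition ls × (∀ z → bead ls z ≡ move (bead μ) y (x + m - a) z)
  newμ = realise (Maya-move r q (bead-Maya ipμ))
  β′ : Bipartition
  β′ = proj₁ newλ , proj₁ newμ
  hλ : ∀ z → bead (proj₁ newλ) z ≡ move (bead λ′) x (y + a - m) z
  hλ = proj₂ (proj₂ newλ)
  -- In content coordinates the bead given to `λ′` is the old bead of `μ` lowered by `m`, and the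
  -- bead given to `μ` is the old bead of `λ′` raised by `m`. As `φ` gains `c₀` over each `suc k`,
  -- the two corrections `j * c₀` cancel.
  sums : ∀ φ → Periodic (+ suc k) (Δ φ) → beadSum a φ β′ ≡ beadSum a φ (λ′ , μ)
  sums φ per = trans (cong₂ _+_ (rowSum-move (λ z → φ (z + 1ℤ)) ipλ (proj₁ (proj₂ newλ)) p s hλ)
      (rowSum-move (λ z → φ (z + 1ℤ + a)) ipμ (proj₁ (proj₂ newμ)) r q (proj₂ (proj₂ newμ))))
    (cancel (rowSum λ′ (λ z → φ (z + 1ℤ))) (rowSum μ (λ z → φ (z + 1ℤ + a)))
      (φ (y + a - m + 1ℤ)) (φ (x + 1ℤ)) (φ (x + m - a + 1ℤ + a)) (φ (y + 1ℤ + a)) (j * c₀)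
      (trans (cong φ (lem₁ y a m)) (quasi-* {f = φ} quasi j (y + a - m + 1ℤ)))
      (trans (cong φ (lem₂ x a m)) (quasi-* {f = φ} quasi j (x + 1ℤ))))
    where
    c₀ : ℤ
    c₀ = φ (+ suc k) - φ 0ℤ
    quasi : Quasi (+ suc k) c₀ φ
    quasi = Δ-periodic⇒quasi {f = φ} per
    lem₁ : ∀ y a m → y + 1ℤ + a ≡ y + a - m + 1ℤ + m
    lem₁ = solve-∀
    lem₂ : ∀ x a m → x + m - a + 1ℤ + a ≡ x + 1ℤ + m
    lem₂ = solve-∀
    cancel : ∀ r₁ r₂ u v w t c → t ≡ u + c → w ≡ v + c → r₁ + (u - v) + (r₂ + (w - t)) ≡ r₁ + r₂
    cancel r₁ r₂ u v _ _ c refl refl = lem r₁ r₂ u v c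
      where
      lem : ∀ r₁ r₂ u v c → r₁ + (u - v) + (r₂ + (v + c - (u + c))) ≡ r₁ + r₂
      lem = solve-∀
  same : β′ ≡ (λ′ , μ)
  same = core β′ (proj₁ (proj₂ newλ) , proj₁ (proj₂ newμ)) (beadSum⇒content {k} {a} {β′} {λ′ , μ} sums)

-- The β-set of `λ′`, that of `μ` moved by `a`, and that of `λ′` moved by `s` have charges 0, `a`
-- and `s`. The bounds on `a` order these charges, so `exchange` turns a failing inclusion into a
-- pair of beads to swap: with `j = 0` for the first inclusion and `j = 1` for the second.
IsCore⇒Adm : ∀ {k a λ′ μ} → 0ℤ ≤ a → a ≤ + suc k → IsCore (suc k) (0ℤ , a) (λ′ , μ) → Adm (+ suc k) a (bead λ′) (bead μ)
IsCore⇒Adm {k} {a} {λ′} {μ} 0≤a a≤s core@((ipλ , ipμ) , _) = first , second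
  where
  s : ℤ
  s = + suc k
  lem₀ : ∀ x s → x + 0ℤ * s ≡ x
  lem₀ = solve-∀
  lem₀′ : ∀ y a s → y - a + a - 0ℤ * s ≡ y
  lem₀′ = solve-∀
  lem₁ : ∀ y s a → y - s + 1ℤ * s - a ≡ y - a
  lem₁ = solve-∀
  lem₂ : ∀ y s a → y + a - 1ℤ * s ≡ y + a - s
  lem₂ = solve-∀
  lem₃ : ∀ y a → y + a - a ≡ y
  lem₃ = solve-∀
  shiftY : Maya (λ z → bead μ (z - a)) a
  shiftY = subst (Maya _) (+-identityˡ a) (Maya-shift a (bead-Maya ipμ))
  shiftX : Maya (λ z → bead λ′ (z - s)) s
  shiftX = subst (Maya _) (+-identityˡ s) (Maya-shift s (bead-Maya ipλ))
  first : ∀ x → bead λ′ x ≡ true → bead μ (x - a) ≡ true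
  first x p with bead μ (x - a) in eq
  ... | true = refl
  ... | false = let y , p′ , q′ = exchange {bead λ′} {λ z → bead μ (z - a)} (bead-Maya ipλ) shiftY 0≤a p eq in
    ⊥-elim (no-exchange {x = x} {y - a} 0ℤ core p (trans (cong (λ w → bead μ (w - a)) (lem₀ x s)) eq) p′
      (trans (cong (bead λ′) (lem₀′ y a s)) q′))
  second : ∀ y → bead μ y ≡ true → bead λ′ (y + a - s) ≡ true
  second y p with bead λ′ (y + a - s) in eq
  ... | true = refl
  ... | false = let z , p′ , q′ = exchange {λ z → bead μ (z - a)} {λ z → bead λ′ (z - s)} {x = y + a} shiftY shiftX a≤s
                                     (trans (cong (bead μ) (lem₃ y a)) p) eq in
    ⊥-elim (no-exchange {x = z - s} {y} 1ℤ core p′ (trans (cong (bead μ) (lem₁ z s a)) q′) p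
      (trans (cong (bead λ′) (lem₂ y s a)) eq))

-- Nested β-sets in terms of heights

quasi-shift : ∀ {g c f} b → Quasi g c f → Quasi g c (λ z → f (z + b))
quasi-shift {g} {c} {f} b q z = trans (cong f (lem z g b)) (q (z + b))
  where
  lem : ∀ z g b → z + g + b ≡ z + b + g
  lem = solve-∀

desc-- : ∀ {g f} → Quasi g (- 1ℤ) f → ∀ m z → f (z - m * g) ≡ f z + m
desc-- {g} {f} q m z = trans (cong f (lem z m g)) (trans (desc-* {g} {f} q (- m) z)
    (cong (_+_ (f z)) (neg-involutive m)))
  where
  lem : ∀ z m g → z - m * g ≡ z + - m * g
  lem = solve-∀

height-≥0 : ∀ {g χ π} → IsHeight g χ π → ∀ {z} → χ z ≡ true → 0ℤ ≤ π z
height-≥0 (_ , h) {z} p = true-nonneg (trans (sym (h z)) p)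

height-<0 : ∀ {g χ π} → IsHeight g χ π → ∀ {z} → χ z ≡ false → π z + 1ℤ ≤ 0ℤ
height-<0 (_ , h) {z} p = false-nonneg (trans (sym (h z)) p)

≥0-height : ∀ {g χ π} → IsHeight g χ π → ∀ {z} → 0ℤ ≤ π z → χ z ≡ true
≥0-height (_ , h) {z} p = trans (h z) (nonneg-true p)

-- Each inclusion is fed to `desc-dominates`; lowering the argument by `s = m * g` raises a height
-- by `m`. The modulus is left free because it is taken to be `s` itself (`m = 1`) in the core
-- criterion and `gcd s t` in the count.
Adm⇒heights : ∀ {g s m a X Y π κ} → s ≡ m * + g → IsHeight g X π → IsHeight g Y κ → Adm s a X Y →
  ∀ z → π z ≤ κ (z - a) × κ (z - a) ≤ π z + m
Adm⇒heights {g} {s} {m} {a} {X} {Y} {π} {κ} refl hX@(qπ , _) hY@(qκ , _) (X⇒Y , Y⇒X) z =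
  desc-dominates {f = π} {h = λ z → κ (z - a)} qπ (quasi-shift {f = κ} (- a) qκ) imp₁ z ,
  desc-dominates {f = λ z → κ (z - a)} {h = λ z → π z + m} (quasi-shift {f = κ} (- a) qκ) qπ+m imp₂ z
  where
  qπ+m : Quasi (+ g) (- 1ℤ) (λ z → π z + m)
  qπ+m z = trans (cong (_+ m) (qπ z)) (lem (π z) m)
    where
    lem : ∀ x m → x + - 1ℤ + m ≡ x + m + - 1ℤ
    lem = solve-∀
  imp₁ : ∀ z → nonneg (π z) ≡ true → nonneg (κ (z - a)) ≡ true
  imp₁ z p = nonneg-true (height-≥0 {π = κ} hY (X⇒Y z (≥0-height {π = π} hX (true-nonneg p))))
  imp₂ : ∀ z → nonneg (κ (z - a)) ≡ true → nonneg (π z + m) ≡ true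
  imp₂ z p = nonneg-true (subst (0ℤ ≤_) (trans (cong π (lem z a (m * + g))) (desc-- {f = π} qπ m z))
    (height-≥0 {π = π} hX (Y⇒X (z - a) (≥0-height {π = κ} hY (true-nonneg p)))))
    where
    lem : ∀ z a s → z - a + a - s ≡ z - s
    lem = solve-∀

heights⇒Adm : ∀ {g s m a X Y π κ} → s ≡ m * + g → IsHeight g X π → IsHeight g Y κ →
  (∀ z → π z ≤ κ (z - a) × κ (z - a) ≤ π z + m) → Adm s a X Y
heights⇒Adm {g} {s} {m} {a} {X} {Y} {π} {κ} refl hX@(qπ , _) hY h =
  (λ z p → ≥0-height {π = κ} hY (≤-trans (height-≥0 {π = π} hX p) (proj₁ (h z)))) ,
  (λ z p → ≥0-height {π = π} hX (≤-trans (height-≥0 {π = κ} hY p)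
    (≤-trans (≤-reflexive (cong κ (lem z a))) (≤-trans (proj₂ (h (z + a)))
        (≤-reflexive (sym (desc-- {f = π} qπ m (z + a))))))))
  where
  lem : ∀ z a → z ≡ z + a - a
  lem = solve-∀

-- Composing the two inclusions puts each set inside its own translate by `s`. Hence `s`-heights
-- exist for both, and both components of a core are `s`-cores.
Adm⇒Closed : ∀ {s a X Y} → Adm (+ s) a X Y → Closed s X × Closed s Y
Adm⇒Closed {s} {a} {X} {Y} (X⇒Y , Y⇒X) =
  (λ z p → trans (cong X (lem₁ z a (+ s))) (Y⇒X (z - a) (X⇒Y z p))) ,
  (λ z p → trans (cong Y (lem₂ z a (+ s))) (X⇒Y (z + a - + s) (Y⇒X z p)))
  where
  lem₁ : ∀ z a s → z - s ≡ z - a + a - s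
  lem₁ = solve-∀
  lem₂ : ∀ z a s → z - s ≡ z + a - s - a
  lem₂ = solve-∀

-- Nested β-sets give cores

rowSum-+ : ∀ ls f h → rowSum ls (λ z → f z + h z) ≡ rowSum ls f + rowSum ls h
rowSum-+ []       f h = refl
rowSum-+ (l ∷ ls) f h rewrite rowSum-+ ls (λ z → f (z - 1ℤ)) (λ z → h (z - 1ℤ)) =
  lem (f (+ l - 1ℤ)) (f (- 1ℤ)) (h (+ l - 1ℤ)) (h (- 1ℤ)) (rowSum ls (λ z → f (z - 1ℤ))) (rowSum ls (λ z → h (z - 1ℤ)))
  where
  lem : ∀ a b c d r s → a + c - (b + d) + (r + s) ≡ a - b + r + (c - d + s)
  lem = solve-∀

-- Among sets with the same weighted sum relative to the vacuum, χ can only be replaced by a subset.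
Separates : (ℤ → Bool) → (ℤ → ℤ) → Set
Separates χ w = (∀ {z} → χ z ≡ true → 0ℤ ≤ w z) × (∀ {z} → χ z ≡ false → w z + 1ℤ ≤ 0ℤ)

separates-term : ∀ {χ w} → Separates χ w → ∀ (χ′ : ℤ → Bool) z → 0ℤ ≤ ι (χ z) * w z - ι (χ′ z) * w z
separates-term {χ} {w} (h₁ , h₂) χ′ z with χ z in eq | χ′ z
... | true  | true  = ≤-reflexive (sym (+-inverseʳ (1ℤ * w z)))
... | true  | false = subst (0ℤ ≤_) (lem (w z)) (h₁ eq)
  where
  lem : ∀ w → w ≡ 1ℤ * w - 0ℤ * w
  lem = solve-∀
... | false | true  = subst (0ℤ ≤_) (lem (w z)) (gap (h₂ eq) ⊕ 0≤+ {1})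
  where
  lem : ∀ w → 0ℤ - (w + 1ℤ) + 1ℤ ≡ 0ℤ * w - 1ℤ * w
  lem = solve-∀
... | false | false = ≤-refl

-- The weight may vanish on `χ` but not off it. A zero term therefore excludes an added bead, though
-- not a removed one.
separates-zero : ∀ {χ w} → Separates χ w → ∀ (χ′ : ℤ → Bool) z → ι (χ z) * w z - ι (χ′ z) * w z ≡ 0ℤ → χ z ≡ false →
    χ′ z ≡ false
separates-zero {χ} {w} (h₁ , h₂) χ′ z eq p rewrite p with χ′ z
... | false = refl
... | true  = ⊥-elim (<-absurd {w z} (h₂ p) (≤-reflexive (trans (sym eq′) (lem (w z)))))
  where
  lem : ∀ w → - (0ℤ * w - 1ℤ * w) ≡ w
  lem = solve-∀
  eq′ : - (0ℤ * w z - 1ℤ * w z) ≡ 0ℤ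
  eq′ = cong -_ eq

-- The difference of the two weights is a sum of the terms `T + U` over a window. All are
-- nonnegative by separation and their total is 0, so each vanishes. The radius `b` contains
-- `suc ∣ z ∣` in order that the given `z` lies in the window.
separated-⊆ : ∀ {λ₁ μ₁ λ₂ μ₂ w v} → IsPartition λ₁ → IsPartition μ₁ → IsPartition λ₂ → IsPartition μ₂ →
  Separates (bead λ₁) w → Separates (bead μ₁) v → rowSum λ₁ w + rowSum μ₁ v ≡ rowSum λ₂ w + rowSum μ₂ v →
  ∀ z → (bead λ₁ z ≡ false → bead λ₂ z ≡ false) × (bead μ₁ z ≡ false → bead μ₂ z ≡ false)
separated-⊆ {λ₁} {μ₁} {λ₂} {μ₂} {w} {v} i₁ j₁ i₂ j₂ sw sv eq z =
  separates-zero sw (bead λ₂) z (+≡0⇒≡0ˡ (T≥0 z) (U≥0 z) zero-term) ,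
  separates-zero sv (bead μ₂) z (+≡0⇒≡0ˡ (U≥0 z) (T≥0 z) (trans (+-comm (U z) (T z)) zero-term))
  where
  a₁ a₂ a₃ a₄ b n : ℕ
  a₁ = size-bound λ₁
  a₂ = size-bound μ₁
  a₃ = size-bound λ₂
  a₄ = size-bound μ₂
  b = ((a₁ ℕ.+ a₂) ℕ.+ (a₃ ℕ.+ a₄)) ℕ.+ suc ∣ z ∣
  n = b ℕ.+ b
  A : ℤ
  A = - + b
  T U : ℤ → ℤ
  T z = ι (bead λ₁ z) * w z - ι (bead λ₂ z) * w z
  U z = ι (bead μ₁ z) * v z - ι (bead μ₂ z) * v z
  T≥0 : ∀ z → 0ℤ ≤ T z
  T≥0 = separates-term sw (bead λ₂)
  U≥0 : ∀ z → 0ℤ ≤ U z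
  U≥0 = separates-term sv (bead μ₂)
  a₁≤b : a₁ ℕ.≤ b
  a₁≤b = ℕ.≤-trans (ℕ.≤-trans (ℕ.m≤m+n a₁ a₂) (ℕ.m≤m+n _ _)) (ℕ.m≤m+n _ _)
  a₂≤b : a₂ ℕ.≤ b
  a₂≤b = ℕ.≤-trans (ℕ.≤-trans (ℕ.m≤n+m a₂ a₁) (ℕ.m≤m+n _ _)) (ℕ.m≤m+n _ _)
  a₃≤b : a₃ ℕ.≤ b
  a₃≤b = ℕ.≤-trans (ℕ.≤-trans (ℕ.m≤m+n a₃ a₄) (ℕ.m≤n+m _ (a₁ ℕ.+ a₂))) (ℕ.m≤m+n _ _)
  a₄≤b : a₄ ℕ.≤ b
  a₄≤b = ℕ.≤-trans (ℕ.≤-trans (ℕ.m≤n+m a₄ a₃) (ℕ.m≤n+m _ (a₁ ℕ.+ a₂))) (ℕ.m≤m+n _ _)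
  z≤b : suc ∣ z ∣ ℕ.≤ b
  z≤b = ℕ.m≤n+m _ ((a₁ ℕ.+ a₂) ℕ.+ (a₃ ℕ.+ a₄))
  diff : ∀ {ls ms} f → IsPartition ls → IsPartition ms → size-bound ls ℕ.≤ b → size-bound ms ℕ.≤ b →
    sumFrom A n (λ z → ι (bead ls z) * f z - ι (bead ms z) * f z) ≡ rowSum ls f - rowSum ms f
  diff {ls} {ms} f i j p q = trans (sum-- A n (λ z → ι (bead ls z) * f z) _)
    (trans (lem (sumOver A n (bead ls) f) (sumOver A n (bead ms) f) (sumOver A n (bead []) f))
    (sym (cong₂ _-_ (rowSum-sumOver ls b f i p) (rowSum-sumOver ms b f j q))))
    where
    lem : ∀ x y e → x - y ≡ x - e - (y - e)
    lem = solve-∀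
  total : sumFrom A n (λ z → T z + U z) ≡ 0ℤ
  total = trans (sum-+ A n T U) (trans (cong₂ _+_ (diff w i₁ i₂ a₁≤b a₃≤b) (diff v j₁ j₂ a₂≤b a₄≤b))
    (trans (lem (rowSum λ₁ w) (rowSum λ₂ w) (rowSum μ₁ v) (rowSum μ₂ v))
        (trans (cong (_- (rowSum λ₂ w + rowSum μ₂ v)) eq)
    (+-inverseʳ (rowSum λ₂ w + rowSum μ₂ v)))))
    where
    lem : ∀ x x′ y y′ → x - x′ + (y - y′) ≡ x + y - (x′ + y′)
    lem = solve-∀
  z-in : A ≤ z × z + 1ℤ ≤ A + + n
  z-in = in-window {A} {n} (win-low z≤b) (win-high z≤b)
  zero-term : T z + U z ≡ 0ℤ
  zero-term = sum≡0⇒≡0 A n (λ z → T z + U z) (λ z → T≥0 z ⊕ U≥0 z) total z (proj₁ z-in) (proj₂ z-in)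

-- With equal charges a missing bead would, by `exchange`, force an added one.
Maya-⊇⇒≡ : ∀ {χ χ′ c} → Maya χ c → Maya χ′ c → (∀ z → χ z ≡ false → χ′ z ≡ false) → ∀ z → χ′ z ≡ χ z
Maya-⊇⇒≡ {χ} {χ′} m m′ h z with χ z in p | χ′ z in q
... | true  | true  = refl
... | false | false = refl
... | false | true  = ⊥-elim (true≢false q (h z p))
... | true  | false = let y , r , s = exchange m m′ ≤-refl p q in ⊥-elim (true≢false r (h y s))

Adm⇒IsCore : ∀ {k a λ′ μ} → IsBipartition (λ′ , μ) → Adm (+ suc k) a (bead λ′) (bead μ) → IsCore (suc k) (0ℤ , a)
    (λ′ , μ)
Adm⇒IsCore {k} {a} {λ′} {μ} (ipλ , ipμ) adm = (ipλ , ipμ) , unique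
  where
  s : ℤ
  s = + suc k
  HX : ∃ λ π → IsHeight (suc k) (bead λ′) π
  HX = height-exists (bead-Maya ipλ) (proj₁ (Adm⇒Closed {suc k} {a} adm))
  HY : ∃ λ κ → IsHeight (suc k) (bead μ) κ
  HY = height-exists (bead-Maya ipμ) (proj₂ (Adm⇒Closed {suc k} {a} adm))
  unique-heights : ∀ π κ → IsHeight (suc k) (bead λ′) π → IsHeight (suc k) (bead μ) κ →
    ∀ β′ → IsBipartition β′ → SameContent (suc k) (0ℤ , a) β′ (λ′ , μ) → β′ ≡ (λ′ , μ)
  unique-heights π κ hX hY (λ″ , μ″) (ipλ″ , ipμ″) sc = cong₂ _,_
    (bead-injective ipλ″ ipλ (Maya-⊇⇒≡ (bead-Maya ipλ) (bead-Maya ipλ″) λ z → proj₁ (subs z)))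
    (bead-injective ipμ″ ipμ (Maya-⊇⇒≡ (bead-Maya ipμ) (bead-Maya ipμ″) λ z → proj₂ (subs z)))
    where
    h : ∀ z → π z ≤ κ (z - a) × κ (z - a) ≤ π z + 1ℤ
    h = Adm⇒heights {suc k} {s} {1ℤ} {a} {π = π} {κ} (sym (*-identityˡ s)) hX hY adm
    κ-at : ∀ z → κ (z + a - a) ≡ κ z
    κ-at z = cong κ (lem z a)
      where
      lem : ∀ z a → z + a - a ≡ z
      lem = solve-∀
    -- By `h`, `κ (z - a)` lies between `π z` and `π z + 1`, so `w` is at least 0 on the beads of
    -- `λ′` and at most -1 off them. On a bead of `μ` one has only `π (z + a) ≥ κ z - 1 ≥ - 1`, and
    -- off `μ` both heights are at most -1. The `+ 1ℤ` in `v` corrects this, and it does not affect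
    -- bead sums since `rowSum` annihilates constants. `φ` undoes the `z + 1ℤ` of `beadSum`.
    w v φ : ℤ → ℤ
    w z = π z + κ (z - a)
    v z = w (z + a) + 1ℤ
    φ z = w (z - 1ℤ)
    w-quasi : Quasi s (- 1ℤ + - 1ℤ) w
    w-quasi z = trans (cong₂ _+_ (proj₁ hX z) (quasi-shift {f = κ} (- a) (proj₁ hY) z)) (lem (π z) (κ (z - a)))
      where
      lem : ∀ x y → x + - 1ℤ + (y + - 1ℤ) ≡ x + y + (- 1ℤ + - 1ℤ)
      lem = solve-∀
    φ-periodic : Periodic s (Δ φ)
    φ-periodic z = trans (cong₂ _-_ (trans (cong w (lem₀ z s)) (w-quasi (z + 1ℤ - 1ℤ)))
        (trans (cong w (lem₁ z s)) (w-quasi (z - 1ℤ))))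
      (lem₂ (w (z + 1ℤ - 1ℤ)) (w (z - 1ℤ)))
      where
      lem₀ : ∀ z s → z + s + 1ℤ - 1ℤ ≡ z + 1ℤ - 1ℤ + s
      lem₀ = solve-∀
      lem₁ : ∀ z s → z + s - 1ℤ ≡ z - 1ℤ + s
      lem₁ = solve-∀
      lem₂ : ∀ x y → x + (- 1ℤ + - 1ℤ) - (y + (- 1ℤ + - 1ℤ)) ≡ x - y + 0ℤ
      lem₂ = solve-∀
    beadSum≡ : ∀ ls ms → beadSum a φ (ls , ms) ≡ rowSum ls w + rowSum ms v
    beadSum≡ ls ms = cong₂ _+_ (rowSum-cong (λ z → cong w (x+1-1 z)) ls)
      (trans (rowSum-cong (λ z → cong w (lem z a)) ms)
      (sym (trans (rowSum-+ ms (λ z → w (z + a)) one) (trans (cong (_+_ (rowSum ms (λ z → w (z + a)))) (rowSum-one ms))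
          (+-identityʳ _)))))
      where
      lem : ∀ z a → z + 1ℤ + a - 1ℤ ≡ z + a
      lem = solve-∀
    sep-w : Separates (bead λ′) w
    sep-w = (λ {z} p → let q = height-≥0 {π = π} hX p in q ⊕ ≤-trans q (proj₁ (h z))) ,
      (λ {z} p → let q = height-<0 {π = π} hX p in ≤-by (gap q ⊕ gap q ⊕ gap (proj₂ (h z))) (lem (π z) (κ (z - a))))
      where
      lem : ∀ x y → 0ℤ - (x + y + 1ℤ) ≡ 0ℤ - (x + 1ℤ) + (0ℤ - (x + 1ℤ)) + (x + 1ℤ - y)
      lem = solve-∀
    sep-v : Separates (bead μ) v
    sep-v = (λ {z} p → let q = height-≥0 {π = κ} hY p in
        ≤-by (q ⊕ q ⊕ gap (proj₂ (h (z + a)))) (trans (cong (λ y → π (z + a) + y + 1ℤ - 0ℤ) (κ-at z))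
          (trans (lem₁ (π (z + a)) (κ z)) (cong (λ y → κ z + κ z + (π (z + a) + 1ℤ - y)) (sym (κ-at z)))))) ,
      (λ {z} p → let q = height-<0 {π = κ} hY p in
        ≤-by (gap q ⊕ gap q ⊕ gap (proj₁ (h (z + a)))) (trans (cong (λ y → 0ℤ - (π (z + a) + y + 1ℤ + 1ℤ)) (κ-at z))
          (trans (lem₂ (π (z + a)) (κ z)) (cong (λ y → 0ℤ - (κ z + 1ℤ) + (0ℤ - (κ z + 1ℤ)) + (y - π (z + a)))
              (sym (κ-at z))))))
      where
      lem₁ : ∀ x y → x + y + 1ℤ - 0ℤ ≡ y + y + (x + 1ℤ - y)
      lem₁ = solve-∀
      lem₂ : ∀ x y → 0ℤ - (x + y + 1ℤ + 1ℤ) ≡ 0ℤ - (y + 1ℤ) + (0ℤ - (y + 1ℤ)) + (y - x)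
      lem₂ = solve-∀
    subs : ∀ z → (bead λ′ z ≡ false → bead λ″ z ≡ false) × (bead μ z ≡ false → bead μ″ z ≡ false)
    subs = separated-⊆ ipλ ipμ ipλ″ ipμ″ sep-w sep-v (trans (sym (beadSum≡ λ′ μ))
      (trans (sym (content⇒beadSum {k} {a} {λ″ , μ″} {λ′ , μ} sc φ φ-periodic)) (beadSum≡ λ″ μ″)))
  unique : ∀ β′ → IsBipartition β′ → SameContent (suc k) (0ℤ , a) β′ (λ′ , μ) → β′ ≡ (λ′ , μ)
  unique = unique-heights (proj₁ HX) (proj₁ HY) (proj₂ HX) (proj₂ HY)

-- Solving for the heights

-- A Bézout inverse of `d` modulo `g`. The coefficient `e` is a natural number because it becomes
-- the number of terms of an `orbitSum`.
Inverse : ℤ → ℤ → Set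
Inverse d g = ∃ λ (e : ℕ) → ∃ λ f → + e * d ≡ 1ℤ + f * g

coprime-inverse : ∀ {k d} → Coprime (suc k) ∣ d ∣ → Inverse d (+ suc k)
coprime-inverse {k} {d} cop = let e , f , eq = signed d (unsigned (coprime-Bézout cop)) in make-nonneg e f eq
  where
  g : ℤ
  g = + suc k
  cast : ∀ x m y n → 1 ℕ.+ x ℕ.* m ≡ y ℕ.* n → 1ℤ + + x * + m ≡ + y * + n
  cast x m y n eq = trans (cong (_+_ 1ℤ) (sym (pos-* x m))) (trans (cong +_ eq) (pos-* y n))
  unsigned : Bézout.Identity 1 (suc k) ∣ d ∣ → ∃ λ e → ∃ λ f → e * + ∣ d ∣ ≡ 1ℤ + f * g
  unsigned (Bézout.-+ x y eq) = + y , + x , sym (cast x (suc k) y ∣ d ∣ eq)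
  unsigned (Bézout.+- x y eq) = - + y , - + x , trans (lem (+ y) (+ ∣ d ∣))
      (trans (cong (_-_ 1ℤ) (cast y ∣ d ∣ x (suc k) eq)) (lem′ (+ x) g))
    where
    lem : ∀ y d → - y * d ≡ 1ℤ - (1ℤ + y * d)
    lem = solve-∀
    lem′ : ∀ x g → 1ℤ - x * g ≡ 1ℤ + - x * g
    lem′ = solve-∀
  signed : ∀ d → (∃ λ e → ∃ λ f → e * + ∣ d ∣ ≡ 1ℤ + f * g) → ∃ λ e → ∃ λ f → e * d ≡ 1ℤ + f * g
  signed (+ n)    r = r
  signed -[1+ n ] (e , f , eq) = - e , f , trans (lem e (+ suc n)) eq
    where
    lem : ∀ e d → - e * - d ≡ e * d
    lem = solve-∀
  make-nonneg : ∀ e f → e * d ≡ 1ℤ + f * g → Inverse d g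
  make-nonneg e f eq = ∣ e + + ∣ e ∣ * g ∣ , f + + ∣ e ∣ * d ,
    trans (cong (_* d) (0≤i⇒+∣i∣≡i {e + + ∣ e ∣ * g} (≤-by (gap (-i≤+∣i∣ e) ⊕ 0≤-* {+ ∣ e ∣} {+ k} 0≤+ 0≤+)
        (lem₁ e (+ ∣ e ∣) (+ k)))))
      (trans (lem₂ e (+ ∣ e ∣) d g) (trans (cong (λ x → x + + ∣ e ∣ * d * g) eq) (lem₃ f (+ ∣ e ∣) d g)))
    where
    lem₁ : ∀ e n k → e + n * (1ℤ + k) - 0ℤ ≡ n - - e + n * k
    lem₁ = solve-∀
    lem₂ : ∀ e n d g → (e + n * g) * d ≡ e * d + n * d * g
    lem₂ = solve-∀
    lem₃ : ∀ f n d g → 1ℤ + f * g + n * d * g ≡ 1ℤ + (f + n * d) * g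
    lem₃ = solve-∀

sum-Δ : ∀ A n f → sumFrom A n (Δ f) ≡ f (A + + n) - f A
sum-Δ A zero f = sym (trans (cong (λ w → f w - f A) (+-identityʳ A)) (+-inverseʳ (f A)))
sum-Δ A (suc n) f = trans (cong (_+_ (Δ f A)) (sum-Δ (A + 1ℤ) n f))
  (trans (lem (f (A + 1ℤ)) (f A) (f (A + 1ℤ + + n))) (cong (λ w → f w - f A) (+-assoc A 1ℤ (+ n))))
  where
  lem : ∀ a b c → a - b + (c - a) ≡ c - b
  lem = solve-∀

coprime-periods : ∀ {d g f} → Inverse d g → Periodic g f → Periodic d f → ∀ z → f z ≡ f 0ℤ
coprime-periods {d} {g} {f} (e , h , eq) pg pd = periodic-1 λ z →
  trans (sym (periodic-* {g} {f} pg h (z + 1ℤ))) (trans (cong f (trans (+-assoc z 1ℤ (h * g)) (cong (_+_ z) (sym eq))))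
      (periodic-* {d} {f} pd (+ e) z))

orbitSum : ℤ → (ℤ → ℤ) → ℕ → ℤ → ℤ
orbitSum d δ′ zero    z = 0ℤ
orbitSum d δ′ (suc e) z = δ′ z + orbitSum d δ′ e (z + d)

orbitSum-shift : ∀ d δ′ e z → orbitSum d δ′ e (z + d) ≡ orbitSum d δ′ e z + (δ′ (z + + e * d) - δ′ z)
orbitSum-shift d δ′ zero z = trans (lem (δ′ z)) (cong (λ w → 0ℤ + (δ′ w - δ′ z)) (sym (+-identityʳ z)))
  where
  lem : ∀ x → 0ℤ ≡ 0ℤ + (x - x)
  lem = solve-∀
orbitSum-shift d δ′ (suc e) z = trans (cong (_+_ (δ′ (z + d))) (orbitSum-shift d δ′ e (z + d)))
  (trans (cong (λ w → δ′ (z + d) + (orbitSum d δ′ e (z + d) + (δ′ w - δ′ (z + d)))) (lem₁ z d (+ e)))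
  (lem₂ (δ′ (z + d)) (orbitSum d δ′ e (z + d)) (δ′ (z + + suc e * d)) (δ′ z)))
  where
  lem₁ : ∀ z d e → z + d + e * d ≡ z + (1ℤ + e) * d
  lem₁ = solve-∀
  lem₂ : ∀ a b c x → a + (b + (c - a)) ≡ x + b + (c - x)
  lem₂ = solve-∀

orbitSum-periodic : ∀ {g} d δ′ e → Periodic g δ′ → Periodic g (orbitSum d δ′ e)
orbitSum-periodic d δ′ zero p z = refl
orbitSum-periodic {g} d δ′ (suc e) p z = trans (cong₂ _+_ (p z)
    (trans (cong (orbitSum d δ′ e) (lem₁ z g d)) (orbitSum-periodic d δ′ e p (z + d))))
  (lem₂ (δ′ z) (orbitSum d δ′ e (z + d)))
  where
  lem₁ : ∀ z g d → z + g + d ≡ z + d + g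
  lem₁ = solve-∀
  lem₂ : ∀ a b → a + 0ℤ + (b + 0ℤ) ≡ a + b + 0ℤ
  lem₂ = solve-∀

sum-period-shift : ∀ {c} g f → Quasi (+ g) c f → ∀ d → sumFrom 0ℤ g (λ z → f (z + d)) ≡ sumFrom 0ℤ g f + d * c
sum-period-shift g f q d = trans (sum-shift 0ℤ g d f) (trans (cong (λ A → sumFrom A g f) (+-identityˡ d))
    (sum-period g f q d))

sum-orbitSum : ∀ g d δ′ e → Periodic (+ g) δ′ → sumFrom 0ℤ g (orbitSum d δ′ e) ≡ + e * sumFrom 0ℤ g δ′
sum-orbitSum g d δ′ zero p = sum-zero 0ℤ g _ λ _ _ _ → refl
sum-orbitSum g d δ′ (suc e) p = trans (sum-+ 0ℤ g δ′ _) (trans (cong (_+_ (sumFrom 0ℤ g δ′))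
  (trans (sum-period-shift g (orbitSum d δ′ e) (orbitSum-periodic d δ′ e p) d)
      (cong (_+ d * 0ℤ) (sum-orbitSum g d δ′ e p))))
  (lem (sumFrom 0ℤ g δ′) d (+ e)))
  where
  lem : ∀ s d e → s + (e * s + d * 0ℤ) ≡ (1ℤ + e) * s
  lem = solve-∀

*-zero-cancel : ∀ k {c} → + suc k * c ≡ 0ℤ → c ≡ 0ℤ
*-zero-cancel k {c} eq with i*j≡0⇒i≡0∨j≡0 (+ suc k) eq
... | inj₂ p = p

-- With e d ≡ 1 modulo g, a unit step is e steps of d up to a multiple of g, which
-- forces the differences of π to be ε below.
desc-with-differences : ∀ {k d δ′} → Inverse d (+ suc k) → Periodic (+ suc k) δ′ → sumFrom 0ℤ (suc k) δ′ ≡ - d →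
  ∃ λ π → Quasi (+ suc k) (- 1ℤ) π × (∀ z → π (z + d) ≡ π z + δ′ z)
desc-with-differences {k} {d} {δ′} (e , h , inv) per total = π , quasi , differences
  where
  g : ℤ
  g = + suc k
  ε π E : ℤ → ℤ
  ε z = h + orbitSum d δ′ e z
  π = Anti ε
  -- The defect of the desired identity. Its differences vanish by the choice of `ε`, so it is
  -- constant, and it sums to 0 over a period: a shift by `d` changes the period sum of `π` by
  -- `- d`, which is the sum of `δ′`.
  E z = π (z + d) - π z - δ′ z
  Δπ : ∀ z → π (z + 1ℤ) - π z ≡ ε z
  Δπ = Δ-Anti ε
  ε-periodic : Periodic g ε
  ε-periodic z = trans (cong (_+_ h) (orbitSum-periodic d δ′ e per z)) (sym (+-assoc h _ 0ℤ))
  Δπ-periodic : Periodic g (Δ π)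
  Δπ-periodic z = trans (Δπ (z + g)) (trans (ε-periodic z) (cong (_+ 0ℤ) (sym (Δπ z))))
  -- Here the summand `h` of `ε` is decisive: over a period `ε` sums to `g * h - e * d`, which is -1
  -- by the Bézout identity.
  increment : π g - π 0ℤ ≡ - 1ℤ
  increment = begin
    π g - π 0ℤ
      ≡⟨ cong (λ w → π w - π 0ℤ) (+-identityˡ g) ⟨
    π (0ℤ + g) - π 0ℤ
      ≡⟨ sum-Δ 0ℤ (suc k) π ⟨
    sumFrom 0ℤ (suc k) (Δ π)
      ≡⟨ sum-cong 0ℤ (suc k) Δπ ⟩
    sumFrom 0ℤ (suc k) ε
      ≡⟨ sum-+ 0ℤ (suc k) (λ _ → h) (orbitSum d δ′ e) ⟩
    sumFrom 0ℤ (suc k) (λ _ → h) + sumFrom 0ℤ (suc k) (orbitSum d δ′ e)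
      ≡⟨ cong₂ _+_ (sum-const 0ℤ (suc k) h) (trans (sum-orbitSum (suc k) d δ′ e per) (cong (_*_ (+ e)) total)) ⟩
    g * h + + e * - d
      ≡⟨ lem₁ g h (+ e) d ⟩
    h * g - + e * d
      ≡⟨ cong (_-_ (h * g)) inv ⟩
    h * g - (1ℤ + h * g)
      ≡⟨ lem₂ (h * g) ⟩
    - 1ℤ ∎
    where
    open ≡-Reasoning
    lem₁ : ∀ g h e d → g * h + e * - d ≡ h * g - e * d
    lem₁ = solve-∀
    lem₂ : ∀ x → x - (1ℤ + x) ≡ - 1ℤ
    lem₂ = solve-∀
  quasi : Quasi g (- 1ℤ) π
  quasi z = trans (Δ-periodic⇒quasi {f = π} Δπ-periodic z) (cong (_+_ (π z)) increment)
  E-step : ∀ z → E (z + 1ℤ) ≡ E z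
  E-step z = trans (cong (λ w → π w - π (z + 1ℤ) - δ′ (z + 1ℤ)) (lem₁ z d))
    (combine (π (z + d + 1ℤ)) (π (z + d)) (π (z + 1ℤ)) (π z) (orbitSum d δ′ e z) (δ′ z) (δ′ (z + 1ℤ))
      (trans (Δπ (z + d)) (cong (_+_ h) (trans (orbitSum-shift d δ′ e z)
          (cong (λ w → orbitSum d δ′ e z + (w - δ′ z)) δ-shift)))) (Δπ z))
    where
    lem₁ : ∀ z d → z + 1ℤ + d ≡ z + d + 1ℤ
    lem₁ = solve-∀
    δ-shift : δ′ (z + + e * d) ≡ δ′ (z + 1ℤ)
    δ-shift = trans (cong δ′ (trans (cong (_+_ z) inv) (sym (+-assoc z 1ℤ (h * g)))))
        (periodic-* {g} {δ′} per h (z + 1ℤ))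
    combine : ∀ p q r s o x y → p - q ≡ h + (o + (y - x)) → r - s ≡ h + o → p - r - y ≡ q - s - x
    combine p q r s o x y e₁ e₂ = trans (lem₂ p q r s y)
        (trans (cong₂ (λ m n → m - n + (q - s - y)) e₁ e₂) (lem₃ h o q s x y))
      where
      lem₂ : ∀ p q r s y → p - r - y ≡ p - q - (r - s) + (q - s - y)
      lem₂ = solve-∀
      lem₃ : ∀ h o q s x y → h + (o + (y - x)) - (h + o) + (q - s - y) ≡ q - s - x
      lem₃ = solve-∀
  E-sum : g * E 0ℤ ≡ 0ℤ
  E-sum = begin
    g * E 0ℤ
      ≡⟨ sum-const 0ℤ (suc k) (E 0ℤ) ⟨
    sumFrom 0ℤ (suc k) (λ _ → E 0ℤ)
      ≡⟨ sum-cong 0ℤ (suc k) (λ z → sym (periodic-1 {E} E-step z)) ⟩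
    sumFrom 0ℤ (suc k) E
      ≡⟨ trans (sum-- 0ℤ (suc k) (λ z → π (z + d) - π z) δ′)
          (cong (_- sumFrom 0ℤ (suc k) δ′) (sum-- 0ℤ (suc k) (λ z → π (z + d)) π)) ⟩
    sumFrom 0ℤ (suc k) (λ z → π (z + d)) - sumFrom 0ℤ (suc k) π - sumFrom 0ℤ (suc k) δ′
      ≡⟨ cong₂ (λ x y → x - sumFrom 0ℤ (suc k) π - y) (sum-period-shift (suc k) π quasi d) total ⟩
    sumFrom 0ℤ (suc k) π + d * - 1ℤ - sumFrom 0ℤ (suc k) π - - d
      ≡⟨ lem (sumFrom 0ℤ (suc k) π) d ⟩
    0ℤ ∎
    where
    open ≡-Reasoning
    lem : ∀ s d → s + d * - 1ℤ - s - - d ≡ 0ℤ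
    lem = solve-∀
  differences : ∀ z → π (z + d) ≡ π z + δ′ z
  differences z = trans (lem (π (z + d)) (π z) (δ′ z)) (trans (cong (λ w → π z + δ′ z + w)
    (trans (periodic-1 {E} E-step z) (*-zero-cancel k E-sum))) (+-identityʳ _))
    where
    lem : ∀ p q x → p ≡ q + x + (p - q - x)
    lem = solve-∀

-- Difference functions

residue : ∀ k → ℤ → Fin (suc k)
residue k z = fromℕ< (n%ℕd<d z (suc k))

periodise : ∀ {k} → Vec ℕ (suc k) → ℤ → ℤ
periodise {k} u z = + lookup u (residue k z)

residue-cong : ∀ {k y z} → y %ℕ suc k ≡ z %ℕ suc k → residue k y ≡ residue k z
residue-cong {k} {y} {z} eq = toℕ-injective (trans (toℕ-fromℕ< (n%ℕd<d y (suc k)))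
    (trans eq (sym (toℕ-fromℕ< (n%ℕd<d z (suc k))))))

residue-toℕ : ∀ {k} (j : Fin (suc k)) → residue k (+ toℕ j) ≡ j
residue-toℕ {k} j = toℕ-injective (trans (toℕ-fromℕ< (n%ℕd<d (+ toℕ j) (suc k))) (m<n⇒m%n≡m (toℕ<n j)))

periodise-periodic : ∀ {k} (u : Vec ℕ (suc k)) → Periodic (+ suc k) (periodise u)
periodise-periodic {k} u z = trans (cong (λ j → + lookup u j) (residue-cong {k} {z + + suc k} {z} (%ℕ-period z k)))
    (sym (+-identityʳ _))

sum-lookup : ∀ {n} (u : Vec ℕ n) A f → (∀ j → f (A + + toℕ j) ≡ + lookup u j) → sumFrom A n f ≡ + sum (toList u)
sum-lookup []      A f h = refl
sum-lookup (x ∷ u) A f h = cong₂ _+_ (trans (cong f (sym (+-identityʳ A))) (h zero))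
  (sum-lookup u (A + 1ℤ) f λ j → trans (cong f (+-assoc A 1ℤ (+ toℕ j))) (h (suc j)))

sum-periodise : ∀ {k} (u : Vec ℕ (suc k)) → sumFrom 0ℤ (suc k) (periodise u) ≡ + sum (toList u)
sum-periodise u = sum-lookup u 0ℤ (periodise u) λ j → cong (λ i → + lookup u i) (residue-toℕ j)

periodise-injective : ∀ {k} {u v : Vec ℕ (suc k)} → (∀ z → periodise u z ≡ periodise v z) → u ≡ v
periodise-injective {k} {u} {v} h = trans (sym (tabulate∘lookup u)) (trans (tabulate-cong λ j →
  trans (cong (lookup u) (sym (residue-toℕ j))) (trans (+-injective (h (+ toℕ j))) (cong (lookup v) (residue-toℕ j))))
      (tabulate∘lookup v))

restrict : ∀ k → (ℤ → ℤ) → Vec ℕ (suc k)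
restrict k f = tabulate λ j → ∣ f (+ toℕ j) ∣

periodise-restrict : ∀ {k f} → Periodic (+ suc k) f → (∀ z → 0ℤ ≤ f z) → ∀ z → periodise (restrict k f) z ≡ f z
periodise-restrict {k} {f} per f≥0 z = trans (cong +_ (lookup∘tabulate (λ j → ∣ f (+ toℕ j) ∣) (residue k z)))
  (trans (0≤i⇒+∣i∣≡i (f≥0 _)) (trans (cong (λ r → f (+ r)) (toℕ-fromℕ< (n%ℕd<d z (suc k))))
      (periodic-reduce {f = f} per z)))

All-lookup : ∀ {n} {P : ℕ → Set} (u : Vec ℕ n) → All P (toList u) → ∀ j → P (lookup u j)
All-lookup (x ∷ u) (p ∷ ps) zero    = p
All-lookup (x ∷ u) (p ∷ ps) (suc j) = All-lookup u ps j

lookup-All : ∀ {n} {P : ℕ → Set} (u : Vec ℕ n) → (∀ j → P (lookup u j)) → All P (toList u)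
lookup-All []      h = []
lookup-All (x ∷ u) h = h zero ∷ lookup-All u λ j → h (suc j)

InU⇒ : ∀ {k m a} {u : Vec ℕ (suc k)} → InU (suc k) (m ℕ.* suc k) a u →
  sumFrom 0ℤ (suc k) (periodise u) ≡ + a × (∀ z → 0ℤ ≤ periodise u z × periodise u z ≤ + m)
InU⇒ {k} {m} {u = u} (s , ps) = trans (sum-periodise u) (cong +_ s) ,
  λ z → 0≤+ , +≤+ (ℕ.≤-trans (All-lookup u ps (residue k z)) (ℕ.≤-reflexive (m*n/n≡m m (suc k))))

⇒InU : ∀ {k m a f} → Periodic (+ suc k) f → (∀ z → 0ℤ ≤ f z × f z ≤ + m) → sumFrom 0ℤ (suc k) f ≡ + a →
  InU (suc k) (m ℕ.* suc k) a (restrict k f)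
⇒InU {k} {m} {a} {f} per bd s = +-injective (trans (sym (sum-periodise (restrict k f)))
    (trans (sum-cong 0ℤ (suc k) (periodise-restrict {f = f} per λ z → proj₁ (bd z))) s)) ,
  lookup-All (restrict k f) λ j → ℕ.≤-trans (drop‿+≤+ (≤-trans (≤-reflexive
    (trans (cong (λ i → + lookup (restrict k f) i) (sym (residue-toℕ j)))
        (periodise-restrict {f = f} per (λ z → proj₁ (bd z)) (+ toℕ j))))
    (proj₂ (bd (+ toℕ j))))) (ℕ.≤-reflexive (sym (m*n/n≡m m (suc k))))

-- u and v are the two bead-difference functions of (λ , μ) after shifting both β-sets by i.
record Diff (k a b : ℕ) (u v : Vec ℕ (suc k)) (i : ℕ) (β : Bipartition) : Set where
  constructor diff
  field
    π κ : ℤ → ℤ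
    π-height : IsHeight (suc k) (bead (proj₁ β)) π
    κ-height : IsHeight (suc k) (bead (proj₂ β)) κ
    u-diff : ∀ z → κ (z - + a) ≡ π z + periodise u (z + + i)
    v-diff : ∀ z → κ (z - + b) ≡ π z + periodise v (z + + i)

AdmPair : (k m n a b : ℕ) → Bipartition → Set
AdmPair k m n a b β = IsBipartition β × Adm (+ (m ℕ.* suc k)) (+ a) (bead (proj₁ β)) (bead (proj₂ β))
  × Adm (+ (n ℕ.* suc k)) (+ b) (bead (proj₁ β)) (bead (proj₂ β)) × Closed (suc k) (bead (proj₁ β)) × Closed (suc k)
      (bead (proj₂ β))

height⇒Closed : ∀ {g χ π} → IsHeight g χ π → Closed g χ
height⇒Closed {g} {χ} {π} h z p = ≥0-height {π = π} h (subst (0ℤ ≤_)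
  (sym (trans (cong π (lem z (+ g))) (desc-- {+ g} {π} (proj₁ h) 1ℤ z))) (height-≥0 {π = π} h p ⊕ 0≤+ {1}))
  where
  lem : ∀ z g → z - g ≡ z - 1ℤ * g
  lem = solve-∀

-- A partition has charge 0, and the charge of a set with height `π` is the period sum of `π z + 1`.
height-sum : ∀ {k ls π} → IsPartition ls → IsHeight (suc k) (bead ls) π → sumFrom 0ℤ (suc k) π ≡ - + suc k
height-sum {k} {ls} {π} ip h = trans (lem (sumFrom 0ℤ (suc k) π) (+ suc k)) (cong (_- + suc k)
  (trans (sym (trans (sum-+ 0ℤ (suc k) π one) (cong (_+_ (sumFrom 0ℤ (suc k) π))
      (trans (sum-const 0ℤ (suc k) 1ℤ) (*-identityʳ (+ suc k))))))
  (Maya-charge (height-Maya h) (bead-Maya ip))))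
  where
  lem : ∀ x g → x ≡ x + g - g
  lem = solve-∀

height-realise : ∀ {k π} → Quasi (+ suc k) (- 1ℤ) π → sumFrom 0ℤ (suc k) π ≡ - + suc k →
  ∃ λ ls → IsPartition ls × IsHeight (suc k) (bead ls) π
height-realise {k} {π} q s = let ls , ip , h = realise (subst (Maya χ) charge (height-Maya {π = π} (q , λ _ → refl))) in
  ls , ip , q , h
  where
  χ : ℤ → Bool
  χ z = nonneg (π z)
  charge : sumFrom 0ℤ (suc k) (λ z → π z + 1ℤ) ≡ 0ℤ
  charge = trans (sum-+ 0ℤ (suc k) π one) (trans (cong₂ _+_ s (trans (sum-const 0ℤ (suc k) 1ℤ) (*-identityʳ (+ suc k))))
      (+-inverseˡ (+ suc k)))

diff-exists : ∀ {k m n a b} {u v : Vec ℕ (suc k)} → Inverse (+ b - + a) (+ suc k) →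
  InU (suc k) (m ℕ.* suc k) a u → InU (suc k) (n ℕ.* suc k) b v →
  ∃ λ i → i ℕ.< suc k × ∃ λ β → AdmPair k m n a b β × Diff k a b u v i β
diff-exists {k} {m} {n} {a} {b} {u} {v} inv uIn vIn =
  i , n%ℕd<d S (suc k) , (ls , ms) ,
  ((ipl , ipm) , heights⇒Adm {π = π} {κ} (pos-* m (suc k)) hπ hκ (bounds {m} {a} {u} u-diff uIn) ,
    heights⇒Adm {π = π} {κ} (pos-* n (suc k)) hπ hκ (bounds {n} {b} {v} v-diff vIn) , height⇒Closed {π = π} hπ ,
        height⇒Closed {π = κ} hκ) ,
  diff π κ hπ hκ u-diff v-diff
  where
  g d : ℤ
  g = + suc k
  d = + b - + a
  U V δ′ : ℤ → ℤ
  U = periodise u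
  V = periodise v
  -- The result of eliminating `κ`: before any shift, `κ (z - a)` equals both `π z + U z` and
  -- `π (z + d) + V (z + d)`.
  δ′ z = U z - V (z + d)
  V-periodic : Periodic g (λ z → V (z + d))
  V-periodic = quasi-shift {c = 0ℤ} {f = V} d (periodise-periodic v)
  δ′-periodic : Periodic g δ′
  δ′-periodic z = trans (cong₂ _-_ (periodise-periodic u z) (V-periodic z)) (lem (U z) (V (z + d)))
    where
    lem : ∀ x y → x + 0ℤ - (y + 0ℤ) ≡ x - y + 0ℤ
    lem = solve-∀
  δ′-sum : sumFrom 0ℤ (suc k) δ′ ≡ - d
  δ′-sum = trans (sum-- 0ℤ (suc k) U (λ z → V (z + d))) (trans (cong₂ _-_ (proj₁ (InU⇒ {m = m} {u = u} uIn))
    (trans (sum-period-shift (suc k) V (periodise-periodic v) d) (cong (_+ d * 0ℤ) (proj₁ (InU⇒ {m = n} {u = v} vIn)))))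
        (lem (+ a) (+ b)))
    where
    lem : ∀ a b → a - (b + (b - a) * 0ℤ) ≡ - (b - a)
    lem = solve-∀
  solution : ∃ λ σ → Quasi g (- 1ℤ) σ × (∀ z → σ (z + d) ≡ σ z + δ′ z)
  solution = desc-with-differences {k} {d} {δ′} inv δ′-periodic δ′-sum
  σ : ℤ → ℤ
  σ = proj₁ solution
  σ-quasi : Quasi g (- 1ℤ) σ
  σ-quasi = proj₁ (proj₂ solution)
  σ-diff : ∀ z → σ (z + d) ≡ σ z + δ′ z
  σ-diff = proj₂ (proj₂ solution)
  -- `S` is the charge of the solution `σ`. Shifting by `i` lowers it by `i` and subtracting the
  -- constant `q` lowers it by `g * q`, so division with remainder brings it to 0.
  S q : ℤ
  S = sumFrom 0ℤ (suc k) σ + g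
  q = S /ℕ suc k
  i : ℕ
  i = S %ℕ suc k
  π κ : ℤ → ℤ
  π z = σ (z + + i) - q
  κ z = π (z + + a) + U (z + + a + + i)
  π-quasi : Quasi g (- 1ℤ) π
  π-quasi z = trans (cong (_- q) (quasi-shift {f = σ} (+ i) σ-quasi z)) (lem (σ (z + + i)) q)
    where
    lem : ∀ x q → x + - 1ℤ - q ≡ x - q + - 1ℤ
    lem = solve-∀
  π-sum : sumFrom 0ℤ (suc k) π ≡ - g
  π-sum = trans (sum-- 0ℤ (suc k) (λ z → σ (z + + i)) (λ _ → q)) (trans (cong₂ _-_
    (sum-period-shift (suc k) σ σ-quasi (+ i)) (sum-const 0ℤ (suc k) q))
    (trans (lem₁ (sumFrom 0ℤ (suc k) σ) (+ i) g q) (trans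
        (cong (λ x → x - g - (+ i + q * g)) (a≡a%ℕn+[a/ℕn]*n S (suc k))) (lem₂ (+ i + q * g) g))))
    where
    lem₁ : ∀ s i g q → s + i * - 1ℤ - g * q ≡ s + g - g - (i + q * g)
    lem₁ = solve-∀
    lem₂ : ∀ x g → x - g - x ≡ - g
    lem₂ = solve-∀
  Ua-quasi : Periodic g (λ z → U (z + + a + + i))
  Ua-quasi = quasi-shift {c = 0ℤ} {f = λ z → U (z + + i)} (+ a)
      (quasi-shift {c = 0ℤ} {f = U} (+ i) (periodise-periodic u))
  κ-quasi : Quasi g (- 1ℤ) κ
  κ-quasi z = trans (cong₂ _+_ (quasi-shift {f = π} (+ a) π-quasi z) (Ua-quasi z))
      (lem (π (z + + a)) (U (z + + a + + i)))
    where
    lem : ∀ x y → x + - 1ℤ + (y + 0ℤ) ≡ x + y + - 1ℤ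
    lem = solve-∀
  -- No further normalisation is possible or required: the shift by `a` lowers the period sum of `π`
  -- by `a`, and `U` restores it.
  κ-sum : sumFrom 0ℤ (suc k) κ ≡ - g
  κ-sum = trans (sum-+ 0ℤ (suc k) (λ z → π (z + + a)) (λ z → U (z + + a + + i))) (trans (cong₂ _+_
    (trans (sum-period-shift (suc k) π π-quasi (+ a)) (cong (_+ + a * - 1ℤ) π-sum))
    (trans (sum-period-shift (suc k) (λ z → U (z + + i)) (quasi-shift {c = 0ℤ} {f = U} (+ i) (periodise-periodic u))
        (+ a))
      (cong (_+ + a * 0ℤ) (trans (sum-period-shift (suc k) U (periodise-periodic u) (+ i))
          (cong (_+ + i * 0ℤ) (proj₁ (InU⇒ {m = m} {u = u} uIn)))))))
    (lem g (+ a) (+ i)))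
    where
    lem : ∀ g a i → - g + a * - 1ℤ + (a + i * 0ℤ + a * 0ℤ) ≡ - g
    lem = solve-∀
  λ″ : ∃ λ ls → IsPartition ls × IsHeight (suc k) (bead ls) π
  λ″ = height-realise π-quasi π-sum
  μ″ : ∃ λ ms → IsPartition ms × IsHeight (suc k) (bead ms) κ
  μ″ = height-realise κ-quasi κ-sum
  ls ms : List ℕ
  ls = proj₁ λ″
  ms = proj₁ μ″
  ipl : IsPartition ls
  ipl = proj₁ (proj₂ λ″)
  ipm : IsPartition ms
  ipm = proj₁ (proj₂ μ″)
  hπ : IsHeight (suc k) (bead ls) π
  hπ = proj₂ (proj₂ λ″)
  hκ : IsHeight (suc k) (bead ms) κ
  hκ = proj₂ (proj₂ μ″)
  u-diff : ∀ z → κ (z - + a) ≡ π z + U (z + + i)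
  u-diff z = cong (λ w → π w + U (w + + i)) (lem z (+ a))
    where
    lem : ∀ z a → z - a + a ≡ z
    lem = solve-∀
  v-diff : ∀ z → κ (z - + b) ≡ π z + V (z + + i)
  v-diff z = sym (trans (cong₂ (λ x y → x - q + V y) (trans (cong σ (lem₁ z (+ a) (+ b) (+ i))) (σ-diff w))
      (lem₁ z (+ a) (+ b) (+ i)))
    (lem₂ (σ w) (U w) (V (w + d)) q))
    where
    w : ℤ
    w = z - + b + + a + + i
    lem₁ : ∀ z a b i → z + i ≡ z - b + a + i + (b - a)
    lem₁ = solve-∀
    lem₂ : ∀ s u v q → s + (u - v) - q + v ≡ s - q + u
    lem₂ = solve-∀
  bounds : ∀ {m a} {w : Vec ℕ (suc k)} → (∀ z → κ (z - + a) ≡ π z + periodise w (z + + i)) → InU (suc k)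
      (m ℕ.* suc k) a w →
    ∀ z → π z ≤ κ (z - + a) × κ (z - + a) ≤ π z + + m
  bounds {m} {w = w} eq wIn z = let lo , hi = proj₂ (InU⇒ {m = m} {u = w} wIn) (z + + i) in
    ≤-trans (≤-trans (≤-reflexive (sym (+-identityʳ (π z)))) (+-monoʳ-≤ (π z) lo)) (≤-reflexive (sym (eq z))) ,
    ≤-trans (≤-reflexive (eq z)) (+-monoʳ-≤ (π z) hi)

diff-function : ∀ {k m a i ls ms π κ} → IsPartition ls → IsPartition ms → Adm (+ (m ℕ.* suc k)) (+ a) (bead ls)
    (bead ms) →
  IsHeight (suc k) (bead ls) π → IsHeight (suc k) (bead ms) κ →
  ∃ λ (u : Vec ℕ (suc k)) → InU (suc k) (m ℕ.* suc k) a u × (∀ z → κ (z - + a) ≡ π z + periodise u (z + + i))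
diff-function {k} {m} {a} {i} {ls} {ms} {π} {κ} ipl ipm adm hπ hκ = restrict k f ,
    ⇒InU {m = m} {f = f} f-periodic f-bounds f-sum , u-diff
  where
  g : ℤ
  g = + suc k
  f : ℤ → ℤ
  f z = κ (z + (- + i - + a)) - π (z - + i)
  f-periodic : Periodic g f
  f-periodic z = trans (cong₂ _-_ (quasi-shift {f = κ} (- + i - + a) (proj₁ hκ) z)
      (quasi-shift {f = π} (- + i) (proj₁ hπ) z))
    (lem (κ (z + (- + i - + a))) (π (z - + i)))
    where
    lem : ∀ x y → x + - 1ℤ - (y + - 1ℤ) ≡ x - y + 0ℤ
    lem = solve-∀
  f-bounds : ∀ z → 0ℤ ≤ f z × f z ≤ + m
  f-bounds z = let lo , hi = Adm⇒heights {π = π} {κ} (pos-* m (suc k)) hπ hκ adm (z - + i) in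
    ≤-by (gap lo) (trans (cong (λ w → κ w - π (z - + i) - 0ℤ) (lem₀ z (+ i) (+ a))) (+-identityʳ _)) ,
    ≤-by (gap hi) (trans (cong (λ w → + m - (κ w - π (z - + i))) (lem₀ z (+ i) (+ a)))
        (lem₁ (+ m) (κ (z - + i - + a)) (π (z - + i))))
    where
    lem₀ : ∀ z i a → z + (- i - a) ≡ z - i - a
    lem₀ = solve-∀
    lem₁ : ∀ m x y → m - (x - y) ≡ y + m - x
    lem₁ = solve-∀
  -- Both heights sum to `- g` over a period. The common shift by `i` cancels, and reading `κ` a
  -- further `a` places lower raises its sum by `a`.
  f-sum : sumFrom 0ℤ (suc k) f ≡ + a
  f-sum = trans (sum-- 0ℤ (suc k) (λ z → κ (z + (- + i - + a))) (λ z → π (z - + i)))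
    (trans (cong₂ _-_ (trans (sum-period-shift (suc k) κ (proj₁ hκ) (- + i - + a))
        (cong (_+ (- + i - + a) * - 1ℤ) (height-sum ipm hκ)))
      (trans (sum-period-shift (suc k) π (proj₁ hπ) (- + i)) (cong (_+ - + i * - 1ℤ) (height-sum ipl hπ))))
    (lem g (+ i) (+ a)))
    where
    lem : ∀ g i a → - g + (- i - a) * - 1ℤ - (- g + - i * - 1ℤ) ≡ a
    lem = solve-∀
  u-diff : ∀ z → κ (z - + a) ≡ π z + periodise (restrict k f) (z + + i)
  u-diff z = sym (trans (cong (_+_ (π z)) (trans (periodise-restrict {f = f} f-periodic (λ w → proj₁ (f-bounds w))
      (z + + i))
      (cong₂ (λ x y → κ x - π y) (lem₁ z (+ i) (+ a)) (lem₂ z (+ i)))))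
    (lem₃ (κ (z - + a)) (π z)))
    where
    lem₁ : ∀ z i a → z + i + (- i - a) ≡ z - a
    lem₁ = solve-∀
    lem₂ : ∀ z i → z + i - i ≡ z
    lem₂ = solve-∀
    lem₃ : ∀ x y → y + (x - y) ≡ x
    lem₃ = solve-∀

diff-functions : ∀ {k m n a b β} → AdmPair k m n a b β → ∀ i →
  ∃ λ u → ∃ λ v → InU (suc k) (m ℕ.* suc k) a u × InU (suc k) (n ℕ.* suc k) b v × Diff k a b u v i β
diff-functions {k} {m} {n} {a} {b} {ls , ms} ((ipl , ipm) , adm₁ , adm₂ , cl , cm) i =
  from (height-exists (bead-Maya ipl) cl) (height-exists (bead-Maya ipm) cm)
  where
  from : (∃ λ π → IsHeight (suc k) (bead ls) π) → (∃ λ κ → IsHeight (suc k) (bead ms) κ) →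
    ∃ λ u → ∃ λ v → InU (suc k) (m ℕ.* suc k) a u × InU (suc k) (n ℕ.* suc k) b v × Diff k a b u v i (ls , ms)
  from (π , hπ) (κ , hκ) =
    let u , uIn , u-diff = diff-function {k} {m} {a} {i} {π = π} {κ} ipl ipm adm₁ hπ hκ
        v , vIn , v-diff = diff-function {k} {n} {b} {i} {π = π} {κ} ipl ipm adm₂ hπ hκ
    in u , v , uIn , vIn , diff π κ hπ hκ u-diff v-diff

diff-functions-unique : ∀ {k a b u v u′ v′ i β} → Diff k a b u v i β → Diff k a b u′ v′ i β → u ≡ u′ × v ≡ v′
diff-functions-unique {k} {a} {b} {u} {v} {u′} {v′} {i} (diff π κ hπ hκ ud vd) (diff π′ κ′ hπ′ hκ′ ud′ vd′) =
  same u u′ (+ a) ud ud′ , same v v′ (+ b) vd vd′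
  where
  same : ∀ w w′ c → (∀ z → κ (z - c) ≡ π z + periodise w (z + + i)) →
      (∀ z → κ′ (z - c) ≡ π′ z + periodise w′ (z + + i)) → w ≡ w′
  same w w′ c wd wd′ = periodise-injective {k} {w} {w′} λ z → trans (cong (periodise w) (lem z (+ i))) (trans
    (+-cancelˡ (π (z - + i)) (trans (sym (wd (z - + i)))
        (trans (height-unique {π = κ} {κ′} hκ hκ′ (λ _ → refl) (z - + i - c))
      (trans (wd′ (z - + i)) (cong (_+ periodise w′ (z - + i + + i))
          (sym (height-unique {π = π} {π′} hπ hπ′ (λ _ → refl) (z - + i))))))))
    (cong (periodise w′) (sym (lem z (+ i)))))
    where
    lem : ∀ z i → z ≡ z - i + i
    lem = solve-∀

-- The difference `D` of the two shifted heights has the periods `g` and `d`, hence is a constant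
-- `c`. Summing over a period gives `i - i′ = g * c`, and since both shifts lie below `g`, they
-- agree and `c` is 0.
diff-bipartition-unique : ∀ {k a b u v i i′ β β′} → Inverse (+ b - + a) (+ suc k) → i ℕ.< suc k → i′ ℕ.< suc k →
  IsBipartition β → IsBipartition β′ → Diff k a b u v i β → Diff k a b u v i′ β′ → i ≡ i′ × β ≡ β′
diff-bipartition-unique {k} {a} {b} {u} {v} {i} {i′} {ls , ms} {ls′ , ms′} inv i< i′< (ipl , ipm) (ipl′ , ipm′)
  (diff π κ hπ hκ ud vd) (diff π′ κ′ hπ′ hκ′ ud′ vd′) =
  i≡i′ , cong₂ _,_ (bead-injective ipl ipl′ λ z → trans (proj₂ hπ z) (trans (cong nonneg (π≡ z)) (sym (proj₂ hπ′ z))))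
                   (bead-injective ipm ipm′ λ z → trans (proj₂ hκ z) (trans (cong nonneg (κ≡ z)) (sym (proj₂ hκ′ z))))
  where
  g d : ℤ
  g = + suc k
  d = + b - + a
  U V D : ℤ → ℤ
  U = periodise u
  V = periodise v
  D z = π (z - + i) - π′ (z - + i′)
  D-periodic-g : Periodic g D
  D-periodic-g z = trans (cong₂ _-_ (quasi-shift {f = π} (- + i) (proj₁ hπ) z)
      (quasi-shift {f = π′} (- + i′) (proj₁ hπ′) z))
    (lem (π (z - + i)) (π′ (z - + i′)))
    where
    lem : ∀ x y → x + - 1ℤ - (y + - 1ℤ) ≡ x - y + 0ℤ
    lem = solve-∀
  step : ∀ {i π κ} → (∀ z → κ (z - + a) ≡ π z + U (z + + i)) → (∀ z → κ (z - + b) ≡ π z + V (z + + i)) →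
    ∀ z → π (z + d - + i) ≡ π (z - + i) + (U z - V (z + d))
  step {i} {π} {κ} ud vd z = solve-for (π (z + d - + i)) (π (z - + i)) (U z) (V (z + d)) (trans
      (trans (cong (λ w → π (z + d - + i) + V w) (lem₁ (z + d) (+ i))) (sym (vd (z + d - + i))))
      (trans (cong κ (lem₂ z (+ a) (+ b) (+ i))) (trans (ud (z - + i))
          (cong (λ w → π (z - + i) + U w) (sym (lem₁ z (+ i)))))))
    where
    lem₁ : ∀ z i → z ≡ z - i + i
    lem₁ = solve-∀
    lem₂ : ∀ z a b i → z + (b - a) - i - b ≡ z - i - a
    lem₂ = solve-∀
    solve-for : ∀ p q x y → p + y ≡ q + x → p ≡ q + (x - y)
    solve-for p q x y eq = trans (lem₃ p y) (trans (cong (_- y) eq) (lem₄ q x y))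
      where
      lem₃ : ∀ p y → p ≡ p + y - y
      lem₃ = solve-∀
      lem₄ : ∀ q x y → q + x - y ≡ q + (x - y)
      lem₄ = solve-∀
  D-periodic-d : Periodic d D
  D-periodic-d z = trans (cong₂ _-_ (step {i} {π} {κ} ud vd z) (step {i′} {π′} {κ′} ud′ vd′ z))
      (lem (π (z - + i)) (π′ (z - + i′)) (U z - V (z + d)))
    where
    lem : ∀ x y e → x + e - (y + e) ≡ x - y + 0ℤ
    lem = solve-∀
  c : ℤ
  c = D 0ℤ
  D≡c : ∀ z → D z ≡ c
  D≡c = coprime-periods {f = D} inv D-periodic-g D-periodic-d
  D-sum : + i - + i′ ≡ g * c
  D-sum = begin
    + i - + i′
      ≡⟨ lem g (+ i) (+ i′) ⟩
    (- g + - + i * - 1ℤ) - (- g + - + i′ * - 1ℤ)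
      ≡⟨ cong₂ _-_ (trans (sum-period-shift (suc k) π (proj₁ hπ) (- + i)) (cong (_+ - + i * - 1ℤ) (height-sum ipl hπ)))
                   (trans (sum-period-shift (suc k) π′ (proj₁ hπ′) (- + i′))
                       (cong (_+ - + i′ * - 1ℤ) (height-sum ipl′ hπ′))) ⟨
    sumFrom 0ℤ (suc k) (λ z → π (z - + i)) - sumFrom 0ℤ (suc k) (λ z → π′ (z - + i′))
      ≡⟨ sum-- 0ℤ (suc k) (λ z → π (z - + i)) (λ z → π′ (z - + i′)) ⟨
    sumFrom 0ℤ (suc k) D
      ≡⟨ trans (sum-cong 0ℤ (suc k) D≡c) (sum-const 0ℤ (suc k) c) ⟩
    g * c ∎
    where
    open ≡-Reasoning
    lem : ∀ g i i′ → i - i′ ≡ (- g + - i * - 1ℤ) - (- g + - i′ * - 1ℤ)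
    lem = solve-∀
  i≡i′,0≡c : i ≡ i′ × 0ℤ ≡ c
  i≡i′,0≡c = divMod-unique 0ℤ c i< i′< (trans (lem₁ (+ i) (+ i′) g)
      (trans (cong (_+_ (+ i′)) D-sum) (cong (_+_ (+ i′)) (*-comm g c))))
    where
    lem₁ : ∀ i i′ g → i + 0ℤ * g ≡ i′ + (i - i′)
    lem₁ = solve-∀
  i≡i′ : i ≡ i′
  i≡i′ = proj₁ i≡i′,0≡c
  π≡ : ∀ z → π z ≡ π′ z
  π≡ z = trans (cong π (lem z (+ i))) (trans (i-j≡0⇒i≡j _ _ (trans (D≡c (z + + i)) (sym (proj₂ i≡i′,0≡c))))
    (cong π′ (trans (cong (λ j → z + + i - + j) (sym i≡i′)) (sym (lem z (+ i))))))
    where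
    lem : ∀ z i → z ≡ z + i - i
    lem = solve-∀
  κ≡ : ∀ z → κ z ≡ κ′ z
  κ≡ z = trans (cong κ (lem z (+ a))) (trans (ud (z + + a))
      (trans (cong₂ (λ x j → x + U (z + + a + + j)) (π≡ (z + + a)) i≡i′)
    (trans (sym (ud′ (z + + a))) (cong κ′ (sym (lem z (+ a)))))))
    where
    lem : ∀ z a → z ≡ z + a - a
    lem = solve-∀

-- Counting

-- Formulated for a relation, so that one and the same relation can be used in either direction
-- without first being made into a function.
injection-length : ∀ {A B : Set} (xs : List A) (ys : List B) (R : A → B → Set) → Unique xs →
  (∀ {x} → x ∈ xs → ∃ λ y → y ∈ ys × R x y) → (∀ {x x′ y} → x ∈ xs → x′ ∈ xs → R x y → R x′ y → x ≡ x′) →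
      length xs ℕ.≤ length ys
injection-length []       ys R _ _ _ = z≤n
injection-length {A} {B} (x ∷ xs) ys R (x∉ ∷ uniq) total inj with total (here refl)
... | y , y∈ , Rxy with ∈-∃++ y∈
...   | as , bs , refl = ℕ.≤-trans (s≤s (injection-length xs (as ++ bs) R uniq total′ λ p q → inj (there p) (there q)))
  (ℕ.≤-reflexive (trans (cong suc (length-++ as)) (trans (sym (ℕ.+-suc (length as) (length bs))) (sym (length-++ as)))))
  where
  total′ : ∀ {x′} → x′ ∈ xs → ∃ λ y′ → y′ ∈ as ++ bs × R x′ y′
  total′ {x′} x′∈ with total (there x′∈)
  ... | y′ , y′∈ , Rx′y′ with ∈-resp-↭ (shift y as bs) y′∈
  ...   | here refl = ⊥-elim (All.lookup x∉ x′∈ (inj (here refl) (there x′∈) Rxy Rx′y′))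
  ...   | there r = y′ , r , Rx′y′

HasCard-unique : ∀ {A : Set} {P : A → Set} {m n} → HasCard P m → HasCard P n → m ≡ n
HasCard-unique (xs , ux , refl , hx) (ys , uy , refl , hy) = ℕ.≤-antisym
  (injection-length xs ys _≡_ ux (λ {x} p → x , Equivalence.from (hy x) (Equivalence.to (hx x) p) , refl)
      λ { _ _ refl refl → refl })
  (injection-length ys xs _≡_ uy (λ {x} p → x , Equivalence.from (hx x) (Equivalence.to (hy x) p) , refl)
      λ { _ _ refl refl → refl })

HasCard-⇔ : ∀ {A : Set} {P Q : A → Set} {n} → (∀ x → P x → Q x) → (∀ x → Q x → P x) → HasCard P n → HasCard Q n
HasCard-⇔ f h (xs , u , l , e) = xs , u , l , λ x → mk⇔ (λ p → f x (Equivalence.to (e x) p))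
    (λ q → Equivalence.from (e x) (h x q))

length-cartesianProduct : ∀ {A B : Set} (xs : List A) (ys : List B) → length
    (cartesianProduct xs ys) ≡ length xs ℕ.* length ys
length-cartesianProduct []       ys = refl
length-cartesianProduct (x ∷ xs) ys = trans (length-++ (map (x ,_) ys))
    (cong₂ ℕ._+_ (length-map (x ,_) ys) (length-cartesianProduct xs ys))

HasCard-× : ∀ {A B : Set} {P : A → Set} {Q : B → Set} {m n} → HasCard P m → HasCard Q n → HasCard
    (λ (x , y) → P x × Q y) (m ℕ.* n)
HasCard-× (xs , ux , refl , hx) (ys , uy , refl , hy) = cartesianProduct xs ys , cartesianProduct⁺ ux uy ,
    length-cartesianProduct xs ys ,
  λ (x , y) → mk⇔ (λ p → let q , r = ∈-cartesianProduct⁻ xs ys p in Equivalence.to (hx x) q , Equivalence.to (hy y) r)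
                  (λ (p , q) → ∈-cartesianProduct⁺ (Equivalence.from (hx x) p) (Equivalence.from (hy y) q))

∈-mapWith∈⁺ : ∀ {A B : Set} (xs : List A) (f : ∀ {x} → x ∈ xs → B) {x} (p : x ∈ xs) → f p ∈ mapWith∈ xs f
∈-mapWith∈⁺ (x ∷ xs) f (here refl) = here refl
∈-mapWith∈⁺ (x ∷ xs) f (there p)   = there (∈-mapWith∈⁺ xs (λ q → f (there q)) p)

∈-mapWith∈⁻ : ∀ {A B : Set} (xs : List A) (f : ∀ {x} → x ∈ xs → B) {y} → y ∈ mapWith∈ xs f → ∃ λ x → Σ (x ∈ xs) λ p →
    y ≡ f p
∈-mapWith∈⁻ (x ∷ xs) f (here refl) = x , here refl , refl
∈-mapWith∈⁻ (x ∷ xs) f (there q) with ∈-mapWith∈⁻ xs (λ p → f (there p)) q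
... | x′ , p , eq = x′ , there p , eq

-- `R` matches the elements of `P` with the pairs of an index below `suc k` and an element of `Q`.
-- No enumeration of `Q` is assumed: it is obtained by collecting the `B`-components over `P` and
-- deleting repetitions, so finiteness of the set of cores is part of the conclusion.
HasCard-fibred : ∀ {A B : Set} {P : A → Set} {Q : B → Set} {m} (R : A → ℕ → B → Set) k → DecidableEquality B →
    HasCard P m →
  (∀ a → P a → ∃ λ i → i ℕ.< suc k × ∃ λ b → Q b × R a i b) →
  (∀ b → Q b → ∀ i → ∃ λ a → P a × R a i b) →
  (∀ {a a′ i b} → R a i b → R a′ i b → a ≡ a′) →
  (∀ {a i i′ b b′} → i ℕ.< suc k → i′ ℕ.< suc k → Q b → Q b′ → R a i b → R a i′ b′ → i ≡ i′ × b ≡ b′) →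
  ∃ λ n → HasCard Q n × suc k ℕ.* n ≡ m
HasCard-fibred {A} {B} {P} {Q} R k _≟B_ (xs , ux , refl , hx) forth back inj-A inj-B =
  length bs , (bs , DecUnique.deduplicate-! _≟B_ image , refl , λ b → mk⇔ bs⇒Q Q⇒bs) ,
  trans (cong (ℕ._* length bs) (sym (length-upTo (suc k))))
      (trans (sym (length-cartesianProduct (upTo (suc k)) bs)) (ℕ.≤-antisym
    (injection-length pairs xs (λ (i , b) a → R a i b) (cartesianProduct⁺ (upTo⁺ (suc k))
        (DecUnique.deduplicate-! _≟B_ image))
      (λ {(i , b)} p → let a , Pa , r = back b (bs⇒Q (proj₂ (∈-cartesianProduct⁻ (upTo (suc k)) bs p))) i in a , Equivalence.from (hx a) Pa , r)
      λ p p′ r r′ → let i∈ , b∈ = ∈-cartesianProduct⁻ (upTo (suc k)) bs p ; i′∈ , b′∈ = ∈-cartesianProduct⁻ (upTo (suc k)) bs p′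
                        i≡ , b≡ = inj-B (∈-upTo⁻ i∈) (∈-upTo⁻ i′∈) (bs⇒Q b∈) (bs⇒Q b′∈) r r′ in cong₂ _,_ i≡ b≡)
    (injection-length xs pairs (λ a (i , b) → R a i b) ux
      (λ {a} p → let i , i< , b , Qb , r = forth a (Equivalence.to (hx a) p) in (i , b) , ∈-cartesianProduct⁺ (∈-upTo⁺ i<) (Q⇒bs Qb) , r)
      λ _ _ r r′ → inj-A r r′)))
  where
  choose : ∀ {a} → a ∈ xs → ∃ λ i → i ℕ.< suc k × ∃ λ b → Q b × R a i b
  choose {a} p = forth a (Equivalence.to (hx a) p)
  value : ∀ {a} → a ∈ xs → B
  value p = proj₁ (proj₂ (proj₂ (choose p)))
  image bs : List B
  image = mapWith∈ xs value
  bs = deduplicate _≟B_ image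
  pairs : List (ℕ × B)
  pairs = cartesianProduct (upTo (suc k)) bs
  bs⇒Q : ∀ {b} → b ∈ bs → Q b
  bs⇒Q p with ∈-mapWith∈⁻ xs value (∈-deduplicate⁻ _≟B_ image p)
  ... | a , a∈ , refl = proj₁ (proj₂ (proj₂ (proj₂ (choose a∈))))
  Q⇒bs : ∀ {b} → Q b → b ∈ bs
  Q⇒bs {b} Qb with back b Qb 0
  ... | a , Pa , r with Equivalence.from (hx a) Pa
  ...   | a∈ with choose a∈ in eq
  ...     | i , i< , b′ , Qb′ , r′ = subst (_∈ bs) (trans (cong (λ c → proj₁ (proj₂ (proj₂ c))) eq)
            (sym (proj₂ (inj-B (s≤s z≤n) i< Qb Qb′ r r′)))) (∈-deduplicate⁺ _≟B_ (∈-mapWith∈⁺ xs value a∈))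

-- Enumeration of bounded and of binary vectors

boundedVecs : ℕ → ∀ n → List (Vec ℕ n)
boundedVecs m zero    = [] ∷ []
boundedVecs m (suc n) = cartesianProductWith _∷_ (upTo (suc m)) (boundedVecs m n)

boundedVecs-unique : ∀ m n → Unique (boundedVecs m n)
boundedVecs-unique m zero    = [] ∷ []
boundedVecs-unique m (suc n) = cartesianProductWith⁺ _∷_ (λ { refl → refl , refl }) (upTo⁺ (suc m))
    (boundedVecs-unique m n)

∈-boundedVecs⁺ : ∀ {m n} (u : Vec ℕ n) → All (ℕ._≤ m) (toList u) → u ∈ boundedVecs m n
∈-boundedVecs⁺ []      []       = here refl
∈-boundedVecs⁺ (x ∷ u) (p ∷ ps) = ∈-cartesianProductWith⁺ _∷_ (∈-upTo⁺ (s≤s p)) (∈-boundedVecs⁺ u ps)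

∈-boundedVecs⁻ : ∀ {m n} (u : Vec ℕ n) → u ∈ boundedVecs m n → All (ℕ._≤ m) (toList u)
∈-boundedVecs⁻ []      _ = []
∈-boundedVecs⁻ {m} {suc n} (x ∷ u) p with ∈-cartesianProductWith⁻ _∷_ (upTo (suc m)) (boundedVecs m n) p
... | _ , _ , x∈ , u∈ , refl = ℕ.≤-pred (∈-upTo⁻ x∈) ∷ ∈-boundedVecs⁻ u u∈

HasCard-InU : ∀ g s a → ∃ λ m → HasCard (InU g s a) m
HasCard-InU g s a = length us , us , filter⁺ sum≟a (boundedVecs-unique (quot s g) g) , refl , λ u → mk⇔
  (λ p → let q , eq = ∈-filter⁻ sum≟a p in eq , ∈-boundedVecs⁻ u q) (λ (eq , ps) → ∈-filter⁺ sum≟a (∈-boundedVecs⁺ u ps) eq)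
  where
  sum≟a = λ (u : Vec ℕ g) → sum (toList u) ℕ.≟ a
  us : List (Vec ℕ g)
  us = filter sum≟a (boundedVecs (quot s g) g)

-- For `g = s` the entries are at most `s / s = 1`. The recursion on the first entry is Pascal's
-- rule, so the lengths are binomial coefficients.
binaryVecs : ∀ n → ℕ → List (Vec ℕ n)
binaryVecs zero    zero    = [] ∷ []
binaryVecs zero    (suc a) = []
binaryVecs (suc n) zero    = map (0 ∷_) (binaryVecs n 0)
binaryVecs (suc n) (suc a) = map (0 ∷_) (binaryVecs n (suc a)) ++ map (1 ∷_) (binaryVecs n a)

∷-injectiveʳ : ∀ {n} x {u v : Vec ℕ n} → _≡_ {A = Vec ℕ (suc n)} (x ∷ u) (x ∷ v) → u ≡ v
∷-injectiveʳ x refl = refl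

binaryVecs-unique : ∀ n a → Unique (binaryVecs n a)
binaryVecs-unique zero    zero    = [] ∷ []
binaryVecs-unique zero    (suc a) = []
binaryVecs-unique (suc n) zero    = map⁺ (∷-injectiveʳ 0) (binaryVecs-unique n 0)
binaryVecs-unique (suc n) (suc a) = ++⁺ (map⁺ (∷-injectiveʳ 0) (binaryVecs-unique n (suc a)))
    (map⁺ (∷-injectiveʳ 1) (binaryVecs-unique n a))
  λ (p , q) → disjoint (∈-map⁻ (0 ∷_) p) (∈-map⁻ (1 ∷_) q)
  where
  disjoint : ∀ {w} → (∃ λ u → u ∈ binaryVecs n (suc a) × w ≡ 0 ∷ u) → (∃ λ v → v ∈ binaryVecs n a × w ≡ 1 ∷ v) → ⊥
  disjoint (_ , _ , refl) (_ , _ , ())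

length-binaryVecs : ∀ n a → length (binaryVecs n a) ≡ n C a
length-binaryVecs zero    zero    = refl
length-binaryVecs zero    (suc a) = sym (k>n⇒nCk≡0 {0} {suc a} (s≤s z≤n))
length-binaryVecs (suc n) zero    = trans (length-map (0 ∷_) (binaryVecs n 0))
    (trans (length-binaryVecs n 0) (trans (nC0≡1 n) (sym (nC0≡1 (suc n)))))
  where
  nC0≡1 : ∀ n → n C 0 ≡ 1
  nC0≡1 n = trans (nCk≡nC[n∸k] {0} {n} z≤n) (nCn≡1 n)
length-binaryVecs (suc n) (suc a) = trans (length-++ (map (0 ∷_) (binaryVecs n (suc a)))) (trans (cong₂ ℕ._+_
    (trans (length-map (0 ∷_) (binaryVecs n (suc a))) (length-binaryVecs n (suc a)))
    (trans (length-map (1 ∷_) (binaryVecs n a)) (length-binaryVecs n a)))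
  (trans (ℕ.+-comm (n C suc a) (n C a)) (nCk+nC[k+1]≡[n+1]C[k+1] n a)))

∈-binaryVecs⁺ : ∀ {n} (u : Vec ℕ n) {a} → sum (toList u) ≡ a → All (ℕ._≤ 1) (toList u) → u ∈ binaryVecs n a
∈-binaryVecs⁺ [] refl _ = here refl
∈-binaryVecs⁺ (zero ∷ u) {zero} eq (_ ∷ ps) = ∈-map⁺ (0 ∷_) (∈-binaryVecs⁺ u eq ps)
∈-binaryVecs⁺ (zero ∷ u) {suc a} eq (_ ∷ ps) = ∈-++⁺ˡ (∈-map⁺ (0 ∷_) (∈-binaryVecs⁺ u eq ps))
∈-binaryVecs⁺ (suc zero ∷ u) {suc a} eq (_ ∷ ps) = ∈-++⁺ʳ (map (0 ∷_) (binaryVecs _ (suc a)))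
    (∈-map⁺ (1 ∷_) (∈-binaryVecs⁺ u (ℕ.suc-injective eq) ps))
∈-binaryVecs⁺ (suc (suc x) ∷ u) eq (s≤s () ∷ ps)

∈-binaryVecs⁻ : ∀ {n} (u : Vec ℕ n) {a} → u ∈ binaryVecs n a → sum (toList u) ≡ a × All (ℕ._≤ 1) (toList u)
∈-binaryVecs⁻ [] {zero} _ = refl , []
∈-binaryVecs⁻ (x ∷ u) {zero} p with ∈-map⁻ (0 ∷_) p
... | v , v∈ , refl = let eq , ps = ∈-binaryVecs⁻ v v∈ in eq , z≤n ∷ ps
∈-binaryVecs⁻ (x ∷ u) {suc a} p with ∈-++⁻ (map (0 ∷_) (binaryVecs _ (suc a))) p
... | inj₁ q with ∈-map⁻ (0 ∷_) q
...   | v , v∈ , refl = let eq , ps = ∈-binaryVecs⁻ v v∈ in eq , z≤n ∷ ps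
∈-binaryVecs⁻ (x ∷ u) {suc a} p | inj₂ q with ∈-map⁻ (1 ∷_) q
...   | v , v∈ , refl = let eq , ps = ∈-binaryVecs⁻ v v∈ in cong suc eq , s≤s z≤n ∷ ps

HasCard-InU-C : ∀ k a → HasCard (InU (suc k) (suc k) a) (suc k C a)
HasCard-InU-C k a = binaryVecs (suc k) a , binaryVecs-unique (suc k) a , length-binaryVecs (suc k) a , λ u → mk⇔
  (λ p → let eq , ps = ∈-binaryVecs⁻ u p in eq , subst (λ m → All (ℕ._≤ m) (toList u)) (sym (n/n≡1 (suc k))) ps)
  (λ (eq , ps) → ∈-binaryVecs⁺ u eq (subst (λ m → All (ℕ._≤ m) (toList u)) (n/n≡1 (suc k)) ps))

-- From nested β-sets to the count of simultaneous cores

_≟ᵇ_ : DecidableEquality Bipartition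
_≟ᵇ_ = Product.≡-dec (List.≡-dec ℕ._≟_) (List.≡-dec ℕ._≟_)

core⇒Adm : ∀ {s a β} → 0 ℕ.< s → a ℕ.< s → IsCore s (+ 0 , + a) β → Adm (+ s) (+ a) (bead (proj₁ β)) (bead (proj₂ β))
core⇒Adm {suc k} _ a<s core = IsCore⇒Adm {k} 0≤+ (+≤+ (ℕ.<⇒≤ a<s)) core

Adm⇒core : ∀ {s a β} → 0 ℕ.< s → IsBipartition β → Adm (+ s) (+ a) (bead (proj₁ β)) (bead (proj₂ β)) → IsCore s
    (+ 0 , + a) β
Adm⇒core {suc k} {a} _ ib adm = Adm⇒IsCore {k} {+ a} ib adm

HasCard-AdmPair : ∀ k m n a b → Coprime (suc k) ∣ (+ a) - (+ b) ∣ → ∃ λ N → ∃ λ M → ∃ λ K →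
  HasCard (AdmPair k m n a b) N × HasCard (InU (suc k) (m ℕ.* suc k) a) M × HasCard (InU (suc k) (n ℕ.* suc k) b) K ×
      suc k ℕ.* N ≡ M ℕ.* K
HasCard-AdmPair k m n a b cop =
  let M , hM = HasCard-InU (suc k) (m ℕ.* suc k) a
      K , hK = HasCard-InU (suc k) (n ℕ.* suc k) b
      N , hN , eq = HasCard-fibred (λ (u , v) i β → Diff k a b u v i β) k _≟ᵇ_ (HasCard-× hM hK)
        (λ (u , v) (uIn , vIn) → diff-exists {k} {m} {n} {a} {b} {u} {v} inv uIn vIn)
        (λ β adm i → let u , v , uIn , vIn , d = diff-functions {k} {m} {n} adm i in (u , v) , (uIn , vIn) , d)
        (λ d d′ → let u≡ , v≡ = diff-functions-unique d d′ in cong₂ _,_ u≡ v≡)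
        (λ i< i′< adm adm′ d d′ → diff-bipartition-unique inv i< i′< (proj₁ adm) (proj₁ adm′) d d′)
  in N , M , K , hN , hM , hK , eq
  where
  inv : Inverse (+ b - + a) (+ suc k)
  inv = coprime-inverse (subst (Coprime (suc k)) (∣i-j∣≡∣j-i∣ (+ a) (+ b)) cop)

-- `g` is a parameter so that, when `s ∣ t`, the count can be transported along the equality of
-- `gcd s t` and `s`.
CoreCount : ℕ → ℕ → ℕ → ℕ → ℕ → Set
CoreCount g s t a b = ∃ λ N → ∃ λ M → ∃ λ K →
    HasCard (λ β → IsCore s (+ 0 , + a) β × IsCore t (+ 0 , + b) β × IsGCore² g β) N
  × HasCard (InU g s a) M
  × HasCard (InU g t b) K
  × g ℕ.* N ≡ M ℕ.* K

-- With `g` a variable, matching on the divisibility proofs replaces `s` and `t` by multiples of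
-- `suc k`, the form used by `AdmPair`.
core-count : ∀ g s t a b → g ≢ 0 → g ∣ s → g ∣ t → 0 ℕ.< s → 0 ℕ.< t → a ℕ.< s → b ℕ.< t →
  Coprime g ∣ (+ a) - (+ b) ∣ → CoreCount g s t a b
core-count zero s t a b g≢0 = ⊥-elim (g≢0 refl)
core-count (suc k) s t a b _ (divides m refl) (divides n refl) 0<s 0<t a<s b<t cop =
  let N , M , K , hN , rest = HasCard-AdmPair k m n a b cop in
  N , M , K , HasCard-⇔
    (λ β (ib , adm₁ , adm₂ , cl , cm) → Adm⇒core 0<s ib adm₁ , Adm⇒core 0<t ib adm₂ ,
      Closed⇒IsGCore (proj₁ ib) cl , Closed⇒IsGCore (proj₂ ib) cm)
    (λ β (core₁ , core₂ , g₁ , g₂) → proj₁ core₁ , core⇒Adm 0<s a<s core₁ , core⇒Adm 0<t b<t core₂ ,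
      IsGCore⇒Closed (proj₁ (proj₁ core₁)) g₁ , IsGCore⇒Closed (proj₂ (proj₁ core₁)) g₂)
    hN , rest

-- This is why the condition on components disappears from the case `s ∣ t`: there the gcd is `s`,
-- and a core for `s` satisfies it automatically.
IsCore⇒IsGCore² : ∀ {s a β} → 0 ℕ.< s → a ℕ.< s → IsCore s (+ 0 , + a) β → IsGCore² s β
IsCore⇒IsGCore² {s} {a} 0<s a<s core = let cl , cm = Adm⇒Closed {s} {+ a} (core⇒Adm 0<s a<s core) in
  Closed⇒IsGCore (proj₁ (proj₁ core)) cl , Closed⇒IsGCore (proj₂ (proj₁ core)) cm

theorem4p2 : (s t a b : ℕ) → 0 ℕ.< s → 0 ℕ.< t → a ℕ.< s → b ℕ.< t →
    Coprime (gcd s t) ∣ (+ a) - (+ b) ∣ →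
    (∃ λ N → ∃ λ M → ∃ λ K →
    HasCard (λ β → IsCore s (+ 0 , + a) β × IsCore t (+ 0 , + b) β × IsGCore² (gcd s t) β) N
    × HasCard (InU (gcd s t) s a) M
    × HasCard (InU (gcd s t) t b) K
    × gcd s t ℕ.* N ≡ M ℕ.* K)
    × (s ∣ t →
    ∃ λ N → ∃ λ K →
    HasCard (λ β → IsCore s (+ 0 , + a) β × IsCore t (+ 0 , + b) β) N
    × HasCard (InU s t b) K
    × s ℕ.* N ≡ (s C a) ℕ.* K)
theorem4p2 s@(suc s-1) t a b 0<s 0<t a<s b<t cop = general , special
  where
  general : CoreCount (gcd s t) s t a b
  general = core-count (gcd s t) s t a b (gcd[m,n]≢0 s t (inj₁ λ ())) (gcd[m,n]∣m s t)
      (gcd[m,n]∣n s t) 0<s 0<t a<s b<t cop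
  special : s ∣ t → ∃ λ N → ∃ λ K →
    HasCard (λ β → IsCore s (+ 0 , + a) β × IsCore t (+ 0 , + b) β) N × HasCard (InU s t b) K × s ℕ.* N ≡ (s C a) ℕ.* K
  special s∣t =
    let N , M , K , hN , hM , hK , eq = subst (λ g → CoreCount g s t a b) (∣-antisym (gcd[m,n]∣m s t) (gcd-greatest ∣-refl s∣t)) general
    in N , K , HasCard-⇔ (λ _ (c , c′ , _) → c , c′) (λ _ (c , c′) → c , c′ , IsCore⇒IsGCore² 0<s a<s c) hN , hK ,
       trans eq (cong (ℕ._* K) (HasCard-unique hM (HasCard-InU-C s-1 a)))
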